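{- Let $C$ be the curve in $\mathbb{R}^2$ that contains the graph of $y=\tfrac34x^2-1$, $-\tfrac23\le x\le\tfrac23$, and that is invariant under rotation by $\pi/2$ about the origin (i.e. $C$ is the union of this parabolic arc and its images under rotations by $\pi/2,\pi,3\pi/2$). Then the scaled Jarník polygons $\tilde P_Q$ converge to $C$ as $Q\to\infty$: for every $\varepsilon>0$ there is $Q_0(\varepsilon)$ such that for all integers $Q>Q_0(\varepsilon)$, every point of $\tilde P_Q$ lies at distance less than $\varepsilon$ from $C$.
   Context: For a positive integer $Q$, let $V_Q=\{(q,a)\in\mathbb{Z}^2:\gcd(q,a)=1,\ \max\{|q|,|a|\}\le Q\}$ (so e.g. $(1,0),(0,1)\in V_Q$). The Jarník polygon $P_Q$ is the convex polygon, unique up to translation, whose edges (as vectors, traversed counterclockwise) are exactly the vectors of $V_Q$, each used once. $P_Q$ has the eight-fold dihedral symmetry of the square $[-1,1]^2$ about its center. The scaled polygon $\tilde P_Q$ is obtained by translating $P_Q$ so that its center of symmetry is the origin and then scaling by a positive factor so that the edge corresponding to the vector $(1,0)$ has midpoint $(0,-1)$; thus $\tilde P_Q$ passes through $(\pm1,0)$ and $(0,\pm1)$. Polygons are regarded as closed curves (their boundaries).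
   Formalization: The number ε and the points of the scaled polygon are taken rational (rational position along each edge), and the nearby point of C is rational; the real statement follows by density of rational points on each edge. -}

module Defs where

open import Data.Bool using (Bool; true; false; _∧_; _∨_; not)
open import Data.Nat as ℕ using (ℕ)
open import Data.Nat.GCD using (gcd)
open import Data.Integer as ℤ using (ℤ; +_; ∣_∣)
open import Data.Rational as ℚ using (ℚ; 0ℚ; 1ℚ)
open import Data.Product using (_×_; _,_; proj₁; proj₂; Σ; ∃)
open import Data.List using (List; []; _∷_; map; filter; upTo; concatMap; foldr; length)
open import Relation.Nullary using (does)
open import Relation.Binary.PropositionalEquality using (_≡_)
open import Data.Sum using (_⊎_)
open import Data.List.Membership.Propositional using (_∈_)

V2 : Set
V2 = ℤ × ℤ

intRange : ℕ → List ℤ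
intRange Q = map (λ k → (+ k) ℤ.- (+ Q)) (upTo (2 ℕ.* Q ℕ.+ 1))

coprimeᵇ : V2 → Bool
coprimeᵇ (q , a) = does (gcd ∣ q ∣ ∣ a ∣ ℕ.≟ 1)

VQ : ℕ → List V2
VQ Q = filter (λ v → coprimeᵇ v ≟ᵇ true)
         (concatMap (λ q → map (λ a → (q , a)) (intRange Q)) (intRange Q))
  where
  open import Data.Bool.Properties using () renaming (_≟_ to _≟ᵇ_)

-- angular order on nonzero vectors, argument measured in [0, 2π) starting at (1,0)
-- upper u : arg u ∈ [0, π)
upper : V2 → Bool
upper (x , y) = does (+ 0 ℤ.<? y) ∨ (does (y ℤ.≟ + 0) ∧ does (+ 0 ℤ.<? x))

cross : V2 → V2 → ℤ
cross (x₁ , y₁) (x₂ , y₂) = x₁ ℤ.* y₂ ℤ.- y₁ ℤ.* x₂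

sameᵇ : Bool → Bool → Bool
sameᵇ true b = b
sameᵇ false b = not b

-- before u w : arg u < arg w
before : V2 → V2 → Bool
before u w = (upper u ∧ not (upper w)) ∨ (sameᵇ (upper u) (upper w) ∧ does (+ 0 ℤ.<? cross u w))

_+ᵥ_ : V2 → V2 → V2
(a , b) +ᵥ (c , d) = (a ℤ.+ c , b ℤ.+ d)

sumV : List V2 → V2
sumV = foldr _+ᵥ_ (+ 0 , + 0)

-- Jarník polygon P_Q (translation fixed so that the edge (1,0) starts at the origin):
-- traversing counterclockwise, the edge with vector e starts at the sum of all
-- edge vectors of smaller argument.
edgeStart : ℕ → V2 → V2
edgeStart Q e = sumV (filter (λ w → before w e ≟ᵇ true) (VQ Q))
  where
  open import Data.Bool.Properties using () renaming (_≟_ to _≟ᵇ_)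

toℚ : ℤ → ℚ
toℚ z = z ℚ./ 1

Q2 : Set
Q2 = ℚ × ℚ

-- centre of symmetry of P_Q = average of its vertices (the vertices are the edge starts)
sumQ2 : List Q2 → Q2
sumQ2 = foldr (λ p r → (proj₁ p ℚ.+ proj₁ r , proj₂ p ℚ.+ proj₂ r)) (0ℚ , 0ℚ)

invLen : ℕ → ℚ
invLen ℕ.zero = 0ℚ
invLen (ℕ.suc m) = (+ 1) ℚ./ ℕ.suc m

centre : ℕ → Q2
centre Q = ( proj₁ s ℚ.* invLen (length (VQ Q)) , proj₂ s ℚ.* invLen (length (VQ Q)) )
  where
  s : Q2
  s = sumQ2 (map (λ e → (toℚ (proj₁ (edgeStart Q e)) , toℚ (proj₂ (edgeStart Q e)))) (VQ Q))

-- λ is an admissible scaling factor: positive, and it maps the midpoint of the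
-- (1,0)-edge (which is (1/2, 0) in our translation), after centring, to (0,-1)
IsScale : ℕ → ℚ → Set
IsScale Q λ₀ = (0ℚ ℚ.< λ₀)
  × (λ₀ ℚ.* (((+ 1) ℚ./ 2) ℚ.- proj₁ (centre Q)) ≡ 0ℚ)
  × (λ₀ ℚ.* (0ℚ ℚ.- proj₂ (centre Q)) ≡ ℚ.- 1ℚ)

OnScaledPolygon : ℕ → ℚ → Q2 → Set
OnScaledPolygon Q λ₀ (px , py) =
  Σ V2 λ e → (e ∈ VQ Q) × Σ ℚ λ t → (0ℚ ℚ.≤ t) × (t ℚ.≤ 1ℚ) ×
    (px ≡ λ₀ ℚ.* (toℚ (proj₁ (edgeStart Q e)) ℚ.+ t ℚ.* toℚ (proj₁ e) ℚ.- proj₁ (centre Q))) ×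
    (py ≡ λ₀ ℚ.* (toℚ (proj₂ (edgeStart Q e)) ℚ.+ t ℚ.* toℚ (proj₂ e) ℚ.- proj₂ (centre Q)))

rot : Q2 → Q2
rot (x , y) = (ℚ.- y , x)

parab : ℚ → Q2
parab x = (x , ((+ 3) ℚ./ 4) ℚ.* x ℚ.* x ℚ.- 1ℚ)

OnC : Q2 → Set
OnC p = Σ ℚ λ x → (ℚ.- ((+ 2) ℚ./ 3) ℚ.≤ x) × (x ℚ.≤ (+ 2) ℚ./ 3) ×
  ((p ≡ parab x) ⊎ (p ≡ rot (parab x)) ⊎ (p ≡ rot (rot (parab x))) ⊎ (p ≡ rot (rot (rot (parab x)))))

dist² : Q2 → Q2 → ℚ
dist² (a , b) (c , d) = (a ℚ.- c) ℚ.* (a ℚ.- c) ℚ.+ (b ℚ.- d) ℚ.* (b ℚ.- d)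

{-# OPTIONS --safe #-}
-- Let S(e) be the start of the edge e, and U(e) the sum of the w in V_Q with
-- cross(e, w) > 0. Antisymmetrising under w ↦ -w gives 2 (S(e) - centre) = -U(e)
-- up to vectors parallel to e, which contribute O(Q²); the scaling factor is 4/K with
-- K = Σ 2y over the w = (x, y) in V_Q with y > 0, and K has order Q³. So the vertex
-- at e is close to -2U(e)/K, and the density of primitive vectors cancels.
--
-- Let e = (q, a) with |a| ≤ q. The weights 3q [cross > 0] x + a [y > 0] 2y and
-- 6q² [cross > 0] y - (3q² - a²) [y > 0] 2y are chosen so that their sums F(M) over all
-- integer points of the box of radius M are only O(M²). If P(M) is the sum over the
-- primitive points, sorting by gcd gives F(Q) = Σ_d d P(⌊Q/d⌋). As Σ_{d≥2} 1/d² ≤ 2/3,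
-- a bound |P(m)| ≤ A m³ + B for all m improves to |P(m)| ≤ (3/4) A m³ + B'. Iterating,
-- P(Q) = o(Q³) uniformly in e, that is, -2U(e)/K is close to the point of the parabola
-- with abscissa 2a/(3q). The other edges follow by rotation by π/2.
module Submission where

open import Defs
open import Data.Nat as ℕ using (ℕ)
open import Data.Rational as ℚ using (ℚ; 0ℚ)
open import Data.Product using (Σ; _×_)

open import Data.Bool using (Bool; true; false; _∧_; _∨_; not)
import Data.Bool.Properties as Boolₚ
open import Data.Empty using (⊥-elim)
open import Data.Integer as ℤ using (ℤ; +_; -[1+_]; ∣_∣)
open import Data.Integer.DivMod using (_/ℕ_; _%ℕ_; a≡a%ℕn+[a/ℕn]*n; n%ℕd<d)
import Data.Integer.Properties as ℤₚ
open import Data.Integer.Tactic.RingSolver using (solve-∀)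
open import Data.List using (List; []; _∷_; map; filter; upTo; applyUpTo; concatMap; foldr; length; _++_)
open import Data.List.Membership.Propositional using (_∈_; find)
open import Data.List.Membership.Propositional.Properties using (∈-filter⁻; ∈-concatMap⁻; ∈-map⁻; ∈-upTo⁻)
open import Data.Nat using (zero; suc)
open import Data.Nat.Divisibility using (_∣?_; divides; ∣⇒≤) renaming (_∣_ to _∣ℕ_)
open import Data.Nat.DivMod using (_/_; 0/n≡0; m*n/n≡m; /-monoˡ-≤; m/n*n≤m; m<n*o⇒m/o<n; n/1≡n)
open import Data.Nat.GCD
  using (gcd; gcd-comm; gcd[m,n]∣m; gcd[m,n]∣n; gcd[m,n]≡0⇒m≡0; gcd[m,n]≡0⇒n≡0; c*gcd[m,n]≡gcd[cm,cn])
import Data.Nat.Properties as ℕₚ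
open import Data.Nat.Tactic.RingSolver using () renaming (solve-∀ to solve-∀ℕ)
open import Data.Product using (_,_; proj₁; proj₂)
open import Data.Rational using (1ℚ; mkℚ; toℚᵘ)
import Data.Rational.Properties as ℚₚ
open import Data.Rational.Unnormalised as ℚᵘ using (mkℚᵘ; *≡*) renaming (*≤* to *≤*ᵘ)
import Data.Rational.Unnormalised.Properties as ℚᵘₚ
open import Data.Sum using (_⊎_; inj₁; inj₂)
open import Function using (_∘_; mk⇔)
open import Level using (0ℓ)
open import Relation.Binary.PropositionalEquality
open import Relation.Nullary using (¬_; Dec; yes; no; does; contradiction)
open import Relation.Nullary.Decidable using (does-⇔; dec-true; dec-false)
open import Relation.Nullary.Decidable.Core using (dec⇒maybe)
import Tactic.RingSolver as RingSolver
open import Tactic.RingSolver.Core.AlmostCommutativeRing using (AlmostCommutativeRing; fromCommutativeRing)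

-- The restriction |a| ≤ q makes the box sums computable: for |x| ≤ M the line q y = a x stays
-- between -M and M, so each column is cut exactly once, at ⌊a x / q⌋, and never truncated. This is
-- also why the limit consists of four arcs. Writing the floor as (a x - r) / q turns the box sums
-- into polynomials whose M³ terms cancel; the remainders r cost O(M) in each of the 2M + 1 columns.
--
-- The density 6/π² is never evaluated. Only ratios to K occur, so everything before the last part
-- takes place in ℤ and ℕ, without limits. The price is a separate lower bound for K, from the same
-- decomposition by gcd: of a box sum of about 2 Q³, the terms d ≥ 2 take at most (2/3)(5/2) Q³ up
-- to O(Q²).
--
-- The number of edges grows with Q, so convergence in each fixed direction would not be enough: the
-- threshold has to be fixed before the edge is chosen. This is why all constants of the iteration
-- depend on C alone. The gap between 2/3 and 3/4 pays for the terms of order Q² that each iteration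
-- creates.

-- Sums over symmetric intervals and boxes
module _ where
  open import Data.Integer using (_+_; _*_; -_; _-_; _≤_; +≤+)

  -- Each step adds the pair ±(M + 1), so reflection only swaps two terms and induction on `M`
  -- follows the growing boxes.
  sumSym : ℕ → (ℤ → ℤ) → ℤ
  sumSym zero    f = f (+ 0)
  sumSym (suc M) f = sumSym M f + (f (+ suc M) + f -[1+ M ])

  sumBox : ℕ → (V2 → ℤ) → ℤ
  sumBox M φ = sumSym M (λ x → sumSym M (λ y → φ (x , y)))

  sumSym-cong : ∀ M {f g : ℤ → ℤ} → (∀ x → ∣ x ∣ ℕ.≤ M → f x ≡ g x) → sumSym M f ≡ sumSym M g
  sumSym-cong zero    h = h (+ 0) ℕ.z≤n
  sumSym-cong (suc M) h = cong₂ _+_ (sumSym-cong M (λ x p → h x (ℕₚ.m≤n⇒m≤1+n p)))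
    (cong₂ _+_ (h (+ suc M) ℕₚ.≤-refl) (h -[1+ M ] ℕₚ.≤-refl))

  sumBox-cong : ∀ M {φ ψ : V2 → ℤ} →
    (∀ x y → ∣ x ∣ ℕ.≤ M → ∣ y ∣ ℕ.≤ M → φ (x , y) ≡ ψ (x , y)) → sumBox M φ ≡ sumBox M ψ
  sumBox-cong M h = sumSym-cong M (λ x p → sumSym-cong M (λ y q → h x y p q))

  sumSym-+ : ∀ M (f g : ℤ → ℤ) → sumSym M (λ x → f x + g x) ≡ sumSym M f + sumSym M g
  sumSym-+ zero    f g = refl
  sumSym-+ (suc M) f g rewrite sumSym-+ M f g =
    lemma (sumSym M f) (sumSym M g) (f (+ suc M)) (g (+ suc M)) (f -[1+ M ]) (g -[1+ M ])
    where
    lemma : ∀ a b c d e k → (a + b) + ((c + d) + (e + k)) ≡ (a + (c + e)) + (b + (d + k))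
    lemma = solve-∀

  sumBox-+ : ∀ M (φ ψ : V2 → ℤ) → sumBox M (λ w → φ w + ψ w) ≡ sumBox M φ + sumBox M ψ
  sumBox-+ M φ ψ = trans (sumSym-cong M (λ x _ → sumSym-+ M _ _)) (sumSym-+ M _ _)

  sumSym-*ˡ : ∀ M c (f : ℤ → ℤ) → sumSym M (λ x → c * f x) ≡ c * sumSym M f
  sumSym-*ˡ zero    c f = refl
  sumSym-*ˡ (suc M) c f rewrite sumSym-*ˡ M c f = lemma c (sumSym M f) (f (+ suc M)) (f -[1+ M ])
    where
    lemma : ∀ c a b d → c * a + (c * b + c * d) ≡ c * (a + (b + d))
    lemma = solve-∀

  sumBox-*ˡ : ∀ M c (φ : V2 → ℤ) → sumBox M (λ w → c * φ w) ≡ c * sumBox M φ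
  sumBox-*ˡ M c φ = trans (sumSym-cong M (λ x _ → sumSym-*ˡ M c _)) (sumSym-*ˡ M c _)

  sumSym-swap : ∀ M N (f : ℤ → ℤ → ℤ) →
    sumSym M (λ x → sumSym N (f x)) ≡ sumSym N (λ y → sumSym M (λ x → f x y))
  sumSym-swap zero    N f = refl
  sumSym-swap (suc M) N f rewrite sumSym-swap M N f =
    trans (cong (λ z → sumSym N (λ y → sumSym M (λ x → f x y)) + z) (sym (sumSym-+ N _ _)))
      (sym (sumSym-+ N _ _))

  sumSym-neg : ∀ M (f : ℤ → ℤ) → sumSym M (f ∘ -_) ≡ sumSym M f
  sumSym-neg zero    f = refl
  sumSym-neg (suc M) f rewrite sumSym-neg M f = cong (λ z → sumSym M f + z) (ℤₚ.+-comm (f -[1+ M ]) (f (+ suc M)))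

  sumBox-neg : ∀ M (φ : V2 → ℤ) → sumBox M (λ (x , y) → φ (- x , - y)) ≡ sumBox M φ
  sumBox-neg M φ = trans (sumSym-cong M (λ x _ → sumSym-neg M (λ y → φ (- x , y))))
    (sumSym-neg M (λ x → sumSym M (λ y → φ (x , y))))

  sumBox-rot : ∀ M (φ : V2 → ℤ) → sumBox M (λ (x , y) → φ (- y , x)) ≡ sumBox M φ
  sumBox-rot M φ = trans (sumSym-swap M M (λ x y → φ (- y , x)))
    (sumSym-neg M (λ x → sumSym M (λ y → φ (x , y))))

  sumSym-const : ∀ M c → sumSym M (λ _ → c) ≡ + (2 ℕ.* M ℕ.+ 1) * c
  sumSym-const zero    c = sym (ℤₚ.*-identityˡ c)
  sumSym-const (suc M) c = begin
    sumSym M (λ _ → c) + (c + c)      ≡⟨ cong (_+ (c + c)) (sumSym-const M c) ⟩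
    + (2 ℕ.* M ℕ.+ 1) * c + (c + c)   ≡⟨ lemma (+ (2 ℕ.* M ℕ.+ 1)) c ⟩
    (+ (2 ℕ.* M ℕ.+ 1) + + 2) * c     ≡⟨ cong (λ z → + z * c) (ℕₚ.+-comm (2 ℕ.* M ℕ.+ 1) 2) ⟩
    + (2 ℕ.+ (2 ℕ.* M ℕ.+ 1)) * c     ≡⟨ cong (λ z → + (z ℕ.+ 1) * c) (sym (ℕₚ.*-suc 2 M)) ⟩
    + (2 ℕ.* suc M ℕ.+ 1) * c ∎
    where
    open ≡-Reasoning
    lemma : ∀ a c → a * c + (c + c) ≡ (a + + 2) * c
    lemma = solve-∀

  sumSym-dominated : ∀ M {f g : ℤ → ℤ} → (∀ x → ∣ x ∣ ℕ.≤ M → + ∣ f x ∣ ≤ g x) →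
    + ∣ sumSym M f ∣ ≤ sumSym M g
  sumSym-dominated zero    h = h (+ 0) ℕ.z≤n
  sumSym-dominated (suc M) {f} {g} h = begin
    + ∣ sumSym M f + (f (+ suc M) + f -[1+ M ]) ∣
      ≤⟨ +≤+ (ℕₚ.≤-trans (ℤₚ.∣i+j∣≤∣i∣+∣j∣ (sumSym M f) _)
           (ℕₚ.+-monoʳ-≤ ∣ sumSym M f ∣ (ℤₚ.∣i+j∣≤∣i∣+∣j∣ (f (+ suc M)) _))) ⟩
    + ∣ sumSym M f ∣ + (+ ∣ f (+ suc M) ∣ + + ∣ f -[1+ M ] ∣)
      ≤⟨ ℤₚ.+-mono-≤ (sumSym-dominated M (λ x p → h x (ℕₚ.m≤n⇒m≤1+n p)))
           (ℤₚ.+-mono-≤ (h (+ suc M) ℕₚ.≤-refl) (h -[1+ M ] ℕₚ.≤-refl)) ⟩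
    sumSym M g + (g (+ suc M) + g -[1+ M ]) ∎
    where open ℤₚ.≤-Reasoning

  sumSym-bound : ∀ M {f : ℤ → ℤ} b → (∀ x → ∣ x ∣ ℕ.≤ M → ∣ f x ∣ ℕ.≤ b) →
    ∣ sumSym M f ∣ ℕ.≤ (2 ℕ.* M ℕ.+ 1) ℕ.* b
  sumSym-bound M {f} b h = ℤₚ.drop‿+≤+ (begin
    + ∣ sumSym M f ∣           ≤⟨ sumSym-dominated M (λ x p → +≤+ (h x p)) ⟩
    sumSym M (λ _ → + b)       ≡⟨ sumSym-const M (+ b) ⟩
    + (2 ℕ.* M ℕ.+ 1) * + b    ≡⟨ ℤₚ.pos-* (2 ℕ.* M ℕ.+ 1) b ⟨
    + ((2 ℕ.* M ℕ.+ 1) ℕ.* b)  ∎)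
    where open ℤₚ.≤-Reasoning

  sumBox-bound : ∀ M {φ : V2 → ℤ} b → (∀ x y → ∣ x ∣ ℕ.≤ M → ∣ y ∣ ℕ.≤ M → ∣ φ (x , y) ∣ ℕ.≤ b) →
    ∣ sumBox M φ ∣ ℕ.≤ (2 ℕ.* M ℕ.+ 1) ℕ.* ((2 ℕ.* M ℕ.+ 1) ℕ.* b)
  sumBox-bound M b h = sumSym-bound M _ (λ x p → sumSym-bound M b (λ y → h x y p))

  -- The lower end is -(M + 1), one below the interval. With `G` a discrete antiderivative this
  -- yields the column sums, and with `G` an indicator the count of points on a line.
  sumSym-telescope : ∀ M (G : ℤ → ℤ) → sumSym M (λ y → G y - G (y - + 1)) ≡ G (+ M) - G -[1+ M ]
  sumSym-telescope zero    G = refl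
  sumSym-telescope (suc M) G = begin
    sumSym M (λ y → G y - G (y - + 1)) + ((G (+ suc M) - G (+ suc M - + 1)) + (G -[1+ M ] - G (-[1+ M ] - + 1)))
      ≡⟨ cong₂ _+_ (sumSym-telescope M G) (cong (λ z → (G (+ suc M) - G (+ M)) + (G -[1+ M ] - G -[1+ suc z ])) (ℕₚ.+-identityʳ M)) ⟩
    (G (+ M) - G -[1+ M ]) + ((G (+ suc M) - G (+ M)) + (G -[1+ M ] - G -[1+ suc M ]))
      ≡⟨ lemma (G (+ M)) (G -[1+ M ]) (G (+ suc M)) (G -[1+ suc M ]) ⟩
    G (+ suc M) - G -[1+ suc M ] ∎
    where
    open ≡-Reasoning
    lemma : ∀ a b c d → (a - b) + ((c - a) + (b - d)) ≡ c - d
    lemma = solve-∀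

-- Primitive sums and the decomposition of a box by gcd
module _ where
  open import Data.Integer using (_+_; _*_; _-_; -_)

  ⟦_⟧ : Bool → ℤ
  ⟦ true ⟧  = + 1
  ⟦ false ⟧ = + 0

  -- Primitivity enters as a 0/1 weight, so linearity and the symmetries of the box carry over.
  sumPrim : ℕ → (V2 → ℤ) → ℤ
  sumPrim M φ = sumBox M (λ w → ⟦ coprimeᵇ w ⟧ * φ w)

  sumSym-zero : ∀ M {f : ℤ → ℤ} → (∀ x → ∣ x ∣ ℕ.≤ M → f x ≡ + 0) → sumSym M f ≡ + 0
  sumSym-zero M h = trans (sumSym-cong M h)
    (trans (sumSym-const M (+ 0)) (ℤₚ.*-zeroʳ (+ (2 ℕ.* M ℕ.+ 1))))

  sumBox-zero : ∀ M → sumBox M (λ _ → + 0) ≡ + 0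
  sumBox-zero M = sumSym-zero M (λ _ _ → sumSym-zero M (λ _ _ → refl))

  -- ⌊M/d⌋ jumps exactly when d divides M + 1; this dichotomy drives the induction in
  -- `sumSym-multiples`.
  /-suc : ∀ M d .{{_ : ℕ.NonZero d}} →
    (suc M / d ≡ M / d × ¬ (d ∣ℕ suc M)) ⊎ (suc M / d ≡ suc (M / d) × suc M ≡ d ℕ.* suc (M / d))
  /-suc M d with d ∣? suc M
  ... | yes (divides zero ())
  ... | yes (divides (suc k) eq) = inj₂
    ( trans quot (cong suc (sym quot′))
    , trans eq (trans (ℕₚ.*-comm (suc k) d) (cong (λ z → d ℕ.* suc z) (sym quot′))) )
    where
    quot : suc M / d ≡ suc k
    quot = trans (cong (_/ d) eq) (m*n/n≡m (suc k) d)
    kd≤M : k ℕ.* d ℕ.≤ M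
    kd≤M = ℕₚ.≤-pred (subst (k ℕ.* d ℕ.<_) (sym eq) (ℕₚ.*-monoˡ-< d (ℕₚ.n<1+n k)))
    quot′ : M / d ≡ k
    quot′ = ℕₚ.≤-antisym
      (ℕₚ.≤-pred (m<n*o⇒m/o<n {n = suc k} (subst (M ℕ.<_) eq (ℕₚ.n<1+n M))))
      (subst (ℕ._≤ M / d) (m*n/n≡m k d) (/-monoˡ-≤ d kd≤M))
  ... | no ∤ = inj₁ (ℕₚ.≤-antisym upper≤ (/-monoˡ-≤ d (ℕₚ.n≤1+n M)) , ∤)
    where
    kd≤M : suc M / d ℕ.* d ℕ.≤ M
    kd≤M = ℕₚ.≤-pred (ℕₚ.≤∧≢⇒< (m/n*n≤m (suc M) d) (λ eq → ∤ (divides (suc M / d) (sym eq))))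
    upper≤ : suc M / d ℕ.≤ M / d
    upper≤ = subst (ℕ._≤ M / d) (m*n/n≡m (suc M / d) d) (/-monoˡ-≤ d kd≤M)

  sumSym-multiples : ∀ d .{{_ : ℕ.NonZero d}} M (f : ℤ → ℤ) →
    (∀ x → ¬ (d ∣ℕ ∣ x ∣) → f x ≡ + 0) → sumSym M f ≡ sumSym (M / d) (λ x → f (+ d * x))
  sumSym-multiples d zero f h = trans (cong f (sym (ℤₚ.*-zeroʳ (+ d))))
    (cong (λ m → sumSym m (λ x → f (+ d * x))) (sym (0/n≡0 d)))
  sumSym-multiples d (suc M) f h with /-suc M d
  ... | inj₁ (eq , ∤) rewrite eq | h (+ suc M) ∤ | h -[1+ M ] ∤ =
    trans (ℤₚ.+-identityʳ (sumSym M f)) (sumSym-multiples d M f h)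
  ... | inj₂ (eq , eq′) rewrite eq = cong₂ _+_ (sumSym-multiples d M f h)
    (cong₂ _+_ (cong f pos) (cong f neg))
    where
    pos : + suc M ≡ + d * + suc (M / d)
    pos = trans (cong +_ eq′) (ℤₚ.pos-* d (suc (M / d)))
    neg : -[1+ M ] ≡ + d * -[1+ M / d ]
    neg = trans (cong -_ pos) (ℤₚ.neg-distribʳ-* (+ d) (+ suc (M / d)))

  sumBelow : ℕ → (ℕ → ℤ) → ℤ
  sumBelow zero    f = + 0
  sumBelow (suc n) f = sumBelow n f + f n

  sumBelow-cong : ∀ n {f g : ℕ → ℤ} → (∀ i → f i ≡ g i) → sumBelow n f ≡ sumBelow n g
  sumBelow-cong zero    h = refl
  sumBelow-cong (suc n) h = cong₂ _+_ (sumBelow-cong n h) (h n)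

  sumBelow-front : ∀ n (f : ℕ → ℤ) → sumBelow (suc n) f ≡ f 0 + sumBelow n (f ∘ suc)
  sumBelow-front zero    f = ℤₚ.+-comm (+ 0) (f 0)
  sumBelow-front (suc n) f rewrite sumBelow-front n f = ℤₚ.+-assoc (f 0) _ _

  sumBelow-*ʳ : ∀ n c (f : ℕ → ℤ) → sumBelow n (λ i → f i * c) ≡ sumBelow n f * c
  sumBelow-*ʳ zero    c f = refl
  sumBelow-*ʳ (suc n) c f rewrite sumBelow-*ʳ n c f = sym (ℤₚ.*-distribʳ-+ c (sumBelow n f) (f n))

  sumBox-sumBelow : ∀ M n (f : ℕ → V2 → ℤ) →
    sumBox M (λ w → sumBelow n (λ i → f i w)) ≡ sumBelow n (λ i → sumBox M (f i))
  sumBox-sumBelow M zero    f = sumBox-zero M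
  sumBox-sumBelow M (suc n) f = trans (sumBox-+ M (λ w → sumBelow n (λ i → f i w)) (f n))
    (cong (_+ sumBox M (f n)) (sumBox-sumBelow M n f))

  -- Partition of unity over the possible values of a gcd, with `suc j` the gcd and `suc i` the
  -- candidates.
  sumBelow-≟ : ∀ n j → (n ℕ.≤ j → sumBelow n (λ i → ⟦ does (suc j ℕ.≟ suc i) ⟧) ≡ + 0)
                     × (j ℕ.< n → sumBelow n (λ i → ⟦ does (suc j ℕ.≟ suc i) ⟧) ≡ + 1)
  sumBelow-≟ zero j = (λ _ → refl) , λ ()
  sumBelow-≟ (suc n) j = above , below
    where
    above : suc n ℕ.≤ j → sumBelow (suc n) (λ i → ⟦ does (suc j ℕ.≟ suc i) ⟧) ≡ + 0
    above n<j = cong₂ _+_ (proj₁ (sumBelow-≟ n j) (ℕₚ.<⇒≤ n<j))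
      (cong ⟦_⟧ (dec-false (suc j ℕ.≟ suc n) (λ eq → ℕₚ.<⇒≢ n<j (sym (ℕₚ.suc-injective eq)))))
    below : j ℕ.< suc n → sumBelow (suc n) (λ i → ⟦ does (suc j ℕ.≟ suc i) ⟧) ≡ + 1
    below j<1+n with ℕₚ.m≤n⇒m<n∨m≡n (ℕₚ.≤-pred j<1+n)
    ... | inj₁ j<n = cong₂ _+_ (proj₂ (sumBelow-≟ n j) j<n)
      (cong ⟦_⟧ (dec-false (suc j ℕ.≟ suc n) (λ eq → ℕₚ.<⇒≢ j<n (ℕₚ.suc-injective eq))))
    ... | inj₂ refl = cong₂ _+_ (proj₁ (sumBelow-≟ n n) ℕₚ.≤-refl)
      (cong ⟦_⟧ (dec-true (suc n ℕ.≟ suc n) refl))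

  -- Only positive factors are allowed, since indicators of half-planes survive no others. The
  -- factor d in front of P(⌊Q/d⌋) comes from here.
  Homogeneous : (V2 → ℤ) → Set
  Homogeneous φ = ∀ d x y → φ (+ suc d * x , + suc d * y) ≡ + suc d * φ (x , y)

  -- Doubling fixes the origin. Having gcd 0, the origin lies in no class d ≥ 1 of the
  -- decomposition, so its contribution must vanish by itself.
  homogeneous-origin : ∀ φ → Homogeneous φ → φ (+ 0 , + 0) ≡ + 0
  homogeneous-origin φ hom = begin
    φ (+ 0 , + 0)                      ≡⟨ double (φ (+ 0 , + 0)) ⟩
    + 2 * φ (+ 0 , + 0) - φ (+ 0 , + 0) ≡⟨ cong (_- φ (+ 0 , + 0)) (hom 1 (+ 0) (+ 0)) ⟨
    φ (+ 0 , + 0) - φ (+ 0 , + 0)      ≡⟨ ℤₚ.+-inverseʳ (φ (+ 0 , + 0)) ⟩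
    + 0                                ∎
    where
    open ≡-Reasoning
    double : ∀ a → a ≡ + 2 * a - a
    double = solve-∀

  gcdV : V2 → ℕ
  gcdV (x , y) = gcd ∣ x ∣ ∣ y ∣

  split-by-gcd : ∀ φ → Homogeneous φ → ∀ M x y → ∣ x ∣ ℕ.≤ M → ∣ y ∣ ℕ.≤ M →
    φ (x , y) ≡ sumBelow M (λ i → ⟦ does (gcdV (x , y) ℕ.≟ suc i) ⟧ * φ (x , y))
  split-by-gcd φ hom M x y x≤M y≤M = sym (trans (sumBelow-*ʳ M (φ (x , y)) _) (go (gcdV (x , y)) refl))
    where
    count : ℕ → ℤ
    count g = sumBelow M (λ i → ⟦ does (g ℕ.≟ suc i) ⟧)
    go : ∀ g → gcdV (x , y) ≡ g → count (gcdV (x , y)) * φ (x , y) ≡ φ (x , y)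
    go zero eq with refl ← ℤₚ.∣i∣≡0⇒i≡0 {x} (gcd[m,n]≡0⇒m≡0 eq)
                  | refl ← ℤₚ.∣i∣≡0⇒i≡0 {y} (gcd[m,n]≡0⇒n≡0 ∣ x ∣ eq)
      rewrite homogeneous-origin φ hom = ℤₚ.*-zeroʳ (count 0)
    go (suc j) eq rewrite eq = trans (cong (_* φ (x , y)) (proj₂ (sumBelow-≟ M j) (bound x y eq x≤M y≤M)))
      (ℤₚ.*-identityˡ (φ (x , y)))
      where
      bound : ∀ x y → gcdV (x , y) ≡ suc j → ∣ x ∣ ℕ.≤ M → ∣ y ∣ ℕ.≤ M → j ℕ.< M
      bound (+ suc m)  y e p q = ℕₚ.≤-trans (∣⇒≤ (subst (_∣ℕ suc m) e (gcd[m,n]∣m (suc m) ∣ y ∣))) p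
      bound -[1+ m ]   y e p q = ℕₚ.≤-trans (∣⇒≤ (subst (_∣ℕ suc m) e (gcd[m,n]∣m (suc m) ∣ y ∣))) p
      bound (+ zero) (+ suc m) e p q = ℕₚ.≤-trans (∣⇒≤ (subst (_∣ℕ suc m) e (gcd[m,n]∣n 0 (suc m)))) q
      bound (+ zero) -[1+ m ]  e p q = ℕₚ.≤-trans (∣⇒≤ (subst (_∣ℕ suc m) e (gcd[m,n]∣n 0 (suc m)))) q
      bound (+ zero) (+ zero) () p q

  ⟦⟧-false : ∀ {A : Set} (A? : Dec A) z → ¬ A → ⟦ does A? ⟧ * z ≡ + 0
  ⟦⟧-false A? z ¬a rewrite dec-false A? ¬a = refl

  -- Points of gcd d are d times the primitive points of the box of radius ⌊M/d⌋: each coordinate is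
  -- restricted to multiples of d, and gcd(dx, dy) = d gcd(x, y) turns the test into coprimality.
  sumBox-gcd≡ : ∀ φ → Homogeneous φ → ∀ M i →
    sumBox M (λ w → ⟦ does (gcdV w ℕ.≟ suc i) ⟧ * φ w) ≡ + suc i * sumPrim (M / suc i) φ
  sumBox-gcd≡ φ hom M i = begin
    sumSym M (λ x → sumSym M (λ y → ψ x y))
      ≡⟨ sumSym-multiples d M _ (λ x ∤ → sumSym-zero M (λ y _ → ⟦⟧-false (gcdV (x , y) ℕ.≟ d) (φ (x , y))
           (λ eq → ∤ (subst (_∣ℕ ∣ x ∣) eq (gcd[m,n]∣m ∣ x ∣ ∣ y ∣))))) ⟩
    sumSym m (λ x → sumSym M (λ y → ψ (+ d * x) y))
      ≡⟨ sumSym-cong m (λ x _ → sumSym-multiples d M _ (λ y ∤ → ⟦⟧-false (gcdV (+ d * x , y) ℕ.≟ d) (φ (+ d * x , y))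
           (λ eq → ∤ (subst (_∣ℕ ∣ y ∣) eq (gcd[m,n]∣n ∣ + d * x ∣ ∣ y ∣))))) ⟩
    sumBox m (λ (x , y) → ψ (+ d * x) (+ d * y))
      ≡⟨ sumBox-cong m (λ x y _ _ → scaled x y) ⟩
    sumBox m (λ w → + d * (⟦ coprimeᵇ w ⟧ * φ w))
      ≡⟨ sumBox-*ˡ m (+ d) _ ⟩
    + d * sumPrim m φ ∎
    where
    open ≡-Reasoning
    d = suc i
    m = M / d
    ψ : ℤ → ℤ → ℤ
    ψ x y = ⟦ does (gcdV (x , y) ℕ.≟ d) ⟧ * φ (x , y)
    gcd-scale : ∀ x y → gcdV (+ d * x , + d * y) ≡ d ℕ.* gcdV (x , y)
    gcd-scale x y = trans (cong₂ gcd (ℤₚ.abs-* (+ d) x) (ℤₚ.abs-* (+ d) y))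
      (sym (c*gcd[m,n]≡gcd[cm,cn] d ∣ x ∣ ∣ y ∣))
    test : ∀ x y → does (gcdV (+ d * x , + d * y) ℕ.≟ d) ≡ coprimeᵇ (x , y)
    test x y = does-⇔ (mk⇔
        (λ eq → ℕₚ.*-cancelˡ-≡ (gcdV (x , y)) 1 d (trans (sym (gcd-scale x y)) (trans eq (sym (ℕₚ.*-identityʳ d)))))
        (λ eq → trans (gcd-scale x y) (trans (cong (d ℕ.*_) eq) (ℕₚ.*-identityʳ d))))
      (gcdV (+ d * x , + d * y) ℕ.≟ d) (gcdV (x , y) ℕ.≟ 1)
    exchange : ∀ a b c → a * (b * c) ≡ b * (a * c)
    exchange = solve-∀
    scaled : ∀ x y → ψ (+ d * x) (+ d * y) ≡ + d * (⟦ coprimeᵇ (x , y) ⟧ * φ (x , y))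
    scaled x y = trans (cong₂ (λ b z → ⟦ b ⟧ * z) (test x y) (hom i x y)) (exchange ⟦ coprimeᵇ (x , y) ⟧ (+ d) (φ (x , y)))

  gcd-decomposition : ∀ φ → Homogeneous φ → ∀ M →
    sumBox M φ ≡ sumBelow M (λ i → + suc i * sumPrim (M / suc i) φ)
  gcd-decomposition φ hom M = begin
    sumBox M φ
      ≡⟨ sumBox-cong M (λ x y p q → split-by-gcd φ hom M x y p q) ⟩
    sumBox M (λ w → sumBelow M (λ i → ⟦ does (gcdV w ℕ.≟ suc i) ⟧ * φ w))
      ≡⟨ sumBox-sumBelow M M _ ⟩
    sumBelow M (λ i → sumBox M (λ w → ⟦ does (gcdV w ℕ.≟ suc i) ⟧ * φ w))
      ≡⟨ sumBelow-cong M (sumBox-gcd≡ φ hom M) ⟩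
    sumBelow M (λ i → + suc i * sumPrim (M / suc i) φ) ∎
    where open ≡-Reasoning

  sumBox-split : ∀ φ → Homogeneous φ → ∀ M →
    sumBox (suc M) φ ≡ sumPrim (suc M) φ + sumBelow M (λ i → + suc (suc i) * sumPrim (suc M / suc (suc i)) φ)
  sumBox-split φ hom M = begin
    sumBox (suc M) φ
      ≡⟨ gcd-decomposition φ hom (suc M) ⟩
    sumBelow (suc M) term
      ≡⟨ sumBelow-front M term ⟩
    + 1 * sumPrim (suc M / 1) φ + sumBelow M (term ∘ suc)
      ≡⟨ cong (_+ sumBelow M (term ∘ suc)) (trans (ℤₚ.*-identityˡ _) (cong (λ m → sumPrim m φ) (n/1≡n (suc M)))) ⟩
    sumPrim (suc M) φ + sumBelow M (term ∘ suc) ∎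
    where
    open ≡-Reasoning
    term : ℕ → ℤ
    term i = + suc i * sumPrim (suc M / suc i) φ

-- Equidistribution of primitive vectors
module _ where
  open import Data.Nat using (_+_; _*_; _^_; _≤_; _<_; z≤n; s≤s)

  sumℕ : ℕ → (ℕ → ℕ) → ℕ
  sumℕ zero    f = 0
  sumℕ (suc n) f = sumℕ n f + f n

  sumℕ-mono : ∀ n {f g : ℕ → ℕ} → (∀ i → i < n → f i ≤ g i) → sumℕ n f ≤ sumℕ n g
  sumℕ-mono zero    h = z≤n
  sumℕ-mono (suc n) h = ℕₚ.+-mono-≤ (sumℕ-mono n (λ i p → h i (ℕₚ.m≤n⇒m≤1+n p))) (h n ℕₚ.≤-refl)

  sumℕ-linear : ∀ n a b (f g : ℕ → ℕ) → sumℕ n (λ i → a * f i + b * g i) ≡ a * sumℕ n f + b * sumℕ n g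
  sumℕ-linear zero    a b f g = lemma a b
    where
    lemma : ∀ a b → 0 ≡ a * 0 + b * 0
    lemma = solve-∀ℕ
  sumℕ-linear (suc n) a b f g rewrite sumℕ-linear n a b f g = lemma a b (sumℕ n f) (sumℕ n g) (f n) (g n)
    where
    lemma : ∀ a b F G x y → a * F + b * G + (a * x + b * y) ≡ a * (F + x) + b * (G + y)
    lemma = solve-∀ℕ

  sumℕ-*ˡ : ∀ n a (f : ℕ → ℕ) → sumℕ n (λ i → a * f i) ≡ a * sumℕ n f
  sumℕ-*ˡ zero    a f = sym (ℕₚ.*-zeroʳ a)
  sumℕ-*ˡ (suc n) a f rewrite sumℕ-*ˡ n a f = sym (ℕₚ.*-distribˡ-+ a (sumℕ n f) (f n))

  sumℕ-const : ∀ n b → sumℕ n (λ _ → b) ≡ n * b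
  sumℕ-const zero    b = refl
  sumℕ-const (suc n) b rewrite sumℕ-const n b = ℕₚ.+-comm (n * b) b

  ∣sumBelow∣≤ : ∀ n (f : ℕ → ℤ) → ∣ sumBelow n f ∣ ≤ sumℕ n (λ i → ∣ f i ∣)
  ∣sumBelow∣≤ zero    f = z≤n
  ∣sumBelow∣≤ (suc n) f = ℕₚ.≤-trans (ℤₚ.∣i+j∣≤∣i∣+∣j∣ (sumBelow n f) (f n))
    (ℕₚ.+-monoˡ-≤ ∣ f n ∣ (∣sumBelow∣≤ n f))

  cube : ℕ → ℕ
  cube m = m * m * m

  cube-mono : ∀ {m n} → m ≤ n → cube m ≤ cube n
  cube-mono p = ℕₚ.*-mono-≤ (ℕₚ.*-mono-≤ p p) p

  -- Telescoping 1/d² ≤ 2/(2d-1) - 2/(2d+1) over 2 ≤ d ≤ n+1, with denominators cleared.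
  sum-cubes-telescoped : ∀ Q n →
    3 * (2 * n + 3) * sumℕ n (λ i → (2 + i) * cube (Q / (2 + i))) ≤ 4 * n * cube Q
  sum-cubes-telescoped Q zero = z≤n
  sum-cubes-telescoped Q (suc n) = ℕₚ.*-cancelˡ-≤ (3 + 2 * n) (begin
    (3 + 2 * n) * (3 * (2 * suc n + 3) * (A + X))
      ≡⟨ expand n A X ⟩
    (2 * n + 5) * (3 * (2 * n + 3) * A) + (3 * (2 * n + 3) * (2 * n + 5)) * X
      ≤⟨ ℕₚ.+-mono-≤ (ℕₚ.*-monoʳ-≤ (2 * n + 5) (sum-cubes-telescoped Q n))
           (ℕₚ.*-monoˡ-≤ X (ℕₚ.≤-trans (ℕₚ.m≤m+n _ 3) (ℕₚ.≤-reflexive (square n)))) ⟩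
    (2 * n + 5) * (4 * n * cube Q) + (12 * ((2 + n) * (2 + n))) * X
      ≡⟨ cong (λ z → (2 * n + 5) * (4 * n * cube Q) + z) (collect (2 + n) m) ⟩
    (2 * n + 5) * (4 * n * cube Q) + 12 * cube (m * (2 + n))
      ≤⟨ ℕₚ.+-monoʳ-≤ ((2 * n + 5) * (4 * n * cube Q)) (ℕₚ.*-monoʳ-≤ 12 (cube-mono (m/n*n≤m Q (2 + n)))) ⟩
    (2 * n + 5) * (4 * n * cube Q) + 12 * cube Q
      ≡⟨ final n (cube Q) ⟩
    (3 + 2 * n) * (4 * suc n * cube Q) ∎)
    where
    open ℕₚ.≤-Reasoning
    m = Q / (2 + n)
    A = sumℕ n (λ i → (2 + i) * cube (Q / (2 + i)))
    X = (2 + n) * cube m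
    expand : ∀ n A X → (3 + 2 * n) * (3 * (2 * (1 + n) + 3) * (A + X))
      ≡ (2 * n + 5) * (3 * (2 * n + 3) * A) + (3 * (2 * n + 3) * (2 * n + 5)) * X
    expand = solve-∀ℕ
    -- With d = n + 2 this is 3 (2d - 1)(2d + 1) + 3 = 12 d².
    square : ∀ n → 3 * (2 * n + 3) * (2 * n + 5) + 3 ≡ 12 * ((2 + n) * (2 + n))
    square = solve-∀ℕ
    collect : ∀ d m → (12 * (d * d)) * (d * (m * m * m)) ≡ 12 * (m * d * (m * d) * (m * d))
    collect = solve-∀ℕ
    final : ∀ n K → (2 * n + 5) * (4 * n * K) + 12 * K ≡ (3 + 2 * n) * (4 * (1 + n) * K)
    final = solve-∀ℕ

  -- The telescoped factor 4n / (3 (2n + 3)) stays below its limit 2/3.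
  sum-cubes : ∀ Q n → 3 * sumℕ n (λ i → (2 + i) * cube (Q / (2 + i))) ≤ 2 * cube Q
  sum-cubes Q n = ℕₚ.*-cancelˡ-≤ (3 + 2 * n) (begin
    (3 + 2 * n) * (3 * A)          ≡⟨ rearrange n A ⟩
    3 * (2 * n + 3) * A            ≤⟨ sum-cubes-telescoped Q n ⟩
    4 * n * cube Q                 ≤⟨ ℕₚ.*-monoˡ-≤ (cube Q) (ℕₚ.≤-trans (ℕₚ.m≤m+n (4 * n) 6) (ℕₚ.≤-reflexive (double n))) ⟩
    (3 + 2 * n) * 2 * cube Q       ≡⟨ ℕₚ.*-assoc (3 + 2 * n) 2 (cube Q) ⟩
    (3 + 2 * n) * (2 * cube Q)     ∎)
    where
    open ℕₚ.≤-Reasoning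
    A = sumℕ n (λ i → (2 + i) * cube (Q / (2 + i)))
    rearrange : ∀ n A → (3 + 2 * n) * (3 * A) ≡ 3 * (2 * n + 3) * A
    rearrange = solve-∀ℕ
    double : ∀ n → 4 * n + 6 ≡ (3 + 2 * n) * 2
    double = solve-∀ℕ

  -- For f ≤ (β/α) m³ + B/α the leading constant of the divisor sum is (2/3)(β/α). Each additive `B`
  -- is multiplied by some d ≤ Q, and there are fewer than Q of them, so the error is only
  -- quadratic.
  sum-divided-bound : ∀ α β B (f : ℕ → ℕ) → (∀ m → α * f m ≤ β * cube m + B) → ∀ n →
    3 * (α * sumℕ n (λ i → (2 + i) * f (suc n / (2 + i)))) ≤ 2 * β * cube (suc n) + 3 * B * (suc n * suc n)
  sum-divided-bound α β B f h n = begin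
    3 * (α * sumℕ n (λ i → (2 + i) * f (Q / (2 + i))))
      ≡⟨ cong (3 *_) (sumℕ-*ˡ n α _) ⟨
    3 * sumℕ n (λ i → α * ((2 + i) * f (Q / (2 + i))))
      ≤⟨ ℕₚ.*-monoʳ-≤ 3 (sumℕ-mono n termwise) ⟩
    3 * sumℕ n (λ i → β * ((2 + i) * cube (Q / (2 + i))) + B * Q)
      ≡⟨ cong (3 *_) (sumℕ-linear n β B _ (λ _ → Q)) ⟩
    3 * (β * A + B * sumℕ n (λ _ → Q))
      ≡⟨ cong (λ z → 3 * (β * A + B * z)) (sumℕ-const n Q) ⟩
    3 * (β * A + B * (n * Q))
      ≡⟨ rearrange β A B (n * Q) ⟩
    β * (3 * A) + 3 * B * (n * Q)
      ≤⟨ ℕₚ.+-mono-≤ (ℕₚ.*-monoʳ-≤ β (sum-cubes Q n)) (ℕₚ.*-monoʳ-≤ (3 * B) (ℕₚ.*-monoˡ-≤ Q (ℕₚ.n≤1+n n))) ⟩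
    β * (2 * cube Q) + 3 * B * (Q * Q)
      ≡⟨ cong (λ z → z + 3 * B * (Q * Q)) (swap β (cube Q)) ⟩
    2 * β * cube Q + 3 * B * (Q * Q) ∎
    where
    open ℕₚ.≤-Reasoning
    Q = suc n
    A = sumℕ n (λ i → (2 + i) * cube (Q / (2 + i)))
    rearrange : ∀ β A B k → 3 * (β * A + B * k) ≡ β * (3 * A) + 3 * B * k
    rearrange = solve-∀ℕ
    swap : ∀ β k → β * (2 * k) ≡ 2 * β * k
    swap = solve-∀ℕ
    exchange : ∀ a b c → a * (b * c) ≡ b * (a * c)
    exchange = solve-∀ℕ
    distribute : ∀ d β m B → d * (β * m + B) ≡ β * (d * m) + B * d
    distribute = solve-∀ℕ
    termwise : ∀ i → i < n → α * ((2 + i) * f (Q / (2 + i))) ≤ β * ((2 + i) * cube (Q / (2 + i))) + B * Q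
    termwise i i<n = begin
      α * (d * f m)                 ≡⟨ exchange α d (f m) ⟩
      d * (α * f m)                 ≤⟨ ℕₚ.*-monoʳ-≤ d (h m) ⟩
      d * (β * cube m + B)          ≡⟨ distribute d β (cube m) B ⟩
      β * (d * cube m) + B * d      ≤⟨ ℕₚ.+-monoʳ-≤ _ (ℕₚ.*-monoʳ-≤ B (s≤s i<n)) ⟩
      β * (d * cube m) + B * Q      ∎
      where
      d = 2 + i
      m = Q / d

  -- Absorbs a quadratic error into the cubic term at the price of a constant, according to whether
  -- K ≤ Q or Q ≤ K.
  square≤cube : ∀ K Q → K * (Q * Q) ≤ cube Q + cube K
  square≤cube K Q with ℕₚ.≤-total K Q
  ... | inj₁ K≤Q = ℕₚ.≤-trans
    (ℕₚ.≤-trans (ℕₚ.*-monoˡ-≤ (Q * Q) K≤Q) (ℕₚ.≤-reflexive (sym (ℕₚ.*-assoc Q Q Q))))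
    (ℕₚ.m≤m+n (cube Q) (cube K))
  ... | inj₂ Q≤K = ℕₚ.≤-trans
    (ℕₚ.≤-trans (ℕₚ.*-monoʳ-≤ K (ℕₚ.*-mono-≤ Q≤K Q≤K)) (ℕₚ.≤-reflexive (sym (ℕₚ.*-assoc K K K))))
    (ℕₚ.m≤n+m (cube K) (cube Q))

  -- N is the scale of the weight (q or q² below); keeping it apart from C makes the
  -- resulting bounds uniform in the edge.
  record Balanced (C N : ℕ) (φ : V2 → ℤ) : Set where
    field
      homogeneous : Homogeneous φ
      linear      : ∀ M x y → ∣ x ∣ ≤ M → ∣ y ∣ ≤ M → ∣ φ (x , y) ∣ ≤ N * (C * M)
      balanced    : ∀ M → ∣ sumBox (suc M) φ ∣ ≤ N * (C * (suc M * suc M))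

  open Balanced

  -- Start of the iteration: (2Q + 1)² ≤ 9 Q² points, each of weight at most N C Q. The case Q = 0
  -- is separate because 2Q + 1 ≤ 3Q fails there.
  sumPrim-trivial : ∀ {C N φ} → Balanced C N φ → ∀ Q → ∣ sumPrim Q φ ∣ ≤ N * (9 * C * cube Q)
  sumPrim-trivial {C} {N} {φ} bal Q = ℕₚ.≤-trans (sumBox-bound Q (N * (C * Q)) weighted) (box Q)
    where
    open ℕₚ.≤-Reasoning
    weighted : ∀ x y → ∣ x ∣ ≤ Q → ∣ y ∣ ≤ Q → ∣ ⟦ coprimeᵇ (x , y) ⟧ ℤ.* φ (x , y) ∣ ≤ N * (C * Q)
    weighted x y p q with coprimeᵇ (x , y)
    ... | false = z≤n
    ... | true rewrite ℤₚ.*-identityˡ (φ (x , y)) = linear bal Q x y p q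
    regroup : ∀ N C Q → 3 * Q * (3 * Q * (N * (C * Q))) ≡ N * (9 * C * (Q * Q * Q))
    regroup = solve-∀ℕ
    box : ∀ Q → (2 * Q + 1) * ((2 * Q + 1) * (N * (C * Q))) ≤ N * (9 * C * cube Q)
    box zero    = ℕₚ.≤-trans (ℕₚ.≤-reflexive (vanish N C)) z≤n
      where
      vanish : ∀ N C → 1 * (1 * (N * (C * 0))) ≡ 0
      vanish = solve-∀ℕ
    box (suc Q) = begin
      (2 * suc Q + 1) * ((2 * suc Q + 1) * (N * (C * suc Q)))
        ≤⟨ ℕₚ.*-mono-≤ side (ℕₚ.*-monoˡ-≤ (N * (C * suc Q)) side) ⟩
      3 * suc Q * (3 * suc Q * (N * (C * suc Q)))
        ≡⟨ regroup N C (suc Q) ⟩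
      N * (9 * C * cube (suc Q)) ∎
      where
      triple : ∀ Q → 2 * Q + Q ≡ 3 * Q
      triple = solve-∀ℕ
      side : 2 * suc Q + 1 ≤ 3 * suc Q
      side = ℕₚ.≤-trans (ℕₚ.+-monoʳ-≤ (2 * suc Q) (s≤s z≤n)) (ℕₚ.≤-reflexive (triple (suc Q)))

  -- The decomposition by gcd is solved for its term d = 1, and `balanced` controls the box sum.
  sumPrim-recursion : ∀ {C N φ} → Balanced C N φ → ∀ n →
    ∣ sumPrim (suc n) φ ∣ ≤ N * (C * (suc n * suc n)) + sumℕ n (λ i → (2 + i) * ∣ sumPrim (suc n / (2 + i)) φ ∣)
  sumPrim-recursion {C} {N} {φ} bal n = begin
    ∣ sumPrim (suc n) φ ∣
      ≡⟨ cong ∣_∣ (isolate (sumPrim (suc n) φ) rest) ⟩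
    ∣ (sumPrim (suc n) φ ℤ.+ rest) ℤ.- rest ∣
      ≡⟨ cong (λ z → ∣ z ℤ.- rest ∣) (sumBox-split φ (homogeneous bal) n) ⟨
    ∣ sumBox (suc n) φ ℤ.- rest ∣
      ≤⟨ ℤₚ.∣i-j∣≤∣i∣+∣j∣ (sumBox (suc n) φ) rest ⟩
    ∣ sumBox (suc n) φ ∣ + ∣ rest ∣
      ≤⟨ ℕₚ.+-mono-≤ (balanced bal n) (∣sumBelow∣≤ n _) ⟩
    N * (C * (suc n * suc n)) + sumℕ n (λ i → ∣ + (2 + i) ℤ.* sumPrim (suc n / (2 + i)) φ ∣)
      ≤⟨ ℕₚ.+-monoʳ-≤ _ (sumℕ-mono n (λ i _ → ℕₚ.≤-reflexive (ℤₚ.abs-* (+ (2 + i)) (sumPrim (suc n / (2 + i)) φ)))) ⟩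
    N * (C * (suc n * suc n)) + sumℕ n (λ i → (2 + i) * ∣ sumPrim (suc n / (2 + i)) φ ∣) ∎
    where
    open ℕₚ.≤-Reasoning
    rest : ℤ
    rest = sumBelow n (λ i → + (2 + i) ℤ.* sumPrim (suc n / (2 + i)) φ)
    isolate : ∀ a b → a ≡ (a ℤ.+ b) ℤ.- b
    isolate a b = sym (trans (ℤₚ.+-assoc a b (ℤ.- b)) (trans (cong (λ z → a ℤ.+ z) (ℤₚ.+-inverseʳ b)) (ℤₚ.+-identityʳ a)))

  -- One iteration multiplies the leading constant by 3/4 = 9/12: the divisor sum accounts for 8/12,
  -- and the remaining 1/12 swallows the terms of order Q². `B` is produced before `N` and `φ`,
  -- hence is common to all edges. The coefficient 1 + 9C, rather than 9C, is always positive, so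
  -- one copy of Q³ fits into it.
  contraction : ∀ C k → Σ ℕ λ B → ∀ N φ → Balanced C N φ → ∀ Q →
    4 ^ k * ∣ sumPrim Q φ ∣ ≤ N * (3 ^ k * (1 + 9 * C) * cube Q + B)
  contraction C zero = 0 , λ N φ bal Q → begin
    1 * ∣ sumPrim Q φ ∣                   ≡⟨ ℕₚ.*-identityˡ _ ⟩
    ∣ sumPrim Q φ ∣                       ≤⟨ sumPrim-trivial bal Q ⟩
    N * (9 * C * cube Q)                  ≤⟨ ℕₚ.*-monoʳ-≤ N (ℕₚ.m≤n+m _ (cube Q)) ⟩
    N * (cube Q + 9 * C * cube Q)         ≡⟨ cong (N *_) (pad (9 * C) (cube Q)) ⟩
    N * (1 * (1 + 9 * C) * cube Q + 0)    ∎
    where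
    open ℕₚ.≤-Reasoning
    pad : ∀ c k → k + c * k ≡ 1 * (1 + c) * k + 0
    pad = solve-∀ℕ
  contraction C (suc k) with contraction C k
  -- After multiplication by 12, `K` collects all coefficients of Q²; `square≤cube` then leaves K³
  -- as the new additive constant.
  ... | B , ih = cube K , step
    where
    open ℕₚ.≤-Reasoning
    α = 4 ^ k
    β = 3 ^ k * (1 + 9 * C)
    K = 3 * (4 * (α * C + B))
    1≤β : 1 ≤ β
    1≤β = ℕₚ.*-mono-≤ {1} {3 ^ k} {1} (ℕₚ.m^n>0 3 k) (s≤s z≤n)
    tidy : ∀ N β c B → N * (β * c + B) ≡ (N * β) * c + N * B
    tidy = solve-∀ℕ
    quadruple : ∀ α d → 3 * (4 * α * d) ≡ 4 * (3 * (α * d))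
    quadruple = solve-∀ℕ
    distribute : ∀ α x y → 4 * (3 * (α * (x + y))) ≡ 4 * (3 * (α * x) + 3 * (α * y))
    distribute = solve-∀ℕ
    regroup : ∀ N C α β B s c → 4 * (3 * (α * (N * (C * s))) + (2 * (N * β) * c + 3 * (N * B) * s))
      ≡ N * (8 * β * c + 3 * (4 * (α * C + B)) * s)
    regroup = solve-∀ℕ
    final : ∀ N w c m K → N * (8 * (w * m) * c + (w * m * c) + 3 * K) ≡ 3 * (N * (3 * w * m * c + K))
    final = solve-∀ℕ
    absorb : ∀ n → 8 * β * cube (suc n) + K * (suc n * suc n) ≤ 8 * β * cube (suc n) + β * cube (suc n) + 3 * cube K
    absorb n = begin
      8 * β * c + K * (suc n * suc n)     ≤⟨ ℕₚ.+-monoʳ-≤ (8 * β * c) (square≤cube K (suc n)) ⟩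
      8 * β * c + (c + cube K)            ≤⟨ ℕₚ.+-monoʳ-≤ (8 * β * c) (ℕₚ.+-mono-≤ (ℕₚ.m≤n*m c β {{ℕ.>-nonZero 1≤β}}) (ℕₚ.m≤n*m (cube K) 3)) ⟩
      8 * β * c + (β * c + 3 * cube K)    ≡⟨ ℕₚ.+-assoc (8 * β * c) (β * c) _ ⟨
      8 * β * c + β * c + 3 * cube K      ∎
      where c = cube (suc n)
    step : ∀ N φ → Balanced C N φ → ∀ Q → 4 ^ suc k * ∣ sumPrim Q φ ∣ ≤ N * (3 ^ suc k * (1 + 9 * C) * cube Q + cube K)
    step N φ bal zero = ℕₚ.≤-trans (ℕₚ.*-monoʳ-≤ (4 ^ suc k) (sumPrim-trivial bal 0))
      (ℕₚ.≤-trans (ℕₚ.≤-reflexive (vanish (4 ^ suc k) N C)) z≤n)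
      where
      vanish : ∀ a N C → a * (N * (9 * C * 0)) ≡ 0
      vanish = solve-∀ℕ
    step N φ bal (suc n) = ℕₚ.*-cancelˡ-≤ 3 (begin
      3 * (4 * α * ∣ sumPrim Q φ ∣)
        ≡⟨ quadruple α ∣ sumPrim Q φ ∣ ⟩
      4 * (3 * (α * ∣ sumPrim Q φ ∣))
        ≤⟨ ℕₚ.*-monoʳ-≤ 4 (ℕₚ.*-monoʳ-≤ 3 (ℕₚ.*-monoʳ-≤ α (sumPrim-recursion bal n))) ⟩
      4 * (3 * (α * (N * (C * (Q * Q)) + T)))
        ≡⟨ distribute α _ T ⟩
      4 * (3 * (α * (N * (C * (Q * Q)))) + 3 * (α * T))
        ≤⟨ ℕₚ.*-monoʳ-≤ 4 (ℕₚ.+-monoʳ-≤ (3 * (α * (N * (C * (Q * Q))))) (sum-divided-bound α (N * β) (N * B) (λ m → ∣ sumPrim m φ ∣)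
             (λ m → ℕₚ.≤-trans (ih N φ bal m) (ℕₚ.≤-reflexive (tidy N β (cube m) B))) n)) ⟩
      4 * (3 * (α * (N * (C * (Q * Q)))) + (2 * (N * β) * cube Q + 3 * (N * B) * (Q * Q)))
        ≡⟨ regroup N C α β B (Q * Q) (cube Q) ⟩
      N * (8 * β * cube Q + K * (Q * Q))
        ≤⟨ ℕₚ.*-monoʳ-≤ N (absorb n) ⟩
      N * (8 * β * cube Q + β * cube Q + 3 * cube K)
        ≡⟨ final N (3 ^ k) (cube Q) (1 + 9 * C) (cube K) ⟩
      3 * (N * (3 ^ suc k * (1 + 9 * C) * cube Q + cube K)) ∎)
      where
      Q = suc n
      T = sumℕ n (λ i → (2 + i) * ∣ sumPrim (suc n / (2 + i)) φ ∣)

  -- Bernoulli: (4/3)^j ≥ 1 + j/3, so j = 3L iterations gain a factor L. This explicit count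
  -- replaces a limit.
  4^3L≥L*3^3L : ∀ L → L * 3 ^ (3 * L) ≤ 4 ^ (3 * L)
  4^3L≥L*3^3L L = ℕₚ.*-cancelˡ-≤ 3 (begin
    3 * (L * 3 ^ j)       ≡⟨ ℕₚ.*-assoc 3 L (3 ^ j) ⟨
    j * 3 ^ j             ≤⟨ ℕₚ.*-monoˡ-≤ (3 ^ j) (ℕₚ.m≤n+m j 3) ⟩
    (3 + j) * 3 ^ j       ≤⟨ bernoulli j ⟩
    3 * 4 ^ j             ∎)
    where
    open ℕₚ.≤-Reasoning
    j = 3 * L
    bernoulli : ∀ j → (3 + j) * 3 ^ j ≤ 3 * 4 ^ j
    bernoulli zero    = ℕₚ.≤-refl
    bernoulli (suc j) = begin
      (4 + j) * (3 * 3 ^ j)     ≤⟨ ℕₚ.m≤m+n _ (j * 3 ^ j) ⟩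
      (4 + j) * (3 * 3 ^ j) + j * 3 ^ j ≡⟨ regroup j (3 ^ j) ⟩
      4 * ((3 + j) * 3 ^ j)     ≤⟨ ℕₚ.*-monoʳ-≤ 4 (bernoulli j) ⟩
      4 * (3 * 4 ^ j)           ≡⟨ swap (4 ^ j) ⟩
      3 * (4 * 4 ^ j)           ∎
      where
      regroup : ∀ j t → (4 + j) * (3 * t) + j * t ≡ 4 * ((3 + j) * t)
      regroup = solve-∀ℕ
      swap : ∀ t → 4 * (3 * t) ≡ 3 * (4 * t)
      swap = solve-∀ℕ

  m≤cube : ∀ m → m ≤ cube m
  m≤cube zero    = z≤n
  m≤cube (suc m) = ℕₚ.m≤n*m (suc m) (suc m * suc m)

  equidistribution : ∀ C k → Σ ℕ λ Q₀ → ∀ N φ → Balanced C N φ → ∀ Q → Q₀ ≤ Q →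
    k * ∣ sumPrim Q φ ∣ ≤ N * cube Q
  -- So many iterations bring the leading constant 1 + 9C below 1/(2k). The other half of 1/k pays
  -- for `B`, which is absorbed once Q ≥ B.
  equidistribution C k with contraction C (3 * (2 * k * (1 + 9 * C)))
  ... | B , contracted = B , λ N φ bal Q B≤Q → ℕₚ.*-cancelˡ-≤ (2 * m) {{ℕ.>-nonZero (ℕₚ.*-mono-≤ {1} {2} {1} (s≤s z≤n) 1≤m)}} (begin
    2 * m * (k * ∣ sumPrim Q φ ∣)
      ≡⟨ regroup (3 ^ j) (1 + 9 * C) k ∣ sumPrim Q φ ∣ ⟩
    L * 3 ^ j * ∣ sumPrim Q φ ∣
      ≤⟨ ℕₚ.*-monoˡ-≤ ∣ sumPrim Q φ ∣ (4^3L≥L*3^3L L) ⟩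
    4 ^ j * ∣ sumPrim Q φ ∣
      ≤⟨ contracted N φ bal Q ⟩
    N * (m * cube Q + B)
      ≤⟨ ℕₚ.*-monoʳ-≤ N (ℕₚ.+-monoʳ-≤ (m * cube Q) (ℕₚ.≤-trans B≤Q (ℕₚ.≤-trans (m≤cube Q) (ℕₚ.m≤n*m (cube Q) m {{ℕ.>-nonZero 1≤m}})))) ⟩
    N * (m * cube Q + m * cube Q)
      ≡⟨ double N m (cube Q) ⟩
    2 * m * (N * cube Q) ∎)
    where
    open ℕₚ.≤-Reasoning
    L = 2 * k * (1 + 9 * C)
    j = 3 * L
    m = 3 ^ j * (1 + 9 * C)
    1≤m : 1 ≤ m
    1≤m = ℕₚ.*-mono-≤ {1} {3 ^ j} {1} (ℕₚ.m^n>0 3 j) (s≤s z≤n)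
    regroup : ∀ t c k d → 2 * (t * c) * (k * d) ≡ 2 * k * c * t * d
    regroup = solve-∀ℕ
    double : ∀ N m c → N * (m * c + m * c) ≡ 2 * m * (N * c)
    double = solve-∀ℕ

-- Moments of a half-plane in a box
module _ where
  open import Data.Integer using (_+_; _*_; -_; _-_; _≤_; _<_; _⊔_; +≤+; -≤+; +<+)

  pos? : ℤ → Bool
  pos? z = does (+ 0 ℤ.<? z)

  pos?-cong : ∀ y z → (+ 0 < y → + 0 < z) → (+ 0 < z → + 0 < y) → pos? y ≡ pos? z
  pos?-cong y z f g = does-⇔ (mk⇔ f g) (+ 0 ℤ.<? y) (+ 0 ℤ.<? z)

  pos?-scale : ∀ d z → pos? (+ suc d * z) ≡ pos? z
  pos?-scale d z = pos?-cong (+ suc d * z) z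
    (λ p → ℤₚ.*-cancelˡ-<-nonNeg (+ suc d) (subst (_< + suc d * z) (sym (ℤₚ.*-zeroʳ (+ suc d))) p))
    (λ p → subst (_< + suc d * z) (ℤₚ.*-zeroʳ (+ suc d)) (ℤₚ.*-monoˡ-<-pos (+ suc d) p))

  i<j⇒i≤j-1 : ∀ {i j} → i < j → i ≤ j - + 1
  i<j⇒i≤j-1 {i} {j} i<j = subst (_≤ j - + 1) (cancel i) (ℤₚ.+-monoˡ-≤ (- + 1) (ℤₚ.i<j⇒suc[i]≤j i<j))
    where
    cancel : ∀ i → + 1 + i - + 1 ≡ i
    cancel = solve-∀

  i-1≤i : ∀ i → i - + 1 ≤ i
  i-1≤i i = subst (i - + 1 ≤_) (ℤₚ.+-identityʳ i) (ℤₚ.+-monoʳ-≤ i -≤+)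

  i<j⇒0<j-i : ∀ {i j} → i < j → + 0 < j - i
  i<j⇒0<j-i {i} {j} i<j = subst (_< j - i) (ℤₚ.+-inverseʳ i) (ℤₚ.+-monoˡ-< (- i) i<j)

  0<i-j⇒j<i : ∀ {i j} → + 0 < i - j → j < i
  0<i-j⇒j<i {i} {j} p = subst₂ _<_ (ℤₚ.+-identityˡ j) (cancel i j) (ℤₚ.+-monoˡ-< j p)
    where
    cancel : ∀ i j → i - j + j ≡ i
    cancel = solve-∀

  sumSym-threshold : ∀ M n (Ψ : ℤ → ℤ) → -[1+ M ] ≤ n → n ≤ + M →
    sumSym M (λ y → ⟦ pos? (y - n) ⟧ * (Ψ y - Ψ (y - + 1))) ≡ Ψ (+ M) - Ψ n
  sumSym-threshold M n Ψ lo hi = begin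
    sumSym M (λ y → ⟦ pos? (y - n) ⟧ * (Ψ y - Ψ (y - + 1)))
      ≡⟨ sumSym-cong M (λ y _ → clamp y) ⟩
    sumSym M (λ y → Ψ (y ⊔ n) - Ψ ((y - + 1) ⊔ n))
      ≡⟨ sumSym-telescope M (λ y → Ψ (y ⊔ n)) ⟩
    Ψ (+ M ⊔ n) - Ψ (-[1+ M ] ⊔ n)
      ≡⟨ cong₂ (λ u v → Ψ u - Ψ v) (ℤₚ.i≥j⇒i⊔j≡i hi) (ℤₚ.i≤j⇒i⊔j≡j lo) ⟩
    Ψ (+ M) - Ψ n ∎
    where
    open ≡-Reasoning
    clamp : ∀ y → ⟦ pos? (y - n) ⟧ * (Ψ y - Ψ (y - + 1)) ≡ Ψ (y ⊔ n) - Ψ ((y - + 1) ⊔ n)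
    clamp y with n ℤ.<? y
    ... | yes n<y rewrite dec-true (+ 0 ℤ.<? (y - n)) (i<j⇒0<j-i n<y)
      | ℤₚ.i≥j⇒i⊔j≡i (ℤₚ.<⇒≤ n<y) | ℤₚ.i≥j⇒i⊔j≡i (i<j⇒i≤j-1 n<y) = ℤₚ.*-identityˡ (Ψ y - Ψ (y - + 1))
    ... | no n≮y rewrite dec-false (+ 0 ℤ.<? (y - n)) (λ p → n≮y (0<i-j⇒j<i p))
      | ℤₚ.i≤j⇒i⊔j≡j (ℤₚ.≮⇒≥ n≮y) | ℤₚ.i≤j⇒i⊔j≡j (ℤₚ.≤-trans (i-1≤i y) (ℤₚ.≮⇒≥ n≮y)) = sym (ℤₚ.+-inverseʳ (Ψ n))

  ∣i∣≤n⇒-n≤i : ∀ i {n} → ∣ i ∣ ℕ.≤ n → - + n ≤ i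
  ∣i∣≤n⇒-n≤i (+ m)      {n} p = ℤₚ.≤-trans (ℤₚ.neg-mono-≤ (+≤+ {0} {n} ℕ.z≤n)) (+≤+ ℕ.z≤n)
  ∣i∣≤n⇒-n≤i -[1+ m ] {n} p = ℤₚ.neg-mono-≤ (+≤+ p)

  ∣i∣≤n⇒i≤n : ∀ i {n} → ∣ i ∣ ℕ.≤ n → i ≤ + n
  ∣i∣≤n⇒i≤n (+ m)    p = +≤+ p
  ∣i∣≤n⇒i≤n -[1+ m ] p = -≤+

  bounds⇒∣i∣≤n : ∀ {i n} → - + n ≤ i → i ≤ + n → ∣ i ∣ ℕ.≤ n
  bounds⇒∣i∣≤n {+ m} lo hi = ℤₚ.drop‿+≤+ hi
  bounds⇒∣i∣≤n { -[1+ m ]} {n} lo hi = ℤₚ.drop‿+≤+ (subst (+ suc m ≤_) (ℤₚ.neg-involutive (+ n)) (ℤₚ.neg-mono-≤ lo))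

  -- Lattice points of one column above a rational height.

  module Row (q′ : ℕ) where

    q : ℕ
    q = suc q′

    floor : ℤ → ℤ
    floor c = c /ℕ q

    rem : ℤ → ℤ
    rem c = + (c %ℕ q)

    division : ∀ c → c ≡ rem c + floor c * + q
    division c = a≡a%ℕn+[a/ℕn]*n c q

    floor-lower : ∀ c → floor c * + q ≤ c
    floor-lower c = subst (floor c * + q ≤_) (sym (division c))
      (subst (_≤ rem c + floor c * + q) (ℤₚ.+-identityˡ (floor c * + q)) (ℤₚ.+-monoˡ-≤ (floor c * + q) (+≤+ ℕ.z≤n)))

    floor-upper : ∀ c → c < (+ 1 + floor c) * + q
    floor-upper c = subst₂ _<_ (sym (division c)) (distribute (floor c) (+ q)) (ℤₚ.+-monoˡ-< (floor c * + q) (+<+ (n%ℕd<d c q)))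
      where
      distribute : ∀ n q → q + n * q ≡ (+ 1 + n) * q
      distribute = solve-∀

    -- With c = a x this is where |a| ≤ q enters: the cut stays inside the column. The lower bound
    -- is integrality applied to -M ≤ c/q < floor c + 1.
    floor-bound : ∀ c {M} → ∣ c ∣ ℕ.≤ q ℕ.* M → ∣ floor c ∣ ℕ.≤ M
    floor-bound c {M} p = bounds⇒∣i∣≤n lo hi
      where
      qM : + (q ℕ.* M) ≡ + M * + q
      qM = trans (cong +_ (ℕₚ.*-comm q M)) (ℤₚ.pos-* M q)
      hi : floor c ≤ + M
      hi = ℤₚ.*-cancelʳ-≤-pos (floor c) (+ M) (+ q)
        (ℤₚ.≤-trans (floor-lower c) (subst (c ≤_) qM (∣i∣≤n⇒i≤n c p)))
      lo : - + M ≤ floor c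
      lo = subst (- + M ≤_) (cancel (floor c)) (i<j⇒i≤j-1 { - + M} {+ 1 + floor c} (ℤₚ.*-cancelʳ-<-nonNeg { - + M} {+ 1 + floor c} (+ q)
        (ℤₚ.≤-<-trans (subst (_≤ c) (trans (cong -_ qM) (ℤₚ.neg-distribˡ-* (+ M) (+ q))) (∣i∣≤n⇒-n≤i c p)) (floor-upper c))))
        where
        cancel : ∀ n → + 1 + n - + 1 ≡ n
        cancel = solve-∀

    pos?-floor : ∀ c y → pos? (+ q * y - c) ≡ pos? (y - floor c)
    pos?-floor c y = pos?-cong (+ q * y - c) (y - floor c) to from
      where
      to : + 0 < + q * y - c → + 0 < y - floor c
      to p = i<j⇒0<j-i {floor c} {y} (ℤₚ.*-cancelʳ-<-nonNeg {floor c} {y} (+ q)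
        (ℤₚ.≤-<-trans (floor-lower c) (subst (c <_) (ℤₚ.*-comm (+ q) y) (0<i-j⇒j<i p))))
      from : + 0 < y - floor c → + 0 < + q * y - c
      from p = i<j⇒0<j-i {c} {+ q * y} (ℤₚ.<-≤-trans (floor-upper c)
        (subst ((+ 1 + floor c) * + q ≤_) (ℤₚ.*-comm y (+ q)) (ℤₚ.*-monoʳ-≤-nonNeg (+ q) (ℤₚ.i<j⇒suc[i]≤j (0<i-j⇒j<i {y} {floor c} p)))))

    sum-above : ∀ M c (Ψ : ℤ → ℤ) → ∣ c ∣ ℕ.≤ q ℕ.* M →
      sumSym M (λ y → ⟦ pos? (+ q * y - c) ⟧ * (Ψ y - Ψ (y - + 1))) ≡ Ψ (+ M) - Ψ (floor c)
    sum-above M c Ψ p = trans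
      (sumSym-cong M (λ y _ → cong (λ b → ⟦ b ⟧ * (Ψ y - Ψ (y - + 1))) (pos?-floor c y)))
      (sumSym-threshold M (floor c) Ψ (ℤₚ.≤-trans (ℤₚ.neg-mono-≤ (+≤+ (ℕₚ.n≤1+n M))) (∣i∣≤n⇒-n≤i (floor c) (floor-bound c p)))
        (∣i∣≤n⇒i≤n (floor c) (floor-bound c p)))

    count-above : ∀ M c → ∣ c ∣ ℕ.≤ q ℕ.* M → sumSym M (λ y → ⟦ pos? (+ q * y - c) ⟧) ≡ + M - floor c
    count-above M c p = trans (sumSym-cong M (λ y _ → unit y ⟦ pos? (+ q * y - c) ⟧)) (sum-above M c (λ y → y) p)
      where
      unit : ∀ y b → b ≡ b * (y - (y - + 1))
      unit = solve-∀

    moment-above : ∀ M c → ∣ c ∣ ℕ.≤ q ℕ.* M →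
      sumSym M (λ y → ⟦ pos? (+ q * y - c) ⟧ * (+ 2 * y)) ≡ + M * (+ M + + 1) - floor c * (floor c + + 1)
    moment-above M c p = trans (sumSym-cong M (λ y _ → difference y ⟦ pos? (+ q * y - c) ⟧)) (sum-above M c (λ y → y * (y + + 1)) p)
      where
      difference : ∀ y b → b * (+ 2 * y) ≡ b * (y * (y + + 1) - (y - + 1) * ((y - + 1) + + 1))
      difference = solve-∀

  sumSym-id : ∀ M → sumSym M (λ x → x) ≡ + 0
  sumSym-id zero    = refl
  sumSym-id (suc M) rewrite sumSym-id M = cancel (+ suc M)
    where
    cancel : ∀ x → + 0 + (x - x) ≡ + 0
    cancel = solve-∀

  sumSym-squares : ∀ M → + 3 * sumSym M (λ x → x * x) ≡ (+ 2 * + M + + 1) * (+ M * (+ M + + 1))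
  sumSym-squares zero    = refl
  sumSym-squares (suc M) = begin
    + 3 * (sumSym M (λ x → x * x) + (x * x + - x * - x))
      ≡⟨ regroup (sumSym M (λ x → x * x)) x ⟩
    + 3 * sumSym M (λ x → x * x) + + 6 * (x * x)
      ≡⟨ cong (_+ + 6 * (x * x)) (sumSym-squares M) ⟩
    (+ 2 * + M + + 1) * (+ M * (+ M + + 1)) + + 6 * ((+ 1 + + M) * (+ 1 + + M))
      ≡⟨ close (+ M) ⟩
    (+ 2 * x + + 1) * (x * (x + + 1)) ∎
    where
    open ≡-Reasoning
    x = + suc M
    regroup : ∀ s x → + 3 * (s + (x * x + - x * - x)) ≡ + 3 * s + + 6 * (x * x)
    regroup = solve-∀
    close : ∀ m → (+ 2 * m + + 1) * (m * (m + + 1)) + + 6 * ((+ 1 + m) * (+ 1 + m))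
      ≡ (+ 2 * (+ 1 + m) + + 1) * ((+ 1 + m) * ((+ 1 + m) + + 1))
    close = solve-∀

  +odd : ∀ M → + (2 ℕ.* M ℕ.+ 1) ≡ + 2 * + M + + 1
  +odd M = cong (_+ + 1) (ℤₚ.pos-* 2 M)

  -- The leading terms M³ of the row sums cancel because 3 Σ x² = (2M+1) M (M+1) exactly.
  sumSym-cancel : ∀ M b c (E : ℤ → ℤ) →
    sumSym M (λ x → (+ 3 * E x + b * x) + (c * (+ M * (+ M + + 1)) + - (+ 3 * c) * (x * x))) ≡ + 3 * sumSym M E
  sumSym-cancel M b c E = begin
    sumSym M (λ x → (+ 3 * E x + b * x) + (c * K + - (+ 3 * c) * (x * x)))
      ≡⟨ sumSym-+ M _ _ ⟩
    sumSym M (λ x → + 3 * E x + b * x) + sumSym M (λ x → c * K + - (+ 3 * c) * (x * x))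
      ≡⟨ cong₂ _+_ (sumSym-+ M _ _) (sumSym-+ M _ _) ⟩
    (sumSym M (λ x → + 3 * E x) + sumSym M (λ x → b * x)) + (sumSym M (λ _ → c * K) + sumSym M (λ x → - (+ 3 * c) * (x * x)))
      ≡⟨ cong₂ _+_ (cong₂ _+_ (sumSym-*ˡ M (+ 3) E) (trans (sumSym-*ˡ M b (λ x → x)) (cong (b *_) (sumSym-id M))))
                   (cong₂ _+_ (trans (sumSym-const M (c * K)) (cong (_* (c * K)) (+odd M))) (sumSym-*ˡ M (- (+ 3 * c)) (λ x → x * x))) ⟩
    (+ 3 * sumSym M E + b * + 0) + ((+ 2 * + M + + 1) * (c * K) + - (+ 3 * c) * sumSym M (λ x → x * x))
      ≡⟨ regroup (+ 3 * sumSym M E) b c K (sumSym M (λ x → x * x)) (+ 2 * + M + + 1) ⟩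
    + 3 * sumSym M E + c * ((+ 2 * + M + + 1) * K - + 3 * sumSym M (λ x → x * x))
      ≡⟨ cong (λ z → + 3 * sumSym M E + c * ((+ 2 * + M + + 1) * K - z)) (sumSym-squares M) ⟩
    + 3 * sumSym M E + c * ((+ 2 * + M + + 1) * K - (+ 2 * + M + + 1) * K)
      ≡⟨ vanish (+ 3 * sumSym M E) c ((+ 2 * + M + + 1) * K) ⟩
    + 3 * sumSym M E ∎
    where
    open ≡-Reasoning
    K = + M * (+ M + + 1)
    regroup : ∀ s b c K t o → (s + b * + 0) + (o * (c * K) + - (+ 3 * c) * t) ≡ s + c * (o * K - + 3 * t)
    regroup = solve-∀
    vanish : ∀ s c k → s + c * (k - k) ≡ s
    vanish = solve-∀

  ∣⟦b⟧*i∣≤∣i∣ : ∀ b i → ∣ ⟦ b ⟧ * i ∣ ℕ.≤ ∣ i ∣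
  ∣⟦b⟧*i∣≤∣i∣ true  i = ℕₚ.≤-reflexive (cong ∣_∣ (ℤₚ.*-identityˡ i))
  ∣⟦b⟧*i∣≤∣i∣ false i = ℕ.z≤n

  abs-*-≤ : ∀ i j {m n} → ∣ i ∣ ℕ.≤ m → ∣ j ∣ ℕ.≤ n → ∣ i * j ∣ ℕ.≤ m ℕ.* n
  abs-*-≤ i j p q = ℕₚ.≤-trans (ℕₚ.≤-reflexive (ℤₚ.abs-* i j)) (ℕₚ.*-mono-≤ p q)

  abs-+-≤ : ∀ i j {m n} → ∣ i ∣ ℕ.≤ m → ∣ j ∣ ℕ.≤ n → ∣ i + j ∣ ℕ.≤ m ℕ.+ n
  abs-+-≤ i j p q = ℕₚ.≤-trans (ℤₚ.∣i+j∣≤∣i∣+∣j∣ i j) (ℕₚ.+-mono-≤ p q)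

  abs-neg-≤ : ∀ i {n} → ∣ i ∣ ℕ.≤ n → ∣ - i ∣ ℕ.≤ n
  abs-neg-≤ i p = ℕₚ.≤-trans (ℕₚ.≤-reflexive (ℤₚ.∣-i∣≡∣i∣ i)) p

  -- The two weights attached to an edge and their box sums.

  leftX leftY : V2 → V2 → ℤ
  leftX e (x , y) = ⟦ pos? (cross e (x , y)) ⟧ * x
  leftY e (x , y) = ⟦ pos? (cross e (x , y)) ⟧ * y

  -- The factor 2 makes the partial sums y (y + 1).
  upperY : V2 → ℤ
  upperY (x , y) = ⟦ pos? y ⟧ * (+ 2 * y)

  cross-scale : ∀ e d x y → cross e (+ suc d * x , + suc d * y) ≡ + suc d * cross e (x , y)
  cross-scale (q , a) d x y = lemma q a (+ suc d) x y
    where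
    lemma : ∀ q a d x y → q * (d * y) - a * (d * x) ≡ d * (q * y - a * x)
    lemma = solve-∀

  left-homogeneous : ∀ e d x y → pos? (cross e (+ suc d * x , + suc d * y)) ≡ pos? (cross e (x , y))
  left-homogeneous e d x y = trans (cong pos? (cross-scale e d x y)) (pos?-scale d (cross e (x , y)))

  upperY-bound : ∀ x y {M} → ∣ y ∣ ℕ.≤ M → ∣ upperY (x , y) ∣ ℕ.≤ 2 ℕ.* M
  upperY-bound x y p = ℕₚ.≤-trans (∣⟦b⟧*i∣≤∣i∣ (pos? y) (+ 2 * y)) (abs-*-≤ (+ 2) y ℕₚ.≤-refl p)

  sum-upperY : ∀ M → sumSym M (λ y → ⟦ pos? y ⟧ * (+ 2 * y)) ≡ + M * (+ M + + 1)
  sum-upperY M = trans (sumSym-cong M (λ y _ → cong (λ z → ⟦ pos? z ⟧ * (+ 2 * y)) (unit y)))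
    (trans (Row.moment-above 0 M (+ 0) ℕ.z≤n) (drop (+ M * (+ M + + 1))))
    where
    unit : ∀ y → y ≡ + 1 * y - + 0
    unit = solve-∀
    drop : ∀ k → k - + 0 ≡ k
    drop = solve-∀

  module HalfPlane (q′ : ℕ) (a : ℤ) (∣a∣≤q : ∣ a ∣ ℕ.≤ suc q′) where

    open Row q′

    e : V2
    e = (+ q , a)

    ax-bound : ∀ x {M} → ∣ x ∣ ℕ.≤ M → ∣ a * x ∣ ℕ.≤ q ℕ.* M
    ax-bound x p = abs-*-≤ a x ∣a∣≤q p

    -- To leading order `leftX`, `leftY` and `upperY` have box sums -(2a/3q) M³, (1 - a²/3q²) M³ and
    -- 2 M³; the coefficients make these cancel.
    momentX momentY : V2 → ℤ
    momentX w = + 3 * + q * leftX e w + a * upperY w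
    momentY w = + 6 * (+ q * + q) * leftY e w + - (+ 3 * (+ q * + q) - a * a) * upperY w

    -- The exact remainders of a column when ⌊a x / q⌋ is written as (a x - r) / q. As 0 ≤ r < q,
    -- they grow at most linearly in M.
    errorX errorY : ℤ → ℤ
    errorX x = x * rem (a * x)
    errorY x = (+ q * floor (a * x)) * (+ 2 * rem (a * x) - + q) + rem (a * x) * rem (a * x)

    rowX : ∀ M x → ∣ x ∣ ℕ.≤ M → sumSym M (λ y → momentX (x , y))
      ≡ (+ 3 * errorX x + (+ 3 * + q * + M) * x) + (a * (+ M * (+ M + + 1)) + - (+ 3 * a) * (x * x))
    rowX M x p = begin
      sumSym M (λ y → + 3 * + q * (h y * x) + a * upperY (x , y))
        ≡⟨ sumSym-cong M (λ y _ → cong (_+ a * upperY (x , y)) (commute (+ 3 * + q) (h y) x)) ⟩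
      sumSym M (λ y → + 3 * + q * x * h y + a * upperY (x , y))
        ≡⟨ sumSym-+ M _ _ ⟩
      sumSym M (λ y → + 3 * + q * x * h y) + sumSym M (λ y → a * upperY (x , y))
        ≡⟨ cong₂ _+_ (trans (sumSym-*ˡ M (+ 3 * + q * x) h) (cong (+ 3 * + q * x *_) (count-above M (a * x) (ax-bound x p))))
                     (trans (sumSym-*ˡ M a _) (cong (a *_) (sum-upperY M))) ⟩
      + 3 * + q * x * (+ M - n) + a * K
        ≡⟨ expand (+ q) x (+ M) n (a * K) ⟩
      + 3 * + q * + M * x + a * K - + 3 * x * (n * + q)
        ≡⟨ cong (λ z → + 3 * + q * + M * x + a * K - + 3 * x * z) (isolate (rem (a * x)) (n * + q)) ⟩
      + 3 * + q * + M * x + a * K - + 3 * x * (rem (a * x) + n * + q - rem (a * x))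
        ≡⟨ cong (λ z → + 3 * + q * + M * x + a * K - + 3 * x * (z - rem (a * x))) (division (a * x)) ⟨
      + 3 * + q * + M * x + a * K - + 3 * x * (a * x - rem (a * x))
        ≡⟨ collect (+ 3 * + q * + M) x a K (rem (a * x)) ⟩
      (+ 3 * (x * rem (a * x)) + (+ 3 * + q * + M) * x) + (a * K + - (+ 3 * a) * (x * x)) ∎
      where
      open ≡-Reasoning
      n = floor (a * x)
      K = + M * (+ M + + 1)
      h : ℤ → ℤ
      h y = ⟦ pos? (+ q * y - a * x) ⟧
      commute : ∀ c b x → c * (b * x) ≡ c * x * b
      commute = solve-∀
      expand : ∀ q x M n k → + 3 * q * x * (M - n) + k ≡ + 3 * q * M * x + k - + 3 * x * (n * q)
      expand = solve-∀
      isolate : ∀ r t → t ≡ r + t - r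
      isolate = solve-∀
      collect : ∀ c x a K r → c * x + a * K - + 3 * x * (a * x - r) ≡ (+ 3 * (x * r) + c * x) + (a * K + - (+ 3 * a) * (x * x))
      collect = solve-∀

    rowY : ∀ M x → ∣ x ∣ ℕ.≤ M → sumSym M (λ y → momentY (x , y))
      ≡ (+ 3 * errorY x + + 0 * x) + (a * a * (+ M * (+ M + + 1)) + - (+ 3 * (a * a)) * (x * x))
    rowY M x p = begin
      sumSym M (λ y → + 6 * (+ q * + q) * (h y * y) + c * upperY (x , y))
        ≡⟨ sumSym-cong M (λ y _ → cong (_+ c * upperY (x , y)) (commute (+ q * + q) (h y) y)) ⟩
      sumSym M (λ y → + 3 * (+ q * + q) * (h y * (+ 2 * y)) + c * upperY (x , y))
        ≡⟨ sumSym-+ M _ _ ⟩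
      sumSym M (λ y → + 3 * (+ q * + q) * (h y * (+ 2 * y))) + sumSym M (λ y → c * upperY (x , y))
        ≡⟨ cong₂ _+_ (trans (sumSym-*ˡ M (+ 3 * (+ q * + q)) _) (cong (+ 3 * (+ q * + q) *_) (moment-above M (a * x) (ax-bound x p))))
                     (trans (sumSym-*ˡ M c _) (cong (c *_) (sum-upperY M))) ⟩
      + 3 * (+ q * + q) * (K - n * (n + + 1)) + c * K
        -- Completes q n to q n + r = a x; the cross terms go into `errorY`.
        ≡⟨ expand (+ q) n a K x r ⟩
      + 3 * errorY x + a * a * K - + 3 * ((r + n * + q) * (r + n * + q))
        ≡⟨ cong (λ z → + 3 * errorY x + a * a * K - + 3 * (z * z)) (division (a * x)) ⟨
      + 3 * errorY x + a * a * K - + 3 * ((a * x) * (a * x))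
        ≡⟨ collect (errorY x) x a K ⟩
      (+ 3 * errorY x + + 0 * x) + (a * a * K + - (+ 3 * (a * a)) * (x * x)) ∎
      where
      open ≡-Reasoning
      n = floor (a * x)
      r = rem (a * x)
      K = + M * (+ M + + 1)
      c = - (+ 3 * (+ q * + q) - a * a)
      h : ℤ → ℤ
      h y = ⟦ pos? (+ q * y - a * x) ⟧
      commute : ∀ c b x → + 6 * c * (b * x) ≡ + 3 * c * (b * (+ 2 * x))
      commute = solve-∀
      expand : ∀ q n a K x r → + 3 * (q * q) * (K - n * (n + + 1)) + - (+ 3 * (q * q) - a * a) * K
        ≡ + 3 * ((q * n) * (+ 2 * r - q) + r * r) + a * a * K - + 3 * ((r + n * q) * (r + n * q))
      expand = solve-∀
      collect : ∀ E x a K → + 3 * E + a * a * K - + 3 * ((a * x) * (a * x)) ≡ (+ 3 * E + + 0 * x) + (a * a * K + - (+ 3 * (a * a)) * (x * x))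
      collect = solve-∀

    sumBox-momentX : ∀ M → sumBox M momentX ≡ + 3 * sumSym M errorX
    sumBox-momentX M = trans (sumSym-cong M (rowX M)) (sumSym-cancel M (+ 3 * + q * + M) a errorX)

    sumBox-momentY : ∀ M → sumBox M momentY ≡ + 3 * sumSym M errorY
    sumBox-momentY M = trans (sumSym-cong M (rowY M)) (sumSym-cancel M (+ 0) (a * a) errorY)

  upperY-homogeneous : Homogeneous upperY
  upperY-homogeneous d x y rewrite pos?-scale d y = lemma ⟦ pos? y ⟧ (+ suc d) y
    where
    lemma : ∀ b d y → b * (+ 2 * (d * y)) ≡ d * (b * (+ 2 * y))
    lemma = solve-∀

  module HalfPlaneBalanced (q′ : ℕ) (a : ℤ) (∣a∣≤q : ∣ a ∣ ℕ.≤ suc q′) where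

    open Row q′
    open HalfPlane q′ a ∣a∣≤q

    combination-homogeneous : ∀ s t (f : V2 → ℤ) → Homogeneous f → Homogeneous (λ w → s * f w + t * upperY w)
    combination-homogeneous s t f hom d x y = trans
      (cong₂ (λ u v → s * u + t * v) (hom d x y) (upperY-homogeneous d x y))
      (lemma s t (+ suc d) (f (x , y)) (upperY (x , y)))
      where
      lemma : ∀ s t d u v → s * (d * u) + t * (d * v) ≡ d * (s * u + t * v)
      lemma = solve-∀

    exchange : ∀ b d x → b * (d * x) ≡ d * (b * x)
    exchange = solve-∀

    leftX-homogeneous : Homogeneous (leftX e)
    leftX-homogeneous d x y = trans (cong (λ b → ⟦ b ⟧ * (+ suc d * x)) (left-homogeneous e d x y))
      (exchange ⟦ pos? (cross e (x , y)) ⟧ (+ suc d) x)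

    leftY-homogeneous : Homogeneous (leftY e)
    leftY-homogeneous d x y = trans (cong (λ b → ⟦ b ⟧ * (+ suc d * y)) (left-homogeneous e d x y))
      (exchange ⟦ pos? (cross e (x , y)) ⟧ (+ suc d) y)

    rem≤q : ∀ c → ∣ rem c ∣ ℕ.≤ q
    rem≤q c = ℕₚ.<⇒≤ (n%ℕd<d c q)

    errorX-bound : ∀ M x → ∣ x ∣ ℕ.≤ M → ∣ errorX x ∣ ℕ.≤ M ℕ.* q
    errorX-bound M x p = abs-*-≤ x (rem (a * x)) p (rem≤q (a * x))

    two-rem-bound : ∀ c → ∣ + 2 * rem c - + q ∣ ℕ.≤ q
    two-rem-bound c = bounds⇒∣i∣≤n
      (subst₂ _≤_ (ℤₚ.+-identityˡ (- + q)) refl (ℤₚ.+-monoˡ-≤ (- + q) (subst (+ 0 ≤_) (ℤₚ.pos-* 2 (c %ℕ q)) (+≤+ ℕ.z≤n))))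
      (subst (+ 2 * rem c - + q ≤_) (halve (+ q)) (ℤₚ.+-monoˡ-≤ (- + q) (ℤₚ.*-monoˡ-≤-nonNeg (+ 2) (+≤+ (rem≤q c)))))
      where
      halve : ∀ q → + 2 * q - q ≡ q
      halve = solve-∀

    errorY-bound : ∀ M x → ∣ x ∣ ℕ.≤ M → ∣ errorY x ∣ ℕ.≤ q ℕ.* M ℕ.* q ℕ.+ q ℕ.* q
    errorY-bound M x p = abs-+-≤ ((+ q * floor (a * x)) * (+ 2 * rem (a * x) - + q)) (rem (a * x) * rem (a * x))
      (abs-*-≤ (+ q * floor (a * x)) (+ 2 * rem (a * x) - + q)
        (abs-*-≤ (+ q) (floor (a * x)) ℕₚ.≤-refl (floor-bound (a * x) (ax-bound x p))) (two-rem-bound (a * x)))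
      (abs-*-≤ (rem (a * x)) (rem (a * x)) (rem≤q (a * x)) (rem≤q (a * x)))

    odd≤3M : ∀ M → 2 ℕ.* suc M ℕ.+ 1 ℕ.≤ 3 ℕ.* suc M
    odd≤3M M = ℕₚ.≤-trans (ℕₚ.+-monoʳ-≤ (2 ℕ.* suc M) (ℕ.s≤s ℕ.z≤n)) (ℕₚ.≤-reflexive (triple (suc M)))
      where
      triple : ∀ M → 2 ℕ.* M ℕ.+ M ≡ 3 ℕ.* M
      triple = solve-∀ℕ

    -- One constant serves both weights. The value 18 = 3 · 3 · 2 comes from the box sum of
    -- `momentY`; the estimates here give 5 and 9, and the added terms 13 and 9 fill them up to 18.
    momentX-balanced : Balanced 18 q momentX
    momentX-balanced = record
      { homogeneous = combination-homogeneous (+ 3 * + q) a (leftX e) leftX-homogeneous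
      ; linear = λ M x y p r → ℕₚ.≤-trans
          (abs-+-≤ (+ 3 * + q * leftX e (x , y)) (a * upperY (x , y))
            (abs-*-≤ (+ 3 * + q) (leftX e (x , y)) (abs-*-≤ (+ 3) (+ q) ℕₚ.≤-refl ℕₚ.≤-refl)
              (ℕₚ.≤-trans (∣⟦b⟧*i∣≤∣i∣ (pos? (cross e (x , y))) x) p))
            (abs-*-≤ a (upperY (x , y)) ∣a∣≤q (upperY-bound x y r)))
          (ℕₚ.≤-trans (ℕₚ.m≤m+n _ (13 ℕ.* (q ℕ.* M))) (ℕₚ.≤-reflexive (linearX q M)))
      ; balanced = λ M → let open ℕₚ.≤-Reasoning in begin
          ∣ sumBox (suc M) momentX ∣
            ≡⟨ cong ∣_∣ (sumBox-momentX (suc M)) ⟩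
          ∣ + 3 * sumSym (suc M) errorX ∣
            ≤⟨ abs-*-≤ (+ 3) (sumSym (suc M) errorX) ℕₚ.≤-refl (sumSym-bound (suc M) _ (errorX-bound (suc M))) ⟩
          3 ℕ.* ((2 ℕ.* suc M ℕ.+ 1) ℕ.* (suc M ℕ.* q))
            ≤⟨ ℕₚ.*-monoʳ-≤ 3 (ℕₚ.*-monoˡ-≤ (suc M ℕ.* q) (odd≤3M M)) ⟩
          3 ℕ.* (3 ℕ.* suc M ℕ.* (suc M ℕ.* q))
            ≤⟨ ℕₚ.m≤m+n _ (9 ℕ.* (q ℕ.* (suc M ℕ.* suc M))) ⟩
          3 ℕ.* (3 ℕ.* suc M ℕ.* (suc M ℕ.* q)) ℕ.+ 9 ℕ.* (q ℕ.* (suc M ℕ.* suc M))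
            ≡⟨ quadratic q (suc M) ⟩
          q ℕ.* (18 ℕ.* (suc M ℕ.* suc M)) ∎
      }
      where
      linearX : ∀ q M → (3 ℕ.* q ℕ.* M ℕ.+ q ℕ.* (2 ℕ.* M)) ℕ.+ 13 ℕ.* (q ℕ.* M) ≡ q ℕ.* (18 ℕ.* M)
      linearX = solve-∀ℕ
      quadratic : ∀ q M → 3 ℕ.* (3 ℕ.* M ℕ.* (M ℕ.* q)) ℕ.+ 9 ℕ.* (q ℕ.* (M ℕ.* M)) ≡ q ℕ.* (18 ℕ.* (M ℕ.* M))
      quadratic = solve-∀ℕ

    momentY-balanced : Balanced 18 (q ℕ.* q) momentY
    momentY-balanced = record
      { homogeneous = combination-homogeneous (+ 6 * (+ q * + q)) (- c) (leftY e) leftY-homogeneous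
      ; linear = λ M x y p r → ℕₚ.≤-trans
          (abs-+-≤ (+ 6 * (+ q * + q) * leftY e (x , y)) (- c * upperY (x , y))
            (abs-*-≤ (+ 6 * (+ q * + q)) (leftY e (x , y)) (abs-*-≤ (+ 6) (+ q * + q) ℕₚ.≤-refl qq)
              (ℕₚ.≤-trans (∣⟦b⟧*i∣≤∣i∣ (pos? (cross e (x , y))) y) r))
            (abs-*-≤ (- c) (upperY (x , y)) (abs-neg-≤ c (abs-+-≤ (+ 3 * (+ q * + q)) (- (a * a))
              (abs-*-≤ (+ 3) (+ q * + q) ℕₚ.≤-refl qq) (abs-neg-≤ (a * a) (abs-*-≤ a a ∣a∣≤q ∣a∣≤q)))) (upperY-bound x y r)))
          (ℕₚ.≤-trans (ℕₚ.m≤m+n _ (4 ℕ.* (q ℕ.* q ℕ.* M))) (ℕₚ.≤-reflexive (linearY (q ℕ.* q) M)))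
      ; balanced = λ M → let open ℕₚ.≤-Reasoning in begin
          ∣ sumBox (suc M) momentY ∣
            ≡⟨ cong ∣_∣ (sumBox-momentY (suc M)) ⟩
          ∣ + 3 * sumSym (suc M) errorY ∣
            ≤⟨ abs-*-≤ (+ 3) (sumSym (suc M) errorY) ℕₚ.≤-refl (sumSym-bound (suc M) _ (errorY-bound (suc M))) ⟩
          3 ℕ.* ((2 ℕ.* suc M ℕ.+ 1) ℕ.* (q ℕ.* suc M ℕ.* q ℕ.+ q ℕ.* q))
            ≤⟨ ℕₚ.*-monoʳ-≤ 3 (ℕₚ.*-mono-≤ (odd≤3M M) (ℕₚ.+-monoʳ-≤ (q ℕ.* suc M ℕ.* q) (ℕₚ.m≤m*n (q ℕ.* q) (suc M)))) ⟩
          3 ℕ.* (3 ℕ.* suc M ℕ.* (q ℕ.* suc M ℕ.* q ℕ.+ q ℕ.* q ℕ.* suc M))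
            ≡⟨ quadratic q (suc M) ⟩
          q ℕ.* q ℕ.* (18 ℕ.* (suc M ℕ.* suc M)) ∎
      }
      where
      c = + 3 * (+ q * + q) - a * a
      qq : ∣ + q * + q ∣ ℕ.≤ q ℕ.* q
      qq = abs-*-≤ (+ q) (+ q) ℕₚ.≤-refl ℕₚ.≤-refl
      linearY : ∀ s M → (6 ℕ.* s ℕ.* M ℕ.+ (3 ℕ.* s ℕ.+ s) ℕ.* (2 ℕ.* M)) ℕ.+ 4 ℕ.* (s ℕ.* M) ≡ s ℕ.* (18 ℕ.* M)
      linearY = solve-∀ℕ
      quadratic : ∀ q M → 3 ℕ.* (3 ℕ.* M ℕ.* (q ℕ.* M ℕ.* q ℕ.+ q ℕ.* q ℕ.* M)) ≡ q ℕ.* q ℕ.* (18 ℕ.* (M ℕ.* M))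
      quadratic = solve-∀ℕ

  -- The normalising sum K has order Q³.

  sumBox-dominated : ∀ M {φ ψ : V2 → ℤ} → (∀ x y → ∣ x ∣ ℕ.≤ M → ∣ y ∣ ℕ.≤ M → + ∣ φ (x , y) ∣ ≤ ψ (x , y)) →
    + ∣ sumBox M φ ∣ ≤ sumBox M ψ
  sumBox-dominated M h = sumSym-dominated M (λ x p → sumSym-dominated M (λ y r → h x y p r))

  upperY-abs : ∀ w → + ∣ upperY w ∣ ≡ upperY w
  upperY-abs (x , + zero)  = refl
  upperY-abs (x , + suc y) = refl
  upperY-abs (x , -[1+ y ]) = refl

  primUpperY-abs : ∀ w → + ∣ ⟦ coprimeᵇ w ⟧ * upperY w ∣ ≡ ⟦ coprimeᵇ w ⟧ * upperY w
  primUpperY-abs w with coprimeᵇ w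
  ... | true rewrite ℤₚ.*-identityˡ (upperY w) = upperY-abs w
  ... | false = refl

  sumPrim-upperY-nonneg : ∀ M → + ∣ sumPrim M upperY ∣ ≡ sumPrim M upperY
  sumPrim-upperY-nonneg M = ℤₚ.0≤i⇒+∣i∣≡i (ℤₚ.≤-trans (+≤+ ℕ.z≤n)
    (sumBox-dominated M {λ w → ⟦ coprimeᵇ w ⟧ * upperY w} (λ x y _ _ → ℤₚ.≤-reflexive (primUpperY-abs (x , y)))))

  sumBox-upperY : ∀ M → sumBox M upperY ≡ + ((2 ℕ.* M ℕ.+ 1) ℕ.* (M ℕ.* (M ℕ.+ 1)))
  sumBox-upperY M = trans (sumSym-cong M (λ x _ → sum-upperY M)) (trans (sumSym-const M _)
    (trans (cong (+ (2 ℕ.* M ℕ.+ 1) *_) (sym (ℤₚ.pos-* M (M ℕ.+ 1)))) (sym (ℤₚ.pos-* (2 ℕ.* M ℕ.+ 1) _))))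

  sumPrim-upperY≤ : ∀ M → ∣ sumPrim M upperY ∣ ℕ.≤ (2 ℕ.* M ℕ.+ 1) ℕ.* (M ℕ.* (M ℕ.+ 1))
  sumPrim-upperY≤ M = ℤₚ.drop‿+≤+ (subst (+ ∣ sumPrim M upperY ∣ ≤_) (sumBox-upperY M)
    (sumBox-dominated M (λ x y _ _ → subst (+ ∣ ⟦ coprimeᵇ (x , y) ⟧ * upperY (x , y) ∣ ≤_) (upperY-abs (x , y))
      (+≤+ (∣⟦b⟧*i∣≤∣i∣ (coprimeᵇ (x , y)) (upperY (x , y)))))))

  -- Times 6, the box sum is at least 12 Q³, while the terms d ≥ 2 amount to at most 10 Q³ + 1536 Q²
  -- by the crude bound (5/2) m³ + 256 for each primitive sum. For Q ≥ 1536 the last term is at most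
  -- Q³, which leaves Q³.
  sumPrim-upperY≥ : ∀ Q → 1536 ℕ.≤ Q → cube Q ℕ.≤ 6 ℕ.* ∣ sumPrim Q upperY ∣
  sumPrim-upperY≥ (suc n) big = ℕₚ.+-cancelʳ-≤ (11 ℕ.* cube Q) _ _ (begin
    cube Q ℕ.+ 11 ℕ.* cube Q
      ≤⟨ ℕₚ.m≤m+n _ (18 ℕ.* (Q ℕ.* Q) ℕ.+ 6 ℕ.* Q) ⟩
    cube Q ℕ.+ 11 ℕ.* cube Q ℕ.+ (18 ℕ.* (Q ℕ.* Q) ℕ.+ 6 ℕ.* Q)
      ≡⟨ expand Q ⟩
    6 ℕ.* ((2 ℕ.* Q ℕ.+ 1) ℕ.* (Q ℕ.* (Q ℕ.+ 1)))
      ≡⟨ cong (λ z → 6 ℕ.* ∣ z ∣) (trans (sym (sumBox-upperY Q)) (sumBox-split upperY upperY-homogeneous n)) ⟩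
    6 ℕ.* ∣ sumPrim Q upperY + sumBelow n (λ i → + (2 ℕ.+ i) * sumPrim (Q / (2 ℕ.+ i)) upperY) ∣
      ≤⟨ ℕₚ.*-monoʳ-≤ 6 (abs-+-≤ (sumPrim Q upperY) _ ℕₚ.≤-refl
           (ℕₚ.≤-trans (∣sumBelow∣≤ n _) (sumℕ-mono n (λ i _ → ℕₚ.≤-reflexive (ℤₚ.abs-* (+ (2 ℕ.+ i)) (sumPrim (Q / (2 ℕ.+ i)) upperY)))))) ⟩
    6 ℕ.* (f Q ℕ.+ T)
      ≡⟨ split (f Q) T ⟩
    6 ℕ.* f Q ℕ.+ 3 ℕ.* (2 ℕ.* T)
      ≤⟨ ℕₚ.+-monoʳ-≤ (6 ℕ.* f Q) (sum-divided-bound 2 5 512 f crude n) ⟩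
    6 ℕ.* f Q ℕ.+ (10 ℕ.* cube Q ℕ.+ 1536 ℕ.* (Q ℕ.* Q))
      ≤⟨ ℕₚ.+-monoʳ-≤ (6 ℕ.* f Q) (ℕₚ.+-monoʳ-≤ (10 ℕ.* cube Q) (ℕₚ.*-monoˡ-≤ (Q ℕ.* Q) big)) ⟩
    6 ℕ.* f Q ℕ.+ (10 ℕ.* cube Q ℕ.+ Q ℕ.* (Q ℕ.* Q))
      ≡⟨ cong (6 ℕ.* f Q ℕ.+_) (merge Q) ⟩
    6 ℕ.* f Q ℕ.+ 11 ℕ.* cube Q ∎)
    where
    open ℕₚ.≤-Reasoning
    Q = suc n
    f : ℕ → ℕ
    f m = ∣ sumPrim m upperY ∣
    T = sumℕ n (λ i → (2 ℕ.+ i) ℕ.* f (Q / (2 ℕ.+ i)))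
    expand : ∀ Q → Q ℕ.* Q ℕ.* Q ℕ.+ 11 ℕ.* (Q ℕ.* Q ℕ.* Q) ℕ.+ (18 ℕ.* (Q ℕ.* Q) ℕ.+ 6 ℕ.* Q) ≡ 6 ℕ.* ((2 ℕ.* Q ℕ.+ 1) ℕ.* (Q ℕ.* (Q ℕ.+ 1)))
    expand = solve-∀ℕ
    split : ∀ a b → 6 ℕ.* (a ℕ.+ b) ≡ 6 ℕ.* a ℕ.+ 3 ℕ.* (2 ℕ.* b)
    split = solve-∀ℕ
    merge : ∀ Q → 10 ℕ.* (Q ℕ.* Q ℕ.* Q) ℕ.+ Q ℕ.* (Q ℕ.* Q) ≡ 11 ℕ.* (Q ℕ.* Q ℕ.* Q)
    merge = solve-∀ℕ
    m≤m² : ∀ m → m ℕ.≤ m ℕ.* m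
    m≤m² zero    = ℕ.z≤n
    m≤m² (suc m) = ℕₚ.m≤m*n (suc m) (suc m)
    -- The constant 512 = 8³ arises from absorbing 8 m² into m³; three times it is the threshold
    -- 1536.
    crude : ∀ m → 2 ℕ.* f m ℕ.≤ 5 ℕ.* cube m ℕ.+ 512
    crude m = begin
      2 ℕ.* f m
        ≤⟨ ℕₚ.*-monoʳ-≤ 2 (sumPrim-upperY≤ m) ⟩
      2 ℕ.* ((2 ℕ.* m ℕ.+ 1) ℕ.* (m ℕ.* (m ℕ.+ 1)))
        ≡⟨ expand′ m ⟩
      4 ℕ.* cube m ℕ.+ (6 ℕ.* (m ℕ.* m) ℕ.+ 2 ℕ.* m)
        ≤⟨ ℕₚ.+-monoʳ-≤ (4 ℕ.* cube m) (ℕₚ.+-monoʳ-≤ (6 ℕ.* (m ℕ.* m)) (ℕₚ.*-monoʳ-≤ 2 (m≤m² m))) ⟩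
      4 ℕ.* cube m ℕ.+ (6 ℕ.* (m ℕ.* m) ℕ.+ 2 ℕ.* (m ℕ.* m))
        ≡⟨ cong (4 ℕ.* cube m ℕ.+_) (ℕₚ.*-distribʳ-+ (m ℕ.* m) 6 2) ⟨
      4 ℕ.* cube m ℕ.+ 8 ℕ.* (m ℕ.* m)
        ≤⟨ ℕₚ.+-monoʳ-≤ (4 ℕ.* cube m) (square≤cube 8 m) ⟩
      4 ℕ.* cube m ℕ.+ (cube m ℕ.+ 512)
        ≡⟨ merge′ (cube m) ⟩
      5 ℕ.* cube m ℕ.+ 512 ∎
      where
      expand′ : ∀ m → 2 ℕ.* ((2 ℕ.* m ℕ.+ 1) ℕ.* (m ℕ.* (m ℕ.+ 1))) ≡ 4 ℕ.* (m ℕ.* m ℕ.* m) ℕ.+ (6 ℕ.* (m ℕ.* m) ℕ.+ 2 ℕ.* m)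
      expand′ = solve-∀ℕ
      merge′ : ∀ c → 4 ℕ.* c ℕ.+ (c ℕ.+ 512) ≡ 5 ℕ.* c ℕ.+ 512
      merge′ = solve-∀ℕ

-- Edge sums of the polygon
module _ where
  open import Data.Integer using (_+_; _*_; -_; _-_; _≤_; +≤+; -≤+)

  sumList : {A : Set} → (A → ℤ) → List A → ℤ
  sumList f = foldr (λ x r → f x + r) (+ 0)

  sumList-++ : ∀ {A : Set} (f : A → ℤ) xs ys → sumList f (xs ++ ys) ≡ sumList f xs + sumList f ys
  sumList-++ f []       ys = sym (ℤₚ.+-identityˡ (sumList f ys))
  sumList-++ f (x ∷ xs) ys rewrite sumList-++ f xs ys = sym (ℤₚ.+-assoc (f x) (sumList f xs) (sumList f ys))

  sumList-map : ∀ {A B : Set} (f : B → ℤ) (g : A → B) xs → sumList f (map g xs) ≡ sumList (f ∘ g) xs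
  sumList-map f g []       = refl
  sumList-map f g (x ∷ xs) = cong (λ z → f (g x) + z) (sumList-map f g xs)

  sumList-concatMap : ∀ {A B : Set} (f : B → ℤ) (g : A → List B) xs →
    sumList f (concatMap g xs) ≡ sumList (λ x → sumList f (g x)) xs
  sumList-concatMap f g []       = refl
  sumList-concatMap f g (x ∷ xs) = trans (sumList-++ f (g x) (concatMap g xs))
    (cong (λ z → sumList f (g x) + z) (sumList-concatMap f g xs))

  sumList-cong : ∀ {A : Set} {f g : A → ℤ} → (∀ x → f x ≡ g x) → ∀ xs → sumList f xs ≡ sumList g xs
  sumList-cong h []       = refl
  sumList-cong h (x ∷ xs) = cong₂ _+_ (h x) (sumList-cong h xs)

  sumList-filter : ∀ {A : Set} (f : A → ℤ) (b : A → Bool) xs →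
    sumList f (filter (λ x → b x Boolₚ.≟ true) xs) ≡ sumList (λ x → ⟦ b x ⟧ * f x) xs
  sumList-filter f b []       = refl
  sumList-filter f b (x ∷ xs) with b x
  ... | true  = cong₂ _+_ (sym (ℤₚ.*-identityˡ (f x))) (sumList-filter f b xs)
  ... | false = trans (sumList-filter f b xs) (sym (ℤₚ.+-identityˡ (sumList (λ x → ⟦ b x ⟧ * f x) xs)))

  sumList-length : ∀ {A : Set} (xs : List A) → + length xs ≡ sumList (λ _ → + 1) xs
  sumList-length []       = refl
  sumList-length (x ∷ xs) = cong (λ z → + 1 + z) (sumList-length xs)

  sumList-upTo : ∀ (f : ℕ → ℤ) (g : ℕ → ℕ) n → sumList f (applyUpTo g n) ≡ sumBelow n (f ∘ g)
  sumList-upTo f g zero    = refl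
  sumList-upTo f g (suc n) = trans (cong (λ z → f (g 0) + z) (sumList-upTo f (g ∘ suc) n)) (sym (sumBelow-front n (f ∘ g)))

  -- Peeling one term off each end of the range matches the recursion of `sumSym`.
  sumSym-shift : ∀ Q (f : ℤ → ℤ) → sumBelow (2 ℕ.* Q ℕ.+ 1) (λ k → f (+ k - + Q)) ≡ sumSym Q f
  sumSym-shift zero f = ℤₚ.+-identityˡ (f (+ 0))
  sumSym-shift (suc Q) f = begin
    sumBelow (2 ℕ.* suc Q ℕ.+ 1) h
      ≡⟨ cong (λ n → sumBelow (n ℕ.+ 1) h) (ℕₚ.*-suc 2 Q) ⟩
    sumBelow (suc n) h + h (suc n)
      ≡⟨ cong (_+ h (suc n)) (sumBelow-front n h) ⟩
    h 0 + sumBelow n (h ∘ suc) + h (suc n)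
      ≡⟨ cong₂ (λ u v → h 0 + u + v) (trans (sumBelow-cong n (λ k → cong f (shift k))) (sumSym-shift Q f)) (cong f last) ⟩
    f -[1+ Q ] + sumSym Q f + f (+ suc Q)
      ≡⟨ rearrange (f -[1+ Q ]) (sumSym Q f) (f (+ suc Q)) ⟩
    sumSym Q f + (f (+ suc Q) + f -[1+ Q ]) ∎
    where
    open ≡-Reasoning
    n = 2 ℕ.* Q ℕ.+ 1
    h : ℕ → ℤ
    h k = f (+ k - + suc Q)
    cancel : ∀ k q → + 1 + k - (+ 1 + q) ≡ k - q
    cancel = solve-∀
    shift : ∀ k → + suc k - + suc Q ≡ + k - + Q
    shift k = cancel (+ k) (+ Q)
    halve : ∀ q → + 1 + (+ 2 * q + + 1) - (+ 1 + q) ≡ + 1 + q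
    halve = solve-∀
    last : + suc n - + suc Q ≡ + suc Q
    last = trans (cong (λ z → + 1 + z - + suc Q) (+odd Q)) (halve (+ Q))
    rearrange : ∀ a b c → a + b + c ≡ b + (c + a)
    rearrange = solve-∀

  sumList-intRange : ∀ Q (f : ℤ → ℤ) → sumList f (intRange Q) ≡ sumSym Q f
  sumList-intRange Q f = trans (sumList-map f (λ k → + k - + Q) (upTo (2 ℕ.* Q ℕ.+ 1)))
    (trans (sumList-upTo (λ k → f (+ k - + Q)) (λ k → k) (2 ℕ.* Q ℕ.+ 1)) (sumSym-shift Q f))

  -- Bridge from the list that defines the polygon to weighted box sums, where symmetries become
  -- changes of variable.
  sumList-VQ : ∀ Q (f : V2 → ℤ) → sumList f (VQ Q) ≡ sumPrim Q f
  sumList-VQ Q f = begin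
    sumList f (VQ Q)
      ≡⟨ sumList-filter f coprimeᵇ (concatMap (λ q → map (λ a → (q , a)) (intRange Q)) (intRange Q)) ⟩
    sumList g (concatMap (λ q → map (λ a → (q , a)) (intRange Q)) (intRange Q))
      ≡⟨ sumList-concatMap g (λ q → map (λ a → (q , a)) (intRange Q)) (intRange Q) ⟩
    sumList (λ q → sumList g (map (λ a → (q , a)) (intRange Q))) (intRange Q)
      ≡⟨ sumList-cong (λ q → trans (sumList-map g (λ a → (q , a)) (intRange Q)) (sumList-intRange Q (λ a → g (q , a)))) (intRange Q) ⟩
    sumList (λ q → sumSym Q (λ a → g (q , a))) (intRange Q)
      ≡⟨ sumList-intRange Q (λ q → sumSym Q (λ a → g (q , a))) ⟩
    sumPrim Q f ∎
    where
    open ≡-Reasoning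
    g : V2 → ℤ
    g w = ⟦ coprimeᵇ w ⟧ * f w

  sumV-proj₁ : ∀ xs → proj₁ (sumV xs) ≡ sumList proj₁ xs
  sumV-proj₁ []       = refl
  sumV-proj₁ (x ∷ xs) = cong (λ z → proj₁ x + z) (sumV-proj₁ xs)

  sumV-proj₂ : ∀ xs → proj₂ (sumV xs) ≡ sumList proj₂ xs
  sumV-proj₂ []       = refl
  sumV-proj₂ (x ∷ xs) = cong (λ z → proj₂ x + z) (sumV-proj₂ xs)

  -- Symmetries of primitive sums.

  negV rotV : V2 → V2
  negV (x , y) = (- x , - y)
  rotV (x , y) = (- y , x)

  sumPrim-cong : ∀ M {f g : V2 → ℤ} → (∀ w → coprimeᵇ w ≡ true → f w ≡ g w) → sumPrim M f ≡ sumPrim M g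
  sumPrim-cong M {f} {g} h = sumBox-cong M (λ x y _ _ → weighted (x , y))
    where
    weighted : ∀ w → ⟦ coprimeᵇ w ⟧ * f w ≡ ⟦ coprimeᵇ w ⟧ * g w
    weighted w with coprimeᵇ w in eq
    ... | true  = cong (+ 1 *_) (h w eq)
    ... | false = refl

  sumPrim-+ : ∀ M (f g : V2 → ℤ) → sumPrim M (λ w → f w + g w) ≡ sumPrim M f + sumPrim M g
  sumPrim-+ M f g = trans (sumBox-cong M (λ x y _ _ → ℤₚ.*-distribˡ-+ ⟦ coprimeᵇ (x , y) ⟧ (f (x , y)) (g (x , y))))
    (sumBox-+ M (λ w → ⟦ coprimeᵇ w ⟧ * f w) (λ w → ⟦ coprimeᵇ w ⟧ * g w))

  sumPrim-*ˡ : ∀ M c (f : V2 → ℤ) → sumPrim M (λ w → c * f w) ≡ c * sumPrim M f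
  sumPrim-*ˡ M c f = trans (sumBox-cong M (λ x y _ _ → exchange ⟦ coprimeᵇ (x , y) ⟧ c (f (x , y))))
    (sumBox-*ˡ M c (λ w → ⟦ coprimeᵇ w ⟧ * f w))
    where
    exchange : ∀ b c f → b * (c * f) ≡ c * (b * f)
    exchange = solve-∀

  coprimeᵇ-neg : ∀ w → coprimeᵇ (negV w) ≡ coprimeᵇ w
  coprimeᵇ-neg (x , y) rewrite ℤₚ.∣-i∣≡∣i∣ x | ℤₚ.∣-i∣≡∣i∣ y = refl

  coprimeᵇ-rot : ∀ w → coprimeᵇ (rotV w) ≡ coprimeᵇ w
  coprimeᵇ-rot (x , y) rewrite ℤₚ.∣-i∣≡∣i∣ y = cong (λ g → does (g ℕ.≟ 1)) (gcd-comm ∣ y ∣ ∣ x ∣)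

  sumPrim-neg : ∀ M (f : V2 → ℤ) → sumPrim M (f ∘ negV) ≡ sumPrim M f
  sumPrim-neg M f = trans (sumBox-cong M (λ x y _ _ → cong (λ b → ⟦ b ⟧ * f (- x , - y)) (sym (coprimeᵇ-neg (x , y)))))
    (sumBox-neg M (λ w → ⟦ coprimeᵇ w ⟧ * f w))

  sumPrim-rot : ∀ M (f : V2 → ℤ) → sumPrim M (f ∘ rotV) ≡ sumPrim M f
  sumPrim-rot M f = trans (sumBox-cong M (λ x y _ _ → cong (λ b → ⟦ b ⟧ * f (- y , x)) (sym (coprimeᵇ-rot (x , y)))))
    (sumBox-rot M (λ w → ⟦ coprimeᵇ w ⟧ * f w))

  sumPrim-symmetrise : ∀ M (f : V2 → ℤ) → + 2 * sumPrim M f ≡ sumPrim M (λ w → f w + f (negV w))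
  sumPrim-symmetrise M f = trans (double (sumPrim M f))
    (trans (cong (λ z → sumPrim M f + z) (sym (sumPrim-neg M f))) (sym (sumPrim-+ M f (f ∘ negV))))
    where
    double : ∀ a → + 2 * a ≡ a + a
    double = solve-∀

  -- The origin is the only point where this fails, and primitivity excludes it.
  upper-neg : ∀ w → coprimeᵇ w ≡ true → upper (negV w) ≡ not (upper w)
  upper-neg (+ zero , + zero) ()
  upper-neg (+ suc x , + zero) _ = refl
  upper-neg (-[1+ x ] , + zero) _ = refl
  upper-neg (x , + suc y) _ = refl
  upper-neg (x , -[1+ y ]) _ = refl

  -- `before` as a function of three bits: the two half-planes and the sign of the cross product.
  -- The symmetry identities below thereby become truth tables.
  beforeᵇ : Bool → Bool → Bool → Bool
  beforeᵇ u v c = (u ∧ not v) ∨ (sameᵇ u v ∧ c)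

  cross-negˡ : ∀ v w → cross (negV v) w ≡ cross v (negV w)
  cross-negˡ (a , b) (c , d) = lemma a b c d
    where
    lemma : ∀ a b c d → - a * d - - b * c ≡ a * - d - b * - c
    lemma = solve-∀

  cross-neg : ∀ v w → cross (negV v) (negV w) ≡ cross v w
  cross-neg (a , b) (c , d) = lemma a b c d
    where
    lemma : ∀ a b c d → - a * - d - - b * - c ≡ a * d - b * c
    lemma = solve-∀

  cross-swap : ∀ v w → cross (negV v) w ≡ cross w v
  cross-swap (a , b) (c , d) = lemma a b c d
    where
    lemma : ∀ a b c d → - a * d - - b * c ≡ c * b - d * a
    lemma = solve-∀

  cross-rot : ∀ v w → cross (rotV v) (rotV w) ≡ cross v w
  cross-rot (a , b) (c , d) = lemma a b c d
    where
    lemma : ∀ a b c d → - b * c - a * - d ≡ a * d - b * c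
    lemma = solve-∀

  -- Edge starts relative to the centre, by antisymmetry.

  module Edges (Q : ℕ) (π : V2 → ℤ) (π-odd : ∀ w → π (negV w) ≡ - π w) where

    startSum : V2 → ℤ
    startSum e = sumPrim Q (λ w → ⟦ before w e ⟧ * π w)

    upperSum : ℤ
    upperSum = sumPrim Q (λ w → ⟦ upper w ⟧ * π w)

    leftSum : V2 → ℤ
    leftSum e = sumPrim Q (λ w → ⟦ pos? (cross e w) ⟧ * π w)

    -- The right side holds the bits of -w: its half-plane is flipped, and the cross products with e
    -- and -e have changed places.
    evenᵇ : ∀ u v c d → ⟦ beforeᵇ u v c ⟧ + ⟦ beforeᵇ u (not v) d ⟧ - ⟦ u ⟧
      ≡ ⟦ beforeᵇ (not u) v d ⟧ + ⟦ beforeᵇ (not u) (not v) c ⟧ - ⟦ not u ⟧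
    evenᵇ true  true  true  d = refl
    evenᵇ true  true  false d = refl
    evenᵇ true  false c true  = refl
    evenᵇ true  false c false = refl
    evenᵇ false true  c true  = refl
    evenᵇ false true  c false = refl
    evenᵇ false false true  d = refl
    evenᵇ false false false d = refl

    -- Central symmetry of the polygon: the starts of e and -e are opposite vertices. The
    -- combination of indicators is even in w while `π` is odd, so the terms at w and -w cancel.
    start-opposite : ∀ e → coprimeᵇ e ≡ true → startSum e + startSum (negV e) ≡ upperSum
    start-opposite e e-prim = ℤₚ.i-j≡0⇒i≡j _ _ (ℤₚ.*-cancelˡ-≡ (+ 2) _ (+ 0) (begin
      + 2 * (startSum e + startSum (negV e) - upperSum)
        ≡⟨ cong (+ 2 *_) collect ⟩
      + 2 * sumPrim Q (λ w → G w * π w)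
        ≡⟨ sumPrim-symmetrise Q (λ w → G w * π w) ⟩
      sumPrim Q (λ w → G w * π w + G (negV w) * π (negV w))
        ≡⟨ sumPrim-cong Q (λ w w-prim → trans (cong₂ (λ g p → G w * π w + g * p) (sym (G-even w w-prim)) (π-odd w)) (vanish (G w) (π w))) ⟩
      sumPrim Q (λ _ → + 0 * + 0)
        ≡⟨ sumPrim-*ˡ Q (+ 0) (λ _ → + 0) ⟩
      + 0 ∎))
      where
      open ≡-Reasoning
      G : V2 → ℤ
      G w = ⟦ before w e ⟧ + ⟦ before w (negV e) ⟧ - ⟦ upper w ⟧
      vanish : ∀ g p → g * p + g * - p ≡ + 0
      vanish = solve-∀
      distribute : ∀ a b c p → (a + b - c) * p ≡ (a * p + b * p) + - + 1 * (c * p)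
      distribute = solve-∀
      minus : ∀ a b → a - b ≡ a + - + 1 * b
      minus = solve-∀
      collect : startSum e + startSum (negV e) - upperSum ≡ sumPrim Q (λ w → G w * π w)
      collect = begin
        startSum e + startSum (negV e) - upperSum
          ≡⟨ minus (startSum e + startSum (negV e)) upperSum ⟩
        startSum e + startSum (negV e) + - + 1 * upperSum
          ≡⟨ cong₂ _+_ (sumPrim-+ Q _ _) (sumPrim-*ˡ Q (- + 1) _) ⟨
        sumPrim Q (λ w → ⟦ before w e ⟧ * π w + ⟦ before w (negV e) ⟧ * π w) + sumPrim Q (λ w → - + 1 * (⟦ upper w ⟧ * π w))
          ≡⟨ sumPrim-+ Q _ _ ⟨
        sumPrim Q (λ w → (⟦ before w e ⟧ * π w + ⟦ before w (negV e) ⟧ * π w) + - + 1 * (⟦ upper w ⟧ * π w))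
          ≡⟨ sumPrim-cong Q (λ w _ → distribute ⟦ before w e ⟧ ⟦ before w (negV e) ⟧ ⟦ upper w ⟧ (π w)) ⟨
        sumPrim Q (λ w → G w * π w) ∎
      G-even : ∀ w → coprimeᵇ w ≡ true → G w ≡ G (negV w)
      G-even w w-prim rewrite upper-neg w w-prim | upper-neg e e-prim | cross-neg w e | cross-negˡ w e =
        evenᵇ (upper w) (upper e) (pos? (cross w e)) (pos? (cross w (negV e)))

    sum-starts : + 2 * sumPrim Q startSum ≡ + length (VQ Q) * upperSum
    sum-starts = begin
      + 2 * sumPrim Q startSum
        ≡⟨ sumPrim-symmetrise Q startSum ⟩
      sumPrim Q (λ e → startSum e + startSum (negV e))
        ≡⟨ sumPrim-cong Q (λ e e-prim → trans (start-opposite e e-prim) (sym (ℤₚ.*-identityʳ upperSum))) ⟩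
      sumPrim Q (λ e → upperSum * + 1)
        ≡⟨ sumPrim-*ˡ Q upperSum (λ _ → + 1) ⟩
      upperSum * sumPrim Q (λ _ → + 1)
        ≡⟨ cong (upperSum *_) (trans (sumList-length (VQ Q)) (sumList-VQ Q (λ _ → + 1))) ⟨
      upperSum * + length (VQ Q)
        ≡⟨ ℤₚ.*-comm upperSum (+ length (VQ Q)) ⟩
      + length (VQ Q) * upperSum ∎
      where open ≡-Reasoning

    -- The coefficient of `π w` once w is paired with -w in 2 [before w e] - [upper w] +
    -- [cross e w > 0]; `c` and `d` are the signs of cross w e and cross e w. Off the line of e
    -- exactly one of them is positive and the coefficient is 0.
    tieᵇ : Bool → Bool → Bool → Bool → ℤ
    tieᵇ u v c d = ((+ 2 * ⟦ beforeᵇ u v c ⟧ - ⟦ u ⟧) - (+ 2 * ⟦ beforeᵇ (not u) v d ⟧ - ⟦ not u ⟧)) + (⟦ d ⟧ - ⟦ c ⟧)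

    tieᵇ-strict : ∀ u v c → tieᵇ u v c (not c) ≡ + 0
    tieᵇ-strict true  true  true  = refl
    tieᵇ-strict true  true  false = refl
    tieᵇ-strict true  false true  = refl
    tieᵇ-strict true  false false = refl
    tieᵇ-strict false true  true  = refl
    tieᵇ-strict false true  false = refl
    tieᵇ-strict false false true  = refl
    tieᵇ-strict false false false = refl

    tieᵇ-bound : ∀ u v → ∣ tieᵇ u v false false ∣ ≡ 1
    tieᵇ-bound true  true  = refl
    tieᵇ-bound true  false = refl
    tieᵇ-bound false true  = refl
    tieᵇ-bound false false = refl

    -- Zero unless w is parallel to e.
    tie : V2 → V2 → ℤ
    tie e w = tieᵇ (upper w) (upper e) (pos? (cross w e)) (pos? (cross e w))

    -- Pairing w with -w trades the angular order, which depends on where arguments start, for the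
    -- half-plane to the left of e. Since `upperSum` is twice the centre, the left side is four
    -- times the start relative to the centre.
    twice-start : ∀ e → + 2 * (+ 2 * startSum e - upperSum) ≡ - (+ 2 * leftSum e) + sumPrim Q (λ w → tie e w * π w)
    twice-start e = begin
      + 2 * (+ 2 * startSum e - upperSum)
        ≡⟨ split (startSum e) upperSum (leftSum e) ⟩
      - (+ 2 * leftSum e) + + 2 * ((+ 2 * startSum e + - + 1 * upperSum) + leftSum e)
        ≡⟨ cong (λ z → - (+ 2 * leftSum e) + + 2 * z) collect ⟩
      - (+ 2 * leftSum e) + + 2 * sumPrim Q (λ w → g w * π w)
        ≡⟨ cong (λ z → - (+ 2 * leftSum e) + z) (trans (sumPrim-symmetrise Q (λ w → g w * π w)) (sumPrim-cong Q pointwise)) ⟩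
      - (+ 2 * leftSum e) + sumPrim Q (λ w → tie e w * π w) ∎
      where
      open ≡-Reasoning
      g : V2 → ℤ
      g w = (+ 2 * ⟦ before w e ⟧ + - + 1 * ⟦ upper w ⟧) + ⟦ pos? (cross e w) ⟧
      split : ∀ s u l → + 2 * (+ 2 * s - u) ≡ - (+ 2 * l) + + 2 * ((+ 2 * s + - + 1 * u) + l)
      split = solve-∀
      distribute : ∀ a b c p → (+ 2 * (a * p) + - + 1 * (b * p)) + c * p ≡ ((+ 2 * a + - + 1 * b) + c) * p
      distribute = solve-∀
      collect : (+ 2 * startSum e + - + 1 * upperSum) + leftSum e ≡ sumPrim Q (λ w → g w * π w)
      collect = begin
        (+ 2 * startSum e + - + 1 * upperSum) + leftSum e
          ≡⟨ cong (_+ leftSum e) (cong₂ _+_ (sumPrim-*ˡ Q (+ 2) _) (sumPrim-*ˡ Q (- + 1) _)) ⟨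
        (sumPrim Q (λ w → + 2 * (⟦ before w e ⟧ * π w)) + sumPrim Q (λ w → - + 1 * (⟦ upper w ⟧ * π w))) + leftSum e
          ≡⟨ cong (_+ leftSum e) (sumPrim-+ Q _ _) ⟨
        sumPrim Q (λ w → + 2 * (⟦ before w e ⟧ * π w) + - + 1 * (⟦ upper w ⟧ * π w)) + leftSum e
          ≡⟨ sumPrim-+ Q _ _ ⟨
        sumPrim Q (λ w → (+ 2 * (⟦ before w e ⟧ * π w) + - + 1 * (⟦ upper w ⟧ * π w)) + ⟦ pos? (cross e w) ⟧ * π w)
          ≡⟨ sumPrim-cong Q (λ w _ → distribute ⟦ before w e ⟧ ⟦ upper w ⟧ ⟦ pos? (cross e w) ⟧ (π w)) ⟩
        sumPrim Q (λ w → g w * π w) ∎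
      combine : ∀ a b c a′ b′ c′ p → ((+ 2 * a + - + 1 * b) + c) * p + ((+ 2 * a′ + - + 1 * b′) + c′) * - p
        ≡ (((+ 2 * a - b) - (+ 2 * a′ - b′)) + (c - c′)) * p
      combine = solve-∀
      pointwise : ∀ w → coprimeᵇ w ≡ true → g w * π w + g (negV w) * π (negV w) ≡ tie e w * π w
      pointwise w w-prim rewrite π-odd w | upper-neg w w-prim
        | sym (cross-negˡ e w) | cross-swap e w | cross-swap w e =
        combine ⟦ before w e ⟧ ⟦ upper w ⟧ ⟦ pos? (cross e w) ⟧ ⟦ beforeᵇ (not (upper w)) (upper e) (pos? (cross e w)) ⟧
          ⟦ not (upper w) ⟧ ⟦ pos? (cross w e) ⟧ (π w)

  -- Vectors parallel to an edge.

  zero? : ℤ → Bool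
  zero? z = does (z ℤ.≟ + 0)

  -- All lattice points on the line are counted, primitive or not: an upper bound suffices, and the
  -- full box can be treated column by column.
  ties : ℕ → V2 → ℤ
  ties Q e = sumBox Q (λ w → ⟦ zero? (cross e w) ⟧)

  0≤⟦_⟧ : ∀ b → + 0 ≤ ⟦ b ⟧
  0≤⟦ true ⟧  = +≤+ ℕ.z≤n
  0≤⟦ false ⟧ = +≤+ ℕ.z≤n

  ⟦_⟧≤1 : ∀ b → ⟦ b ⟧ ≤ + 1
  ⟦ true ⟧≤1  = +≤+ (ℕ.s≤s ℕ.z≤n)
  ⟦ false ⟧≤1 = +≤+ ℕ.z≤n

  -- The indicator of q y = c is at most the jump of [q y ≥ c] from y - 1 to y, and the jumps
  -- telescope to at most 1.
  row-ties : ∀ M q′ c → + ∣ sumSym M (λ y → ⟦ zero? (+ suc q′ * y - c) ⟧) ∣ ≤ + 1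
  row-ties M q′ c = begin
    + ∣ sumSym M (λ y → ⟦ zero? (+ suc q′ * y - c) ⟧) ∣  ≤⟨ sumSym-dominated M (λ y _ → step y) ⟩
    sumSym M (λ y → G y - G (y - + 1))                    ≡⟨ sumSym-telescope M G ⟩
    G (+ M) - G -[1+ M ]                                  ≤⟨ ℤₚ.+-mono-≤ ⟦ nonneg? (+ M) ⟧≤1 (ℤₚ.neg-mono-≤ 0≤⟦ nonneg? -[1+ M ] ⟧) ⟩
    + 1                                                   ∎
    where
    open ℤₚ.≤-Reasoning
    q = suc q′
    nonneg? : ℤ → Bool
    nonneg? y = does (+ 0 ℤ.≤? (+ q * y - c))
    G : ℤ → ℤ
    G y = ⟦ nonneg? y ⟧
    previous : ∀ q y c → q * (y - + 1) - c ≡ (q * y - c) - q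
    previous = solve-∀
    step : ∀ y → + ∣ ⟦ zero? (+ q * y - c) ⟧ ∣ ≤ G y - G (y - + 1)
    step y rewrite previous (+ q) y c = cases (+ q * y - c)
      where
      cases : ∀ z → + ∣ ⟦ zero? z ⟧ ∣ ≤ ⟦ does (+ 0 ℤ.≤? z) ⟧ - ⟦ does (+ 0 ℤ.≤? (z - + q)) ⟧
      cases (+ zero)  = ℤₚ.≤-refl
      cases (+ suc n) = ℤₚ.i≤j⇒0≤j-i ⟦ does (+ 0 ℤ.≤? (+ suc n - + q)) ⟧≤1
      cases -[1+ n ]  = ℤₚ.≤-refl

  ties-right : ∀ Q q′ a → ties Q (+ suc q′ , a) ≤ + (2 ℕ.* Q ℕ.+ 1)
  ties-right Q q′ a = begin
    ties Q (+ suc q′ , a)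
      ≤⟨ i≤+∣i∣ (ties Q (+ suc q′ , a)) ⟩
    + ∣ ties Q (+ suc q′ , a) ∣
      ≤⟨ sumSym-dominated Q (λ x _ → row-ties Q q′ (a * x)) ⟩
    sumSym Q (λ _ → + 1)
      ≡⟨ trans (sumSym-const Q (+ 1)) (ℤₚ.*-identityʳ _) ⟩
    + (2 ℕ.* Q ℕ.+ 1) ∎
    where
    open ℤₚ.≤-Reasoning
    i≤+∣i∣ : ∀ i → i ≤ + ∣ i ∣
    i≤+∣i∣ (+ n)    = ℤₚ.≤-refl
    i≤+∣i∣ -[1+ n ] = -≤+

  ties-rot : ∀ Q e → ties Q (rotV e) ≡ ties Q e
  ties-rot Q e = trans (sym (sumBox-rot Q (λ w → ⟦ zero? (cross (rotV e) w) ⟧)))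
    (sumBox-cong Q (λ x y _ _ → cong (λ z → ⟦ zero? z ⟧) (cross-rot e (x , y))))

  pos?-neg : ∀ z → z ≢ + 0 → pos? z ≡ not (pos? (- z))
  pos?-neg (+ zero)  z≢0 = contradiction refl z≢0
  pos?-neg (+ suc n) _   = refl
  pos?-neg -[1+ n ]  _   = refl

  cross-anti : ∀ v w → cross v w ≡ - cross w v
  cross-anti (a , b) (c , d) = lemma a b c d
    where
    lemma : ∀ a b c d → a * d - b * c ≡ - (c * b - d * a)
    lemma = solve-∀

  module TieBound (Q : ℕ) (π : V2 → ℤ) (π-odd : ∀ w → π (negV w) ≡ - π w)
    (π-bound : ∀ x y → ∣ x ∣ ℕ.≤ Q → ∣ y ∣ ℕ.≤ Q → ∣ π (x , y) ∣ ℕ.≤ Q) where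

    open Edges Q π π-odd

    tie-bound : ∀ e w → + ∣ tie e w ∣ ≤ ⟦ zero? (cross e w) ⟧
    tie-bound e w with cross e w ℤ.≟ + 0
    ... | yes eq rewrite cross-anti w e | eq = ℤₚ.≤-reflexive (cong +_ (tieᵇ-bound (upper w) (upper e)))
    ... | no neq rewrite pos?-neg (cross e w) neq | sym (cross-anti w e) =
      ℤₚ.≤-reflexive (cong (λ z → + ∣ z ∣) (tieᵇ-strict (upper w) (upper e) (pos? (cross w e))))

    tieSum-bound : ∀ e → + ∣ sumPrim Q (λ w → tie e w * π w) ∣ ≤ + Q * ties Q e
    tieSum-bound e = subst (+ ∣ sumPrim Q (λ w → tie e w * π w) ∣ ≤_) (sumBox-*ˡ Q (+ Q) _)
      (sumBox-dominated Q {λ w → ⟦ coprimeᵇ w ⟧ * (tie e w * π w)} (λ x y p r → pointwise (x , y) (π-bound x y p r)))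
      where
      open ℤₚ.≤-Reasoning
      pointwise : ∀ w → ∣ π w ∣ ℕ.≤ Q → + ∣ ⟦ coprimeᵇ w ⟧ * (tie e w * π w) ∣ ≤ + Q * ⟦ zero? (cross e w) ⟧
      pointwise w p = begin
        + ∣ ⟦ coprimeᵇ w ⟧ * (tie e w * π w) ∣   ≤⟨ +≤+ (∣⟦b⟧*i∣≤∣i∣ (coprimeᵇ w) (tie e w * π w)) ⟩
        + ∣ tie e w * π w ∣                      ≤⟨ +≤+ (abs-*-≤ (tie e w) (π w) ℕₚ.≤-refl p) ⟩
        + (∣ tie e w ∣ ℕ.* Q)                    ≡⟨ cong +_ (ℕₚ.*-comm ∣ tie e w ∣ Q) ⟩
        + (Q ℕ.* ∣ tie e w ∣)                    ≡⟨ ℤₚ.pos-* Q ∣ tie e w ∣ ⟩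
        + Q * + ∣ tie e w ∣                      ≤⟨ ℤₚ.*-monoˡ-≤-nonNeg (+ Q) (tie-bound e w) ⟩
        + Q * ⟦ zero? (cross e w) ⟧              ∎

    twice-start-bound : ∀ e → ties Q e ≤ + (2 ℕ.* Q ℕ.+ 1) →
      ∣ + 2 * (+ 2 * startSum e - upperSum) + + 2 * leftSum e ∣ ℕ.≤ Q ℕ.* (2 ℕ.* Q ℕ.+ 1)
    twice-start-bound e few = ℤₚ.drop‿+≤+ (begin
      + ∣ + 2 * (+ 2 * startSum e - upperSum) + + 2 * leftSum e ∣
        ≡⟨ cong (λ z → + ∣ z + + 2 * leftSum e ∣) (twice-start e) ⟩
      + ∣ - (+ 2 * leftSum e) + sumPrim Q (λ w → tie e w * π w) + + 2 * leftSum e ∣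
        ≡⟨ cong (λ z → + ∣ z ∣) (cancel (+ 2 * leftSum e) _) ⟩
      + ∣ sumPrim Q (λ w → tie e w * π w) ∣
        ≤⟨ tieSum-bound e ⟩
      + Q * ties Q e
        ≤⟨ ℤₚ.*-monoˡ-≤-nonNeg (+ Q) few ⟩
      + Q * + (2 ℕ.* Q ℕ.+ 1)
        ≡⟨ ℤₚ.pos-* Q _ ⟨
      + (Q ℕ.* (2 ℕ.* Q ℕ.+ 1)) ∎)
      where
      open ℤₚ.≤-Reasoning
      cancel : ∀ a b → - a + b + a ≡ b
      cancel = solve-∀

  module X (Q : ℕ) where
    open Edges Q proj₁ (λ _ → refl) public
    open TieBound Q proj₁ (λ _ → refl) (λ x y p r → p) public

  module Y (Q : ℕ) where
    open Edges Q proj₂ (λ _ → refl) public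
    open TieBound Q proj₂ (λ _ → refl) (λ x y p r → r) public

  edgeStart-x : ∀ Q e → proj₁ (edgeStart Q e) ≡ X.startSum Q e
  edgeStart-x Q e = trans (sumV-proj₁ (filter (λ w → before w e Boolₚ.≟ true) (VQ Q)))
    (trans (sumList-filter proj₁ (λ w → before w e) (VQ Q)) (sumList-VQ Q (λ w → ⟦ before w e ⟧ * proj₁ w)))

  edgeStart-y : ∀ Q e → proj₂ (edgeStart Q e) ≡ Y.startSum Q e
  edgeStart-y Q e = trans (sumV-proj₂ (filter (λ w → before w e Boolₚ.≟ true) (VQ Q)))
    (trans (sumList-filter proj₂ (λ w → before w e) (VQ Q)) (sumList-VQ Q (λ w → ⟦ before w e ⟧ * proj₂ w)))

  -- The two half-planes differ only on the axis y = 0, which contributes nothing. Thus K is four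
  -- times the height of the centre.
  upperSum-Y : ∀ Q → + 2 * Y.upperSum Q ≡ sumPrim Q upperY
  upperSum-Y Q = trans (sym (sumPrim-*ˡ Q (+ 2) (λ w → ⟦ upper w ⟧ * proj₂ w))) (sumPrim-cong Q (λ w _ → pointwise w))
    where
    exchange : ∀ b y → + 2 * (b * y) ≡ b * (+ 2 * y)
    exchange = solve-∀
    upper-pos : ∀ x y → ⟦ upper (x , y) ⟧ * (+ 2 * y) ≡ ⟦ pos? y ⟧ * (+ 2 * y)
    upper-pos x (+ zero)  = ℤₚ.*-zeroʳ ⟦ upper (x , + 0) ⟧
    upper-pos x (+ suc y) = refl
    upper-pos x -[1+ y ]  = refl
    pointwise : ∀ w → + 2 * (⟦ upper w ⟧ * proj₂ w) ≡ upperY w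
    pointwise (x , y) = trans (exchange ⟦ upper (x , y) ⟧ y) (upper-pos x y)

  -- Reduction to |a| ≤ q by quarter turns.

  left-rot-x : ∀ Q e → X.leftSum Q (rotV e) ≡ - Y.leftSum Q e
  left-rot-x Q e = trans (sym (sumPrim-rot Q (λ w → ⟦ pos? (cross (rotV e) w) ⟧ * proj₁ w)))
    (trans (sumPrim-cong Q (λ w _ → trans (cong (λ z → ⟦ pos? z ⟧ * - proj₂ w) (cross-rot e w)) (flip ⟦ pos? (cross e w) ⟧ (proj₂ w))))
      (trans (sumPrim-*ˡ Q (- + 1) (λ w → ⟦ pos? (cross e w) ⟧ * proj₂ w)) (ℤₚ.-1*i≡-i _)))
    where
    flip : ∀ b y → b * - y ≡ - + 1 * (b * y)
    flip = solve-∀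

  left-rot-y : ∀ Q e → Y.leftSum Q (rotV e) ≡ X.leftSum Q e
  left-rot-y Q e = trans (sym (sumPrim-rot Q (λ w → ⟦ pos? (cross (rotV e) w) ⟧ * proj₂ w)))
    (sumPrim-cong Q (λ w _ → cong (λ z → ⟦ pos? z ⟧ * proj₁ w) (cross-rot e w)))

  -- Every nonzero vector arises from one with |a| ≤ q, q > 0 by at most three quarter turns; the
  -- larger coordinate and its sign tell how many.
  rotation-induction : (P : V2 → Set) → (∀ q′ a → ∣ a ∣ ℕ.≤ suc q′ → P (+ suc q′ , a)) →
    (∀ e → P e → P (rotV e)) → ∀ e → coprimeᵇ e ≡ true → P e
  rotation-induction P right rot (q , a) e-prim with ℕₚ.≤-total ∣ a ∣ ∣ q ∣
  rotation-induction P right rot (+ suc q , a) e-prim | inj₁ a≤q = right q a a≤q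
  rotation-induction P right rot (-[1+ q ] , a) e-prim | inj₁ a≤q =
    subst (λ z → P (-[1+ q ] , z)) (ℤₚ.neg-involutive a)
      (rot _ (rot _ (right q (- a) (subst (ℕ._≤ suc q) (sym (ℤₚ.∣-i∣≡∣i∣ a)) a≤q))))
  rotation-induction P right rot (+ zero , + zero) () | inj₁ a≤q
  rotation-induction P right rot (q , + suc a) e-prim | inj₂ q≤a =
    subst (λ z → P (z , + suc a)) (ℤₚ.neg-involutive q) (rot _ (right a (- q) (subst (ℕ._≤ suc a) (sym (ℤₚ.∣-i∣≡∣i∣ q)) q≤a)))
  rotation-induction P right rot (q , -[1+ a ]) e-prim | inj₂ q≤a =
    subst (λ z → P (z , -[1+ a ])) (ℤₚ.neg-involutive q) (rot _ (rot _ (rot _ (right a q q≤a))))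
  rotation-induction P right rot (+ zero , + zero) () | inj₂ q≤a

  sumPrim-linear : ∀ M s t (f g : V2 → ℤ) → sumPrim M (λ w → s * f w + t * g w) ≡ s * sumPrim M f + t * sumPrim M g
  sumPrim-linear M s t f g = trans (sumPrim-+ M (λ w → s * f w) (λ w → t * g w)) (cong₂ _+_ (sumPrim-*ˡ M s f) (sumPrim-*ˡ M t g))

  MomentX MomentY : ℕ → ℕ → ℤ → ℤ
  MomentX Q q a = + 3 * + q * X.leftSum Q (+ q , a) + a * sumPrim Q upperY
  MomentY Q q a = + 6 * (+ q * + q) * Y.leftSum Q (+ q , a) + - (+ 3 * (+ q * + q) - a * a) * sumPrim Q upperY

  -- A single threshold serves all edges and both coordinates, because both weights are balanced
  -- with the same constant 18.
  moment-estimates : ∀ k → Σ ℕ λ Q₀ → ∀ Q → Q₀ ℕ.≤ Q → ∀ q′ a → ∣ a ∣ ℕ.≤ suc q′ →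
    k ℕ.* ∣ MomentX Q (suc q′) a ∣ ℕ.≤ suc q′ ℕ.* cube Q × k ℕ.* ∣ MomentY Q (suc q′) a ∣ ℕ.≤ suc q′ ℕ.* suc q′ ℕ.* cube Q
  moment-estimates k = proj₁ small , estimate
    where
    small : Σ ℕ λ Q₀ → ∀ N φ → Balanced 18 N φ → ∀ Q → Q₀ ℕ.≤ Q → k ℕ.* ∣ sumPrim Q φ ∣ ℕ.≤ N ℕ.* cube Q
    small = equidistribution 18 k
    estimate : ∀ Q → proj₁ small ℕ.≤ Q → ∀ q′ a → ∣ a ∣ ℕ.≤ suc q′ →
      k ℕ.* ∣ MomentX Q (suc q′) a ∣ ℕ.≤ suc q′ ℕ.* cube Q × k ℕ.* ∣ MomentY Q (suc q′) a ∣ ℕ.≤ suc q′ ℕ.* suc q′ ℕ.* cube Q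
    estimate Q big q′ a a≤q =
        subst (λ z → k ℕ.* ∣ z ∣ ℕ.≤ q ℕ.* cube Q) (sumPrim-linear Q (+ 3 * + q) a (leftX (+ q , a)) upperY)
          (proj₂ small q momentX momentX-balanced Q big)
      , subst (λ z → k ℕ.* ∣ z ∣ ℕ.≤ q ℕ.* q ℕ.* cube Q)
          (sumPrim-linear Q (+ 6 * (+ q * + q)) (- (+ 3 * (+ q * + q) - a * a)) (leftY (+ q , a)) upperY)
          (proj₂ small (q ℕ.* q) momentY momentY-balanced Q big)
      where
      q = suc q′
      open HalfPlane q′ a a≤q
      open HalfPlaneBalanced q′ a a≤q

-- Distance to the curve
module _ where
  open import Data.Rational using (_+_; _*_; -_; _-_; _≤_; _<_)

  ℚ-ring : AlmostCommutativeRing 0ℓ 0ℓ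
  ℚ-ring = fromCommutativeRing ℚₚ.+-*-commutativeRing (λ p → dec⇒maybe (0ℚ ℚₚ.≟ p))

  toℚ-toℚᵘ : ∀ z → toℚᵘ (toℚ z) ℚᵘ.≃ mkℚᵘ z 0
  toℚ-toℚᵘ z = ℚₚ.toℚᵘ-fromℚᵘ (mkℚᵘ z 0)

  toℚ-+ : ∀ a b → toℚ (a ℤ.+ b) ≡ toℚ a + toℚ b
  toℚ-+ a b = ℚₚ.toℚᵘ-injective (begin-equality
    toℚᵘ (toℚ (a ℤ.+ b))              ≃⟨ toℚ-toℚᵘ (a ℤ.+ b) ⟩
    mkℚᵘ (a ℤ.+ b) 0                  ≃⟨ *≡* (lemma a b) ⟩
    mkℚᵘ a 0 ℚᵘ.+ mkℚᵘ b 0            ≃⟨ ℚᵘₚ.+-cong (toℚ-toℚᵘ a) (toℚ-toℚᵘ b) ⟨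
    toℚᵘ (toℚ a) ℚᵘ.+ toℚᵘ (toℚ b)    ≃⟨ ℚₚ.toℚᵘ-homo-+ (toℚ a) (toℚ b) ⟨
    toℚᵘ (toℚ a + toℚ b)              ∎)
    where
    open ℚᵘₚ.≤-Reasoning
    lemma : ∀ a b → (a ℤ.+ b) ℤ.* + 1 ≡ (a ℤ.* + 1 ℤ.+ b ℤ.* + 1) ℤ.* + 1
    lemma = solve-∀

  toℚ-* : ∀ a b → toℚ (a ℤ.* b) ≡ toℚ a * toℚ b
  toℚ-* a b = ℚₚ.toℚᵘ-injective (begin-equality
    toℚᵘ (toℚ (a ℤ.* b))              ≃⟨ toℚ-toℚᵘ (a ℤ.* b) ⟩
    mkℚᵘ a 0 ℚᵘ.* mkℚᵘ b 0            ≃⟨ ℚᵘₚ.*-cong (toℚ-toℚᵘ a) (toℚ-toℚᵘ b) ⟨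
    toℚᵘ (toℚ a) ℚᵘ.* toℚᵘ (toℚ b)    ≃⟨ ℚₚ.toℚᵘ-homo-* (toℚ a) (toℚ b) ⟨
    toℚᵘ (toℚ a * toℚ b)              ∎)
    where open ℚᵘₚ.≤-Reasoning

  toℚ-neg : ∀ a → toℚ (ℤ.- a) ≡ - toℚ a
  toℚ-neg (+ zero)  = refl
  toℚ-neg (+ suc n) = refl
  toℚ-neg -[1+ n ]  = sym (neg-neg (toℚ (+ suc n)))
    where
    neg-neg : ∀ p → - (- p) ≡ p
    neg-neg = RingSolver.solve-∀ ℚ-ring

  toℚ-mono-≤ : ∀ {a b} → a ℤ.≤ b → toℚ a ≤ toℚ b
  toℚ-mono-≤ {a} {b} a≤b = ℚₚ.toℚᵘ-cancel-≤ (begin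
    toℚᵘ (toℚ a)   ≃⟨ toℚ-toℚᵘ a ⟩
    mkℚᵘ a 0       ≤⟨ *≤*ᵘ (ℤₚ.*-monoʳ-≤-nonNeg (+ 1) a≤b) ⟩
    mkℚᵘ b 0       ≃⟨ toℚ-toℚᵘ b ⟨
    toℚᵘ (toℚ b)   ∎)
    where open ℚᵘₚ.≤-Reasoning

  toℚ-positive : ∀ n → ℚ.Positive (toℚ (+ suc n))
  toℚ-positive n = ℚₚ.normalize-pos (suc n) 1

  toℚ-nonNegative : ∀ n → ℚ.NonNegative (toℚ (+ n))
  toℚ-nonNegative n = ℚₚ.normalize-nonNeg n 1

  toℚ-abs : ∀ z → ℚ.∣ toℚ z ∣ ≡ toℚ (+ ∣ z ∣)
  toℚ-abs (+ n)     = ℚₚ.0≤p⇒∣p∣≡p (toℚ-mono-≤ {+ 0} {+ n} (ℤ.+≤+ ℕ.z≤n))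
  toℚ-abs -[1+ n ]  = trans (ℚₚ.∣-p∣≡∣p∣ (toℚ (+ suc n))) (toℚ-abs (+ suc n))

  /-cancel : ∀ z d → (z ℚ./ suc d) * toℚ (+ suc d) ≡ toℚ z
  /-cancel z d = ℚₚ.toℚᵘ-injective (begin-equality
    toℚᵘ ((z ℚ./ suc d) * toℚ (+ suc d))            ≃⟨ ℚₚ.toℚᵘ-homo-* (z ℚ./ suc d) (toℚ (+ suc d)) ⟩
    toℚᵘ (z ℚ./ suc d) ℚᵘ.* toℚᵘ (toℚ (+ suc d))    ≃⟨ ℚᵘₚ.*-cong (ℚₚ.toℚᵘ-fromℚᵘ (mkℚᵘ z d)) (toℚ-toℚᵘ (+ suc d)) ⟩
    mkℚᵘ z d ℚᵘ.* mkℚᵘ (+ suc d) 0                  ≃⟨ *≡* (trans (lemma z (+ suc d)) (cong (λ k → z ℤ.* + suc k) (sym (ℕₚ.*-identityʳ d)))) ⟩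
    mkℚᵘ z 0                                        ≃⟨ toℚ-toℚᵘ z ⟨
    toℚᵘ (toℚ z)                                    ∎)
    where
    open ℚᵘₚ.≤-Reasoning
    lemma : ∀ z d → z ℤ.* d ℤ.* + 1 ≡ z ℤ.* d
    lemma = solve-∀

  -- Passage from integer to rational estimates: `u` is the fraction w / (d + 1), and the conclusion
  -- reads |u| ≤ N / k.
  scaled-bound : ∀ u d w k N → u * toℚ (+ suc d) ≡ toℚ w → k ℕ.* ∣ w ∣ ℕ.≤ N ℕ.* suc d →
    ℚ.∣ u ∣ * toℚ (+ k) ≤ toℚ (+ N)
  scaled-bound u d w k N eq h = ℚₚ.*-cancelʳ-≤-pos (toℚ (+ suc d)) {{toℚ-positive d}} (begin
    ℚ.∣ u ∣ * toℚ (+ k) * toℚ (+ suc d)        ≡⟨ rearrange ℚ.∣ u ∣ (toℚ (+ k)) (toℚ (+ suc d)) ⟩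
    toℚ (+ k) * (ℚ.∣ u ∣ * toℚ (+ suc d))      ≡⟨ cong (λ z → toℚ (+ k) * (ℚ.∣ u ∣ * z)) (toℚ-abs (+ suc d)) ⟨
    toℚ (+ k) * (ℚ.∣ u ∣ * ℚ.∣ toℚ (+ suc d) ∣) ≡⟨ cong (toℚ (+ k) *_) (ℚₚ.∣p*q∣≡∣p∣*∣q∣ u (toℚ (+ suc d))) ⟨
    toℚ (+ k) * ℚ.∣ u * toℚ (+ suc d) ∣        ≡⟨ cong (λ z → toℚ (+ k) * z) (trans (cong ℚ.∣_∣ eq) (toℚ-abs w)) ⟩
    toℚ (+ k) * toℚ (+ ∣ w ∣)                  ≡⟨ toℚ-* (+ k) (+ ∣ w ∣) ⟨
    toℚ (+ k ℤ.* + ∣ w ∣)                      ≡⟨ cong toℚ (ℤₚ.pos-* k ∣ w ∣) ⟨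
    toℚ (+ (k ℕ.* ∣ w ∣))                      ≤⟨ toℚ-mono-≤ (ℤ.+≤+ h) ⟩
    toℚ (+ (N ℕ.* suc d))                      ≡⟨ trans (cong toℚ (ℤₚ.pos-* N (suc d))) (toℚ-* (+ N) (+ suc d)) ⟩
    toℚ (+ N) * toℚ (+ suc d)                  ∎)
    where
    open ℚₚ.≤-Reasoning
    rearrange : ∀ u k d → u * k * d ≡ k * (u * d)
    rearrange = RingSolver.solve-∀ ℚ-ring

  archimedean : ∀ ε → 0ℚ < ε → Σ ℕ λ n → 1ℚ ≤ ε * toℚ (+ suc n)
  -- The denominator d + 1 of ε works because the numerator is at least 1.
  archimedean (mkℚ (+ suc m) d c) _ = d , subst (1ℚ ≤_) (sym eq) (toℚ-mono-≤ {+ 1} {+ suc m} (ℤ.+≤+ (ℕ.s≤s ℕ.z≤n)))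
    where
    eq : mkℚ (+ suc m) d c * toℚ (+ suc d) ≡ toℚ (+ suc m)
    eq = trans (cong (_* toℚ (+ suc d)) (sym (ℚₚ.fromℚᵘ-toℚᵘ (mkℚ (+ suc m) d c)))) (/-cancel (+ suc m) d)
  archimedean (mkℚ (+ zero) d c) (ℚ.*<* (ℤ.+<+ ()))
  archimedean (mkℚ -[1+ m ] d c) (ℚ.*<* ())

  invLen-* : ∀ n → invLen (suc n) * toℚ (+ suc n) ≡ 1ℚ
  invLen-* n = /-cancel (+ 1) n

  neg-neg : ∀ p → - (- p) ≡ p
  neg-neg = RingSolver.solve-∀ ℚ-ring

  -- The point of the curve attached to an edge.

  OnC-rot : ∀ c → OnC c → OnC (rot c)
  OnC-rot _ (x , lo , hi , inj₁ refl)                      = x , lo , hi , inj₂ (inj₁ refl)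
  OnC-rot _ (x , lo , hi , inj₂ (inj₁ refl))               = x , lo , hi , inj₂ (inj₂ (inj₁ refl))
  OnC-rot _ (x , lo , hi , inj₂ (inj₂ (inj₁ refl)))        = x , lo , hi , inj₂ (inj₂ (inj₂ refl))
  OnC-rot _ (x , lo , hi , inj₂ (inj₂ (inj₂ refl)))        =
    x , lo , hi , inj₁ (cong₂ _,_ (neg-neg (proj₁ (parab x))) (neg-neg (proj₂ (parab x))))

  -- Division-free form of |-2u/K - c| ≤ 4/k. The 4 comes from the abscissa, where the error is 2 ·
  -- q · 6K over the denominator 3q.
  CloseTo : ℕ → ℤ → ℤ → ℚ → Set
  CloseTo k K u c = ℚ.∣ toℚ (+ 2 ℤ.* u) + toℚ K * c ∣ * toℚ (+ k) ≤ toℚ (+ (4 ℕ.* ∣ K ∣))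

  CloseTo-neg : ∀ k K u c → CloseTo k K u c → CloseTo k K (ℤ.- u) (- c)
  CloseTo-neg k K u c = subst (λ z → z * toℚ (+ k) ≤ toℚ (+ (4 ℕ.* ∣ K ∣))) (trans (sym (ℚₚ.∣-p∣≡∣p∣ _)) (cong ℚ.∣_∣ eq))
    where
    negate : ∀ u → ℤ.- (+ 2 ℤ.* u) ≡ + 2 ℤ.* ℤ.- u
    negate = solve-∀
    distribute : ∀ v K c → - (v + K * c) ≡ - v + K * - c
    distribute = RingSolver.solve-∀ ℚ-ring
    eq : - (toℚ (+ 2 ℤ.* u) + toℚ K * c) ≡ toℚ (+ 2 ℤ.* ℤ.- u) + toℚ K * - c
    eq = trans (distribute (toℚ (+ 2 ℤ.* u)) (toℚ K) c)
      (cong (_+ toℚ K * - c) (trans (sym (toℚ-neg (+ 2 ℤ.* u))) (cong toℚ (negate u))))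

  -- Collects what the final estimate uses about an edge in a form stable under quarter turns, as
  -- `rotation-induction` requires.
  Near : ℕ → ℕ → V2 → Set
  Near Q k e = (ties Q e ℤ.≤ + (2 ℕ.* Q ℕ.+ 1)) × Σ Q2 λ c → OnC c ×
    CloseTo k (sumPrim Q upperY) (X.leftSum Q e) (proj₁ c) ×
    CloseTo k (sumPrim Q upperY) (Y.leftSum Q e) (proj₂ c)

  Near-rot : ∀ Q k e → Near Q k e → Near Q k (rotV e)
  Near-rot Q k e (few , c , onC , closeX , closeY) =
      subst (ℤ._≤ + (2 ℕ.* Q ℕ.+ 1)) (sym (ties-rot Q e)) few
    , rot c , OnC-rot c onC
    , subst (λ u → CloseTo k K u (- proj₂ c)) (sym (left-rot-x Q e)) (CloseTo-neg k K (Y.leftSum Q e) (proj₂ c) closeY)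
    , subst (λ u → CloseTo k K u (proj₁ c)) (sym (left-rot-y Q e)) closeX
    where K = sumPrim Q upperY

  module RightSector (q′ : ℕ) (a : ℤ) (∣a∣≤q : ∣ a ∣ ℕ.≤ suc q′) where

    q d : ℕ
    q = suc q′
    -- `suc d` unfolds to 3 * q, the denominator of the abscissa 2a/(3q).
    d = q′ ℕ.+ 2 ℕ.* suc q′

    +3q : + suc d ≡ + 3 ℤ.* + q
    +3q = ℤₚ.pos-* 3 q

    x : ℚ
    x = (+ 2 ℤ.* a) ℚ./ suc d

    x-upper : x ≤ (+ 2) ℚ./ 3
    x-upper = ℚₚ.toℚᵘ-cancel-≤ (begin
      toℚᵘ x                    ≃⟨ ℚₚ.toℚᵘ-fromℚᵘ (mkℚᵘ (+ 2 ℤ.* a) d) ⟩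
      mkℚᵘ (+ 2 ℤ.* a) d        ≤⟨ *≤*ᵘ num ⟩
      mkℚᵘ (+ 2) 2              ∎)
      where
      open ℚᵘₚ.≤-Reasoning
      left : ∀ a → + 6 ℤ.* a ≡ + 2 ℤ.* a ℤ.* + 3
      left = solve-∀
      right : ∀ q → + 6 ℤ.* q ≡ + 2 ℤ.* (+ 3 ℤ.* q)
      right = solve-∀
      num : + 2 ℤ.* a ℤ.* + 3 ℤ.≤ + 2 ℤ.* + suc d
      num = subst₂ ℤ._≤_ (left a) (trans (right (+ q)) (cong (+ 2 ℤ.*_) (sym +3q)))
        (ℤₚ.*-monoˡ-≤-nonNeg (+ 6) (∣i∣≤n⇒i≤n a ∣a∣≤q))

    x-lower : - ((+ 2) ℚ./ 3) ≤ x
    x-lower = ℚₚ.toℚᵘ-cancel-≤ (begin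
      mkℚᵘ (ℤ.- + 2) 2          ≤⟨ *≤*ᵘ num ⟩
      mkℚᵘ (+ 2 ℤ.* a) d        ≃⟨ ℚₚ.toℚᵘ-fromℚᵘ (mkℚᵘ (+ 2 ℤ.* a) d) ⟨
      toℚᵘ x                    ∎)
      where
      open ℚᵘₚ.≤-Reasoning
      left : ∀ q → + 6 ℤ.* ℤ.- q ≡ ℤ.- + 2 ℤ.* (+ 3 ℤ.* q)
      left = solve-∀
      right : ∀ a → + 6 ℤ.* a ≡ + 2 ℤ.* a ℤ.* + 3
      right = solve-∀
      num : ℤ.- + 2 ℤ.* + suc d ℤ.≤ + 2 ℤ.* a ℤ.* + 3
      num = subst₂ ℤ._≤_ (trans (left (+ q)) (cong (ℤ.- + 2 ℤ.*_) (sym +3q))) (right a)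
        (ℤₚ.*-monoˡ-≤-nonNeg (+ 6) (∣i∣≤n⇒-n≤i a ∣a∣≤q))

    closeX : ∀ Q k → k ℕ.* ∣ MomentX Q q a ∣ ℕ.≤ q ℕ.* cube Q → cube Q ℕ.≤ 6 ℕ.* ∣ sumPrim Q upperY ∣ →
      CloseTo k (sumPrim Q upperY) (X.leftSum Q (+ q , a)) (proj₁ (parab x))
    closeX Q k small large = scaled-bound (toℚ (+ 2 ℤ.* U) + toℚ K * x) d (+ 2 ℤ.* MomentX Q q a) k (4 ℕ.* ∣ K ∣) scaled bounded
      where
      U = X.leftSum Q (+ q , a)
      K = sumPrim Q upperY
      expand : ∀ v K x D → (v + K * x) * D ≡ v * D + K * (x * D)
      expand = RingSolver.solve-∀ ℚ-ring
      integer : ∀ U K q a → + 2 ℤ.* U ℤ.* (+ 3 ℤ.* q) ℤ.+ K ℤ.* (+ 2 ℤ.* a) ≡ + 2 ℤ.* (+ 3 ℤ.* q ℤ.* U ℤ.+ a ℤ.* K)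
      integer = solve-∀
      scaled : (toℚ (+ 2 ℤ.* U) + toℚ K * x) * toℚ (+ suc d) ≡ toℚ (+ 2 ℤ.* MomentX Q q a)
      scaled = begin
        (toℚ (+ 2 ℤ.* U) + toℚ K * x) * toℚ (+ suc d)
          ≡⟨ expand (toℚ (+ 2 ℤ.* U)) (toℚ K) x (toℚ (+ suc d)) ⟩
        toℚ (+ 2 ℤ.* U) * toℚ (+ suc d) + toℚ K * (x * toℚ (+ suc d))
          ≡⟨ cong (λ z → toℚ (+ 2 ℤ.* U) * toℚ (+ suc d) + toℚ K * z) (/-cancel (+ 2 ℤ.* a) d) ⟩
        toℚ (+ 2 ℤ.* U) * toℚ (+ suc d) + toℚ K * toℚ (+ 2 ℤ.* a)
          ≡⟨ cong₂ _+_ (toℚ-* (+ 2 ℤ.* U) (+ suc d)) (toℚ-* K (+ 2 ℤ.* a)) ⟨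
        toℚ (+ 2 ℤ.* U ℤ.* + suc d) + toℚ (K ℤ.* (+ 2 ℤ.* a))
          ≡⟨ toℚ-+ (+ 2 ℤ.* U ℤ.* + suc d) (K ℤ.* (+ 2 ℤ.* a)) ⟨
        toℚ (+ 2 ℤ.* U ℤ.* + suc d ℤ.+ K ℤ.* (+ 2 ℤ.* a))
          ≡⟨ cong toℚ (trans (cong (λ z → + 2 ℤ.* U ℤ.* z ℤ.+ K ℤ.* (+ 2 ℤ.* a)) +3q) (integer U K (+ q) a)) ⟩
        toℚ (+ 2 ℤ.* MomentX Q q a) ∎
        where open ≡-Reasoning
      swap : ∀ k m → k ℕ.* (2 ℕ.* m) ≡ 2 ℕ.* (k ℕ.* m)
      swap = solve-∀ℕ
      collect : ∀ q K → 2 ℕ.* (q ℕ.* (6 ℕ.* K)) ≡ 4 ℕ.* K ℕ.* (3 ℕ.* q)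
      collect = solve-∀ℕ
      bounded : k ℕ.* ∣ + 2 ℤ.* MomentX Q q a ∣ ℕ.≤ 4 ℕ.* ∣ K ∣ ℕ.* suc d
      bounded = begin
        k ℕ.* ∣ + 2 ℤ.* MomentX Q q a ∣     ≡⟨ cong (k ℕ.*_) (ℤₚ.abs-* (+ 2) (MomentX Q q a)) ⟩
        k ℕ.* (2 ℕ.* ∣ MomentX Q q a ∣)     ≡⟨ swap k ∣ MomentX Q q a ∣ ⟩
        2 ℕ.* (k ℕ.* ∣ MomentX Q q a ∣)     ≤⟨ ℕₚ.*-monoʳ-≤ 2 (ℕₚ.≤-trans small (ℕₚ.*-monoʳ-≤ q large)) ⟩
        2 ℕ.* (q ℕ.* (6 ℕ.* ∣ K ∣))         ≡⟨ collect q ∣ K ∣ ⟩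
        4 ℕ.* ∣ K ∣ ℕ.* suc d               ∎
        where open ℕₚ.≤-Reasoning

    closeY : ∀ Q k → k ℕ.* ∣ MomentY Q q a ∣ ℕ.≤ q ℕ.* q ℕ.* cube Q → cube Q ℕ.≤ 6 ℕ.* ∣ sumPrim Q upperY ∣ →
      CloseTo k (sumPrim Q upperY) (Y.leftSum Q (+ q , a)) (proj₂ (parab x))
    -- The ordinate has denominator 9q² = (d + 1)², passed as its predecessor; multiplication by it
    -- gives exactly three times `MomentY`.
    closeY Q k small large = scaled-bound (toℚ (+ 2 ℤ.* U) + toℚ K * proj₂ (parab x))
      (d ℕ.+ d ℕ.* suc d) (+ 3 ℤ.* MomentY Q q a) k (4 ℕ.* ∣ K ∣) scaled bounded
      where
      U = Y.leftSum Q (+ q , a)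
      K = sumPrim Q upperY
      D = toℚ (+ suc d)
      expand : ∀ v K x D → (v + K * (((+ 3) ℚ./ 4) * x * x - 1ℚ)) * (D * D)
        ≡ v * (D * D) + K * (((+ 3) ℚ./ 4) * (x * D) * (x * D) - D * D)
      expand = RingSolver.solve-∀ ℚ-ring
      quarter : ∀ a → ((+ 3) ℚ./ 4) * (toℚ (+ 2) * a) * (toℚ (+ 2) * a) ≡ toℚ (+ 3) * (a * a)
      quarter = RingSolver.solve-∀ ℚ-ring
      integer : ∀ U K q a → + 2 ℤ.* U ℤ.* (+ 3 ℤ.* q ℤ.* (+ 3 ℤ.* q)) ℤ.+ K ℤ.* (+ 3 ℤ.* (a ℤ.* a) ℤ.+ ℤ.- (+ 3 ℤ.* q ℤ.* (+ 3 ℤ.* q)))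
        ≡ + 3 ℤ.* (+ 6 ℤ.* (q ℤ.* q) ℤ.* U ℤ.+ ℤ.- (+ 3 ℤ.* (q ℤ.* q) ℤ.- a ℤ.* a) ℤ.* K)
      integer = solve-∀
      D² : ℤ
      D² = + suc d ℤ.* + suc d
      toℚ-D² : toℚ D² ≡ D * D
      toℚ-D² = toℚ-* (+ suc d) (+ suc d)
      toℚ-3a² : toℚ (+ 3 ℤ.* (a ℤ.* a)) ≡ ((+ 3) ℚ./ 4) * toℚ (+ 2 ℤ.* a) * toℚ (+ 2 ℤ.* a)
      toℚ-3a² = begin
        toℚ (+ 3 ℤ.* (a ℤ.* a))             ≡⟨ trans (toℚ-* (+ 3) (a ℤ.* a)) (cong (toℚ (+ 3) *_) (toℚ-* a a)) ⟩
        toℚ (+ 3) * (toℚ a * toℚ a)         ≡⟨ quarter (toℚ a) ⟨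
        ((+ 3) ℚ./ 4) * (toℚ (+ 2) * toℚ a) * (toℚ (+ 2) * toℚ a)
          ≡⟨ cong (λ z → ((+ 3) ℚ./ 4) * z * z) (toℚ-* (+ 2) a) ⟨
        ((+ 3) ℚ./ 4) * toℚ (+ 2 ℤ.* a) * toℚ (+ 2 ℤ.* a) ∎
        where open ≡-Reasoning
      scaled : (toℚ (+ 2 ℤ.* U) + toℚ K * proj₂ (parab x)) * toℚ (+ suc (d ℕ.+ d ℕ.* suc d)) ≡ toℚ (+ 3 ℤ.* MomentY Q q a)
      scaled = begin
        (toℚ (+ 2 ℤ.* U) + toℚ K * proj₂ (parab x)) * toℚ (+ suc (d ℕ.+ d ℕ.* suc d))
          ≡⟨ cong ((toℚ (+ 2 ℤ.* U) + toℚ K * proj₂ (parab x)) *_) (trans (cong toℚ (ℤₚ.pos-* (suc d) (suc d))) toℚ-D²) ⟩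
        (toℚ (+ 2 ℤ.* U) + toℚ K * proj₂ (parab x)) * (D * D)
          ≡⟨ expand (toℚ (+ 2 ℤ.* U)) (toℚ K) x D ⟩
        toℚ (+ 2 ℤ.* U) * (D * D) + toℚ K * (((+ 3) ℚ./ 4) * (x * D) * (x * D) - D * D)
          ≡⟨ cong (λ z → toℚ (+ 2 ℤ.* U) * (D * D) + toℚ K * (((+ 3) ℚ./ 4) * z * z - D * D)) (/-cancel (+ 2 ℤ.* a) d) ⟩
        toℚ (+ 2 ℤ.* U) * (D * D) + toℚ K * (((+ 3) ℚ./ 4) * toℚ (+ 2 ℤ.* a) * toℚ (+ 2 ℤ.* a) - D * D)
          ≡⟨ cong₂ (λ y z → toℚ (+ 2 ℤ.* U) * z + toℚ K * (y - z)) toℚ-3a² toℚ-D² ⟨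
        toℚ (+ 2 ℤ.* U) * toℚ D² + toℚ K * (toℚ (+ 3 ℤ.* (a ℤ.* a)) - toℚ D²)
          ≡⟨ cong₂ _+_ (toℚ-* (+ 2 ℤ.* U) D²)
               (trans (toℚ-* K (+ 3 ℤ.* (a ℤ.* a) ℤ.+ ℤ.- D²)) (cong (toℚ K *_)
                 (trans (toℚ-+ (+ 3 ℤ.* (a ℤ.* a)) (ℤ.- D²)) (cong (λ z → toℚ (+ 3 ℤ.* (a ℤ.* a)) + z) (toℚ-neg D²))))) ⟨
        toℚ (+ 2 ℤ.* U ℤ.* D²) + toℚ (K ℤ.* (+ 3 ℤ.* (a ℤ.* a) ℤ.+ ℤ.- D²))
          ≡⟨ toℚ-+ (+ 2 ℤ.* U ℤ.* D²) (K ℤ.* (+ 3 ℤ.* (a ℤ.* a) ℤ.+ ℤ.- D²)) ⟨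
        toℚ (+ 2 ℤ.* U ℤ.* D² ℤ.+ K ℤ.* (+ 3 ℤ.* (a ℤ.* a) ℤ.+ ℤ.- D²))
          ≡⟨ cong toℚ (trans (cong (λ z → + 2 ℤ.* U ℤ.* (z ℤ.* z) ℤ.+ K ℤ.* (+ 3 ℤ.* (a ℤ.* a) ℤ.+ ℤ.- (z ℤ.* z))) +3q) (integer U K (+ q) a)) ⟩
        toℚ (+ 3 ℤ.* MomentY Q q a) ∎
        where open ≡-Reasoning
      swap : ∀ k m → k ℕ.* (3 ℕ.* m) ≡ 3 ℕ.* (k ℕ.* m)
      swap = solve-∀ℕ
      collect : ∀ q K → 3 ℕ.* (q ℕ.* q ℕ.* (6 ℕ.* K)) ℕ.+ 18 ℕ.* (q ℕ.* q ℕ.* K) ≡ 4 ℕ.* K ℕ.* (3 ℕ.* q ℕ.* (3 ℕ.* q))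
      collect = solve-∀ℕ
      bounded : k ℕ.* ∣ + 3 ℤ.* MomentY Q q a ∣ ℕ.≤ 4 ℕ.* ∣ K ∣ ℕ.* (suc d ℕ.* suc d)
      bounded = begin
        k ℕ.* ∣ + 3 ℤ.* MomentY Q q a ∣       ≡⟨ cong (k ℕ.*_) (ℤₚ.abs-* (+ 3) (MomentY Q q a)) ⟩
        k ℕ.* (3 ℕ.* ∣ MomentY Q q a ∣)       ≡⟨ swap k ∣ MomentY Q q a ∣ ⟩
        3 ℕ.* (k ℕ.* ∣ MomentY Q q a ∣)       ≤⟨ ℕₚ.*-monoʳ-≤ 3 (ℕₚ.≤-trans small (ℕₚ.*-monoʳ-≤ (q ℕ.* q) large)) ⟩
        3 ℕ.* (q ℕ.* q ℕ.* (6 ℕ.* ∣ K ∣))     ≤⟨ ℕₚ.m≤m+n _ (18 ℕ.* (q ℕ.* q ℕ.* ∣ K ∣)) ⟩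
        3 ℕ.* (q ℕ.* q ℕ.* (6 ℕ.* ∣ K ∣)) ℕ.+ 18 ℕ.* (q ℕ.* q ℕ.* ∣ K ∣)  ≡⟨ collect q ∣ K ∣ ⟩
        4 ℕ.* ∣ K ∣ ℕ.* (suc d ℕ.* suc d)     ∎
        where open ℕₚ.≤-Reasoning

  all-near : ∀ k → Σ ℕ λ Q₀ → ∀ Q → Q₀ ℕ.≤ Q → cube Q ℕ.≤ 6 ℕ.* ∣ sumPrim Q upperY ∣ → ∀ e → coprimeᵇ e ≡ true → Near Q k e
  all-near k = proj₁ estimates , λ Q big large → rotation-induction (Near Q k)
    (λ q′ a a≤q → let open RightSector q′ a a≤q ; small = proj₂ estimates Q big q′ a a≤q in
       ties-right Q q′ a , parab x , (x , x-lower , x-upper , inj₁ refl)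
         , closeX Q k (proj₁ small) large , closeY Q k (proj₂ small) large)
    (Near-rot Q k)
    where
    estimates : Σ ℕ λ Q₀ → ∀ Q → Q₀ ℕ.≤ Q → ∀ q′ a → ∣ a ∣ ℕ.≤ suc q′ →
      k ℕ.* ∣ MomentX Q (suc q′) a ∣ ℕ.≤ suc q′ ℕ.* cube Q × k ℕ.* ∣ MomentY Q (suc q′) a ∣ ℕ.≤ suc q′ ℕ.* suc q′ ℕ.* cube Q
    estimates = moment-estimates k

  -- Centre and scaling factor in terms of edge sums.

  sumQ2-x : ∀ (f g : V2 → ℤ) es → proj₁ (sumQ2 (map (λ e → (toℚ (f e) , toℚ (g e))) es)) ≡ toℚ (sumList f es)
  sumQ2-x f g []       = refl
  sumQ2-x f g (e ∷ es) = trans (cong (λ z → toℚ (f e) + z) (sumQ2-x f g es)) (sym (toℚ-+ (f e) (sumList f es)))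

  sumQ2-y : ∀ (f g : V2 → ℤ) es → proj₂ (sumQ2 (map (λ e → (toℚ (f e) , toℚ (g e))) es)) ≡ toℚ (sumList g es)
  sumQ2-y f g []       = refl
  sumQ2-y f g (e ∷ es) = trans (cong (λ z → toℚ (g e) + z) (sumQ2-y f g es)) (sym (toℚ-+ (g e) (sumList g es)))

  ∈⇒length : ∀ {A : Set} {x : A} {xs} → x ∈ xs → Σ ℕ λ m → length xs ≡ suc m
  ∈⇒length {xs = _ ∷ xs} _ = length xs , refl

  average : ∀ s l u m → + 2 ℤ.* s ≡ + l ℤ.* u → l ≡ suc m → toℚ (+ 2) * (toℚ s * invLen l) ≡ toℚ u
  average s _ u m eq refl = begin
    toℚ (+ 2) * (toℚ s * inv)          ≡⟨ ℚₚ.*-assoc (toℚ (+ 2)) (toℚ s) inv ⟨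
    toℚ (+ 2) * toℚ s * inv            ≡⟨ cong (_* inv) (trans (sym (toℚ-* (+ 2) s)) (trans (cong toℚ eq) (toℚ-* (+ suc m) u))) ⟩
    toℚ (+ suc m) * toℚ u * inv        ≡⟨ rearrange (toℚ (+ suc m)) (toℚ u) inv ⟩
    inv * toℚ (+ suc m) * toℚ u        ≡⟨ cong (_* toℚ u) (invLen-* m) ⟩
    1ℚ * toℚ u                         ≡⟨ ℚₚ.*-identityˡ (toℚ u) ⟩
    toℚ u                              ∎
    where
    open ≡-Reasoning
    inv = invLen (suc m)
    rearrange : ∀ a b c → a * b * c ≡ c * a * b
    rearrange = RingSolver.solve-∀ ℚ-ring

  centre-x : ∀ Q {e} → e ∈ VQ Q → toℚ (+ 2) * proj₁ (centre Q) ≡ toℚ (X.upperSum Q)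
  centre-x Q e∈ = trans (cong (λ z → toℚ (+ 2) * (z * invLen (length (VQ Q)))) total)
    (average (sumPrim Q (X.startSum Q)) (length (VQ Q)) (X.upperSum Q) (proj₁ nonempty) (X.sum-starts Q) (proj₂ nonempty))
    where
    nonempty = ∈⇒length e∈
    total : proj₁ (sumQ2 (map (λ e → (toℚ (proj₁ (edgeStart Q e)) , toℚ (proj₂ (edgeStart Q e)))) (VQ Q))) ≡ toℚ (sumPrim Q (X.startSum Q))
    total = trans (sumQ2-x (λ e → proj₁ (edgeStart Q e)) (λ e → proj₂ (edgeStart Q e)) (VQ Q))
      (cong toℚ (trans (sumList-cong (edgeStart-x Q) (VQ Q)) (sumList-VQ Q (X.startSum Q))))

  centre-y : ∀ Q {e} → e ∈ VQ Q → toℚ (+ 2) * proj₂ (centre Q) ≡ toℚ (Y.upperSum Q)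
  centre-y Q e∈ = trans (cong (λ z → toℚ (+ 2) * (z * invLen (length (VQ Q)))) total)
    (average (sumPrim Q (Y.startSum Q)) (length (VQ Q)) (Y.upperSum Q) (proj₁ nonempty) (Y.sum-starts Q) (proj₂ nonempty))
    where
    nonempty = ∈⇒length e∈
    total : proj₂ (sumQ2 (map (λ e → (toℚ (proj₁ (edgeStart Q e)) , toℚ (proj₂ (edgeStart Q e)))) (VQ Q))) ≡ toℚ (sumPrim Q (Y.startSum Q))
    total = trans (sumQ2-y (λ e → proj₁ (edgeStart Q e)) (λ e → proj₂ (edgeStart Q e)) (VQ Q))
      (cong toℚ (trans (sumList-cong (edgeStart-y Q) (VQ Q)) (sumList-VQ Q (Y.startSum Q))))

  -- The normalisation says that λ₀ times the height of the centre is 1, and K is four times that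
  -- height.
  scale-value : ∀ Q λ₀ {e} → e ∈ VQ Q → IsScale Q λ₀ → λ₀ * toℚ (sumPrim Q upperY) ≡ toℚ (+ 4)
  scale-value Q λ₀ e∈ (_ , _ , eq) = begin
    λ₀ * toℚ (sumPrim Q upperY)
      ≡⟨ cong (λ z → λ₀ * toℚ z) (upperSum-Y Q) ⟨
    λ₀ * toℚ (+ 2 ℤ.* Y.upperSum Q)
      ≡⟨ cong (λ₀ *_) (trans (toℚ-* (+ 2) (Y.upperSum Q)) (cong (toℚ (+ 2) *_) (sym (centre-y Q e∈)))) ⟩
    λ₀ * (toℚ (+ 2) * (toℚ (+ 2) * proj₂ (centre Q)))
      ≡⟨ rearrange λ₀ (proj₂ (centre Q)) ⟩
    - (toℚ (+ 4)) * (λ₀ * (0ℚ - proj₂ (centre Q)))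
      ≡⟨ cong (- (toℚ (+ 4)) *_) eq ⟩
    toℚ (+ 4) ∎
    where
    open ≡-Reasoning
    rearrange : ∀ l c → l * (toℚ (+ 2) * (toℚ (+ 2) * c)) ≡ - (toℚ (+ 4)) * (l * (0ℚ - c))
    rearrange = RingSolver.solve-∀ ℚ-ring

  -- The final estimate for a point of the polygon.

  ∈-intRange : ∀ Q {z} → z ∈ intRange Q → ∣ z ∣ ℕ.≤ Q
  ∈-intRange Q z∈ with ∈-map⁻ (λ k → (+ k) ℤ.- (+ Q)) z∈
  ... | k , k∈ , refl = bounds⇒∣i∣≤n
    (subst (ℤ._≤ + k ℤ.- + Q) (ℤₚ.+-identityˡ (ℤ.- + Q)) (ℤₚ.+-monoˡ-≤ (ℤ.- + Q) (ℤ.+≤+ {0} {k} ℕ.z≤n)))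
    (subst (+ k ℤ.- + Q ℤ.≤_) upper-end (ℤₚ.+-monoˡ-≤ (ℤ.- + Q) (ℤ.+≤+ k≤2Q)))
    where
    k≤2Q : k ℕ.≤ 2 ℕ.* Q
    k≤2Q = ℕₚ.≤-pred (subst (k ℕ.<_) (ℕₚ.+-comm (2 ℕ.* Q) 1) (∈-upTo⁻ k∈))
    halve : ∀ q → + 2 ℤ.* q ℤ.- q ≡ q
    halve = solve-∀
    upper-end : + (2 ℕ.* Q) ℤ.- + Q ≡ + Q
    upper-end = trans (cong (ℤ._- + Q) (ℤₚ.pos-* 2 Q)) (halve (+ Q))

  ∈-VQ : ∀ Q {e} → e ∈ VQ Q → coprimeᵇ e ≡ true × ∣ proj₁ e ∣ ℕ.≤ Q × ∣ proj₂ e ∣ ℕ.≤ Q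
  ∈-VQ Q e∈ with ∈-filter⁻ (λ v → coprimeᵇ v Boolₚ.≟ true) e∈
  ... | e∈box , e-prim with ∈-concatMap⁻ (λ q → map (λ a → (q , a)) (intRange Q)) {xs = intRange Q} e∈box
  ... | any with find any
  ... | q , q∈ , e∈row with ∈-map⁻ (λ a → (q , a)) e∈row
  ... | a , a∈ , refl = e-prim , ∈-intRange Q q∈ , ∈-intRange Q a∈

  -- Times K, the deviation is the tie error plus 4 t e minus (2U + K c). The last term costs at
  -- most 4K/k by `CloseTo`; the tie error and the position along the edge together cost at most
  -- K/k. Hence the 5.
  coordinate-bound : ∀ Q k Kn (S Sup U e : ℤ) (λ₀ ctr t c : ℚ) →
    λ₀ * toℚ (+ suc Kn) ≡ toℚ (+ 4) → toℚ (+ 2) * ctr ≡ toℚ Sup →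
    0ℚ ≤ t → t ≤ 1ℚ → ∣ e ∣ ℕ.≤ Q →
    ∣ + 2 ℤ.* (+ 2 ℤ.* S ℤ.- Sup) ℤ.+ + 2 ℤ.* U ∣ ℕ.≤ Q ℕ.* (2 ℕ.* Q ℕ.+ 1) →
    CloseTo k (+ suc Kn) U c →
    k ℕ.* (Q ℕ.* (2 ℕ.* Q ℕ.+ 1) ℕ.+ 4 ℕ.* Q) ℕ.≤ suc Kn →
    ℚ.∣ λ₀ * (toℚ S + t * toℚ e - ctr) - c ∣ * toℚ (+ k) ≤ toℚ (+ 5)
  coordinate-bound Q k Kn S Sup U e λ₀ ctr t c scale avg 0≤t t≤1 e≤Q tieB close small =
    ℚₚ.*-cancelʳ-≤-pos K {{toℚ-positive Kn}} (begin
      ℚ.∣ u ∣ * k′ * K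
        ≡⟨ rearrange ℚ.∣ u ∣ k′ K ⟩
      ℚ.∣ u ∣ * K * k′
        ≡⟨ cong (λ z → ℚ.∣ u ∣ * z * k′) (toℚ-abs (+ suc Kn)) ⟨
      ℚ.∣ u ∣ * ℚ.∣ K ∣ * k′
        ≡⟨ cong (_* k′) (trans (sym (ℚₚ.∣p*q∣≡∣p∣*∣q∣ u K)) (cong ℚ.∣_∣ identity)) ⟩
      ℚ.∣ (toℚ E + toℚ (+ 4) * (t * toℚ e)) - w ∣ * k′
        ≤⟨ ℚₚ.*-monoʳ-≤-nonNeg k′ {{toℚ-nonNegative k}} triangle ⟩
      (toℚ (+ (Q ℕ.* (2 ℕ.* Q ℕ.+ 1) ℕ.+ 4 ℕ.* Q)) + ℚ.∣ w ∣) * k′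
        ≡⟨ distribute (toℚ (+ (Q ℕ.* (2 ℕ.* Q ℕ.+ 1) ℕ.+ 4 ℕ.* Q))) ℚ.∣ w ∣ k′ ⟩
      k′ * toℚ (+ (Q ℕ.* (2 ℕ.* Q ℕ.+ 1) ℕ.+ 4 ℕ.* Q)) + ℚ.∣ w ∣ * k′
        ≤⟨ ℚₚ.+-mono-≤ negligible close ⟩
      K + toℚ (+ (4 ℕ.* suc Kn))
        ≡⟨ cong (λ z → K + z) (trans (cong toℚ (ℤₚ.pos-* 4 (suc Kn))) (toℚ-* (+ 4) (+ suc Kn))) ⟩
      K + toℚ (+ 4) * K
        ≡⟨ five K ⟩
      toℚ (+ 5) * K ∎)
    where
    open ℚₚ.≤-Reasoning
    K k′ u w : ℚ
    K = toℚ (+ suc Kn)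
    k′ = toℚ (+ k)
    u = λ₀ * (toℚ S + t * toℚ e - ctr) - c
    w = toℚ (+ 2 ℤ.* U) + K * c
    E : ℤ
    E = + 2 ℤ.* (+ 2 ℤ.* S ℤ.- Sup) ℤ.+ + 2 ℤ.* U
    rearrange : ∀ u k K → u * k * K ≡ u * K * k
    rearrange = RingSolver.solve-∀ ℚ-ring
    distribute : ∀ a b k → (a + b) * k ≡ k * a + b * k
    distribute = RingSolver.solve-∀ ℚ-ring
    five : ∀ K → K + toℚ (+ 4) * K ≡ toℚ (+ 5) * K
    five = RingSolver.solve-∀ ℚ-ring
    factor : ∀ l s c v K → (l * (s - c) - v) * K ≡ l * K * (s - c) - K * v
    factor = RingSolver.solve-∀ ℚ-ring
    regroup : ∀ s r x U v → toℚ (+ 4) * ((s + r) - x) - v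
      ≡ (toℚ (+ 2) * (toℚ (+ 2) * s - toℚ (+ 2) * x) + U + toℚ (+ 4) * r) - (U + v)
    regroup = RingSolver.solve-∀ ℚ-ring
    toℚ-E : toℚ E ≡ toℚ (+ 2) * (toℚ (+ 2) * toℚ S - toℚ Sup) + toℚ (+ 2 ℤ.* U)
    toℚ-E = trans (toℚ-+ (+ 2 ℤ.* (+ 2 ℤ.* S ℤ.- Sup)) (+ 2 ℤ.* U)) (cong (_+ toℚ (+ 2 ℤ.* U))
      (trans (toℚ-* (+ 2) (+ 2 ℤ.* S ℤ.- Sup)) (cong (toℚ (+ 2) *_)
        (trans (toℚ-+ (+ 2 ℤ.* S) (ℤ.- Sup)) (cong₂ _+_ (toℚ-* (+ 2) S) (toℚ-neg Sup))))))
    identity : u * K ≡ (toℚ E + toℚ (+ 4) * (t * toℚ e)) - w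
    identity = begin-equality
      u * K
        ≡⟨ factor λ₀ (toℚ S + t * toℚ e) ctr c K ⟩
      λ₀ * K * (toℚ S + t * toℚ e - ctr) - K * c
        ≡⟨ cong (λ z → z * (toℚ S + t * toℚ e - ctr) - K * c) scale ⟩
      toℚ (+ 4) * (toℚ S + t * toℚ e - ctr) - K * c
        ≡⟨ regroup (toℚ S) (t * toℚ e) ctr (toℚ (+ 2 ℤ.* U)) (K * c) ⟩
      (toℚ (+ 2) * (toℚ (+ 2) * toℚ S - toℚ (+ 2) * ctr) + toℚ (+ 2 ℤ.* U) + toℚ (+ 4) * (t * toℚ e)) - w
        ≡⟨ cong (λ z → (toℚ (+ 2) * (toℚ (+ 2) * toℚ S - z) + toℚ (+ 2 ℤ.* U) + toℚ (+ 4) * (t * toℚ e)) - w) avg ⟩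
      (toℚ (+ 2) * (toℚ (+ 2) * toℚ S - toℚ Sup) + toℚ (+ 2 ℤ.* U) + toℚ (+ 4) * (t * toℚ e)) - w
        ≡⟨ cong (λ z → (z + toℚ (+ 4) * (t * toℚ e)) - w) toℚ-E ⟨
      (toℚ E + toℚ (+ 4) * (t * toℚ e)) - w ∎
    edge : ℚ.∣ toℚ (+ 4) * (t * toℚ e) ∣ ≤ toℚ (+ (4 ℕ.* Q))
    edge = begin
      ℚ.∣ toℚ (+ 4) * (t * toℚ e) ∣
        ≡⟨ trans (ℚₚ.∣p*q∣≡∣p∣*∣q∣ (toℚ (+ 4)) (t * toℚ e)) (cong (toℚ (+ 4) *_) (ℚₚ.∣p*q∣≡∣p∣*∣q∣ t (toℚ e))) ⟩
      toℚ (+ 4) * (ℚ.∣ t ∣ * ℚ.∣ toℚ e ∣)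
        ≡⟨ cong₂ (λ x y → toℚ (+ 4) * (x * y)) (ℚₚ.0≤p⇒∣p∣≡p 0≤t) (toℚ-abs e) ⟩
      toℚ (+ 4) * (t * toℚ (+ ∣ e ∣))
        ≤⟨ ℚₚ.*-monoˡ-≤-nonNeg (toℚ (+ 4)) (ℚₚ.*-monoʳ-≤-nonNeg (toℚ (+ ∣ e ∣)) {{toℚ-nonNegative ∣ e ∣}} t≤1) ⟩
      toℚ (+ 4) * (1ℚ * toℚ (+ ∣ e ∣))
        ≡⟨ trans (cong (toℚ (+ 4) *_) (ℚₚ.*-identityˡ (toℚ (+ ∣ e ∣)))) (sym (toℚ-* (+ 4) (+ ∣ e ∣))) ⟩
      toℚ (+ 4 ℤ.* + ∣ e ∣)
        ≤⟨ toℚ-mono-≤ (ℤₚ.*-monoˡ-≤-nonNeg (+ 4) (ℤ.+≤+ e≤Q)) ⟩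
      toℚ (+ 4 ℤ.* + Q)
        ≡⟨ cong toℚ (ℤₚ.pos-* 4 Q) ⟨
      toℚ (+ (4 ℕ.* Q)) ∎
    triangle : ℚ.∣ (toℚ E + toℚ (+ 4) * (t * toℚ e)) - w ∣ ≤ toℚ (+ (Q ℕ.* (2 ℕ.* Q ℕ.+ 1) ℕ.+ 4 ℕ.* Q)) + ℚ.∣ w ∣
    triangle = begin
      ℚ.∣ (toℚ E + toℚ (+ 4) * (t * toℚ e)) - w ∣
        ≤⟨ ℚₚ.∣p-q∣≤∣p∣+∣q∣ (toℚ E + toℚ (+ 4) * (t * toℚ e)) w ⟩
      ℚ.∣ toℚ E + toℚ (+ 4) * (t * toℚ e) ∣ + ℚ.∣ w ∣
        ≤⟨ ℚₚ.+-monoˡ-≤ ℚ.∣ w ∣ (ℚₚ.≤-trans (ℚₚ.∣p+q∣≤∣p∣+∣q∣ (toℚ E) (toℚ (+ 4) * (t * toℚ e)))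
             (ℚₚ.+-mono-≤ (ℚₚ.≤-trans (ℚₚ.≤-reflexive (toℚ-abs E)) (toℚ-mono-≤ (ℤ.+≤+ tieB))) edge)) ⟩
      toℚ (+ (Q ℕ.* (2 ℕ.* Q ℕ.+ 1))) + toℚ (+ (4 ℕ.* Q)) + ℚ.∣ w ∣
        ≡⟨ cong (_+ ℚ.∣ w ∣) (toℚ-+ (+ (Q ℕ.* (2 ℕ.* Q ℕ.+ 1))) (+ (4 ℕ.* Q))) ⟨
      toℚ (+ (Q ℕ.* (2 ℕ.* Q ℕ.+ 1) ℕ.+ 4 ℕ.* Q)) + ℚ.∣ w ∣ ∎
    negligible : k′ * toℚ (+ (Q ℕ.* (2 ℕ.* Q ℕ.+ 1) ℕ.+ 4 ℕ.* Q)) ≤ K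
    negligible = begin
      k′ * toℚ (+ (Q ℕ.* (2 ℕ.* Q ℕ.+ 1) ℕ.+ 4 ℕ.* Q))
        ≡⟨ toℚ-* (+ k) (+ (Q ℕ.* (2 ℕ.* Q ℕ.+ 1) ℕ.+ 4 ℕ.* Q)) ⟨
      toℚ (+ k ℤ.* + (Q ℕ.* (2 ℕ.* Q ℕ.+ 1) ℕ.+ 4 ℕ.* Q))
        ≡⟨ cong toℚ (ℤₚ.pos-* k (Q ℕ.* (2 ℕ.* Q ℕ.+ 1) ℕ.+ 4 ℕ.* Q)) ⟨
      toℚ (+ (k ℕ.* (Q ℕ.* (2 ℕ.* Q ℕ.+ 1) ℕ.+ 4 ℕ.* Q)))
        ≤⟨ toℚ-mono-≤ (ℤ.+≤+ small) ⟩
      K ∎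

  -- Q (2Q + 1) comes from the ties and 4Q from the edge. Times 6k they give 12k Q² + 30k Q, whence
  -- 42 = 12 + 30, to be compared with Q³ ≤ 6K.
  negligible-perimeter : ∀ k Q K → 42 ℕ.* k ℕ.≤ Q → 1 ℕ.≤ Q → cube Q ℕ.≤ 6 ℕ.* K →
    k ℕ.* (Q ℕ.* (2 ℕ.* Q ℕ.+ 1) ℕ.+ 4 ℕ.* Q) ℕ.≤ K
  negligible-perimeter k Q K 42k≤Q 1≤Q large = ℕₚ.*-cancelˡ-≤ 6 (begin
    6 ℕ.* (k ℕ.* (Q ℕ.* (2 ℕ.* Q ℕ.+ 1) ℕ.+ 4 ℕ.* Q))
      ≡⟨ expand k Q ⟩
    12 ℕ.* k ℕ.* (Q ℕ.* Q) ℕ.+ 30 ℕ.* k ℕ.* (1 ℕ.* Q)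
      ≤⟨ ℕₚ.+-monoʳ-≤ (12 ℕ.* k ℕ.* (Q ℕ.* Q)) (ℕₚ.*-monoʳ-≤ (30 ℕ.* k) (ℕₚ.*-monoˡ-≤ Q 1≤Q)) ⟩
    12 ℕ.* k ℕ.* (Q ℕ.* Q) ℕ.+ 30 ℕ.* k ℕ.* (Q ℕ.* Q)
      ≡⟨ collect k Q ⟩
    42 ℕ.* k ℕ.* Q ℕ.* Q
      ≤⟨ ℕₚ.*-monoˡ-≤ Q (ℕₚ.*-monoˡ-≤ Q 42k≤Q) ⟩
    cube Q
      ≤⟨ large ⟩
    6 ℕ.* K ∎)
    where
    open ℕₚ.≤-Reasoning
    expand : ∀ k Q → 6 ℕ.* (k ℕ.* (Q ℕ.* (2 ℕ.* Q ℕ.+ 1) ℕ.+ 4 ℕ.* Q)) ≡ 12 ℕ.* k ℕ.* (Q ℕ.* Q) ℕ.+ 30 ℕ.* k ℕ.* (1 ℕ.* Q)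
    expand = solve-∀ℕ
    collect : ∀ k Q → 12 ℕ.* k ℕ.* (Q ℕ.* Q) ℕ.+ 30 ℕ.* k ℕ.* (Q ℕ.* Q) ≡ 42 ℕ.* k ℕ.* Q ℕ.* Q
    collect = solve-∀ℕ

  -- With k = 10 (n + 1) the error 5/k equals 1/(2 (n + 1)), at most ε/2.
  half-ε : ∀ u ε n → 1ℚ ≤ ε * toℚ (+ suc n) → ℚ.∣ u ∣ * toℚ (+ (10 ℕ.* suc n)) ≤ toℚ (+ 5) → toℚ (+ 2) * ℚ.∣ u ∣ ≤ ε
  half-ε u ε n 1≤εn bound = ℚₚ.*-cancelʳ-≤-pos (toℚ (+ 5)) (ℚₚ.*-cancelʳ-≤-pos n′ {{toℚ-positive n}} (begin
    toℚ (+ 2) * ℚ.∣ u ∣ * toℚ (+ 5) * n′     ≡⟨ regroup ℚ.∣ u ∣ n′ ⟩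
    ℚ.∣ u ∣ * (toℚ (+ 10) * n′)              ≡⟨ cong (ℚ.∣ u ∣ *_) (trans (cong toℚ (ℤₚ.pos-* 10 (suc n))) (toℚ-* (+ 10) (+ suc n))) ⟨
    ℚ.∣ u ∣ * toℚ (+ (10 ℕ.* suc n))         ≤⟨ bound ⟩
    toℚ (+ 5) * 1ℚ                           ≤⟨ ℚₚ.*-monoˡ-≤-nonNeg (toℚ (+ 5)) 1≤εn ⟩
    toℚ (+ 5) * (ε * n′)                     ≡⟨ swap ε n′ ⟩
    ε * toℚ (+ 5) * n′                       ∎))
    where
    open ℚₚ.≤-Reasoning
    n′ = toℚ (+ suc n)
    regroup : ∀ u n → toℚ (+ 2) * u * toℚ (+ 5) * n ≡ u * (toℚ (+ 10) * n)
    regroup = RingSolver.solve-∀ ℚ-ring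
    swap : ∀ ε n → toℚ (+ 5) * (ε * n) ≡ ε * toℚ (+ 5) * n
    swap = RingSolver.solve-∀ ℚ-ring

  square-≤ : ∀ u ε → 0ℚ < ε → toℚ (+ 2) * ℚ.∣ u ∣ ≤ ε → toℚ (+ 4) * (u * u) ≤ ε * ε
  square-≤ u ε 0<ε h = begin
    toℚ (+ 4) * (u * u)                                  ≡⟨ cong (toℚ (+ 4) *_) square-abs ⟩
    toℚ (+ 4) * (ℚ.∣ u ∣ * ℚ.∣ u ∣)                      ≡⟨ regroup ℚ.∣ u ∣ ⟩
    toℚ (+ 2) * ℚ.∣ u ∣ * (toℚ (+ 2) * ℚ.∣ u ∣)          ≤⟨ ℚₚ.*-monoˡ-≤-nonNeg (toℚ (+ 2) * ℚ.∣ u ∣)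
      {{ℚₚ.nonNeg*nonNeg⇒nonNeg (toℚ (+ 2)) ℚ.∣ u ∣ {{ℚₚ.∣-∣-nonNeg u}}}} h ⟩
    toℚ (+ 2) * ℚ.∣ u ∣ * ε                              ≤⟨ ℚₚ.*-monoʳ-≤-nonNeg ε {{ℚ.nonNegative (ℚₚ.<⇒≤ 0<ε)}} h ⟩
    ε * ε                                                ∎
    where
    open ℚₚ.≤-Reasoning
    regroup : ∀ v → toℚ (+ 4) * (v * v) ≡ toℚ (+ 2) * v * (toℚ (+ 2) * v)
    regroup = RingSolver.solve-∀ ℚ-ring
    negate : ∀ v → v * v ≡ - v * - v
    negate = RingSolver.solve-∀ ℚ-ring
    square-abs : u * u ≡ ℚ.∣ u ∣ * ℚ.∣ u ∣
    square-abs with ℚₚ.∣p∣≡p∨∣p∣≡-p u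
    ... | inj₁ eq = cong₂ _*_ (sym eq) (sym eq)
    ... | inj₂ eq = trans (negate u) (cong₂ _*_ (sym eq) (sym eq))

  -- Each square is at most ε²/4, so the sum is at most ε²/2; this slack gives the strict
  -- inequality.
  distance-bound : ∀ u v ε → 0ℚ < ε → toℚ (+ 2) * ℚ.∣ u ∣ ≤ ε → toℚ (+ 2) * ℚ.∣ v ∣ ≤ ε → u * u + v * v < ε * ε
  distance-bound u v ε 0<ε hu hv = ℚₚ.*-cancelˡ-<-nonNeg (toℚ (+ 4)) (begin-strict
    toℚ (+ 4) * (u * u + v * v)                ≡⟨ ℚₚ.*-distribˡ-+ (toℚ (+ 4)) (u * u) (v * v) ⟩
    toℚ (+ 4) * (u * u) + toℚ (+ 4) * (v * v)  ≤⟨ ℚₚ.+-mono-≤ (square-≤ u ε 0<ε hu) (square-≤ v ε 0<ε hv) ⟩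
    ε * ε + ε * ε                              ≡⟨ double (ε * ε) ⟩
    toℚ (+ 2) * (ε * ε)                        <⟨ ℚₚ.*-monoˡ-<-pos (ε * ε) {{ℚₚ.pos*pos⇒pos ε {{ℚ.positive 0<ε}} ε {{ℚ.positive 0<ε}}}} 2<4 ⟩
    toℚ (+ 4) * (ε * ε)                        ∎)
    where
    open ℚₚ.≤-Reasoning
    double : ∀ x → x + x ≡ toℚ (+ 2) * x
    double = RingSolver.solve-∀ ℚ-ring
    2<4 : toℚ (+ 2) < toℚ (+ 4)
    2<4 = ℚ.*<* (ℤ.+<+ (ℕ.s≤s (ℕ.s≤s (ℕ.s≤s ℕ.z≤n))))

  positive-value : ∀ K n → + ∣ K ∣ ≡ K → 1 ℕ.≤ n → n ℕ.≤ 6 ℕ.* ∣ K ∣ → Σ ℕ λ Kn → K ≡ + suc Kn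
  positive-value (+ zero) n _ 1≤n n≤0 = ⊥-elim (ℕₚ.<⇒≱ 1≤n n≤0)
  positive-value (+ suc Kn) _ _ _ _ = Kn , refl
  positive-value -[1+ _ ] _ () _ _

  module Approximation (k Q : ℕ) (λ₀ : ℚ) (isScale : IsScale Q λ₀) (e : V2) (e∈ : e ∈ VQ Q)
    (t : ℚ) (0≤t : 0ℚ ≤ t) (t≤1 : t ≤ 1ℚ) (1≤Q : 1 ℕ.≤ Q) (42k≤Q : 42 ℕ.* k ℕ.≤ Q)
    (large : cube Q ℕ.≤ 6 ℕ.* ∣ sumPrim Q upperY ∣) (near : Near Q k e) where

    K : ℤ
    K = sumPrim Q upperY

    c : Q2
    c = proj₁ (proj₂ near)

    positive-K : Σ ℕ λ Kn → K ≡ + suc Kn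
    positive-K = positive-value K (cube Q) (sumPrim-upperY-nonneg Q) (ℕₚ.*-mono-≤ (ℕₚ.*-mono-≤ 1≤Q 1≤Q) 1≤Q) large

    coordinate : ∀ S Sup U ei ctr ci → toℚ (+ 2) * ctr ≡ toℚ Sup → ∣ ei ∣ ℕ.≤ Q →
      ∣ + 2 ℤ.* (+ 2 ℤ.* S ℤ.- Sup) ℤ.+ + 2 ℤ.* U ∣ ℕ.≤ Q ℕ.* (2 ℕ.* Q ℕ.+ 1) → CloseTo k K U ci →
      ℚ.∣ λ₀ * (toℚ S + t * toℚ ei - ctr) - ci ∣ * toℚ (+ k) ≤ toℚ (+ 5)
    coordinate S Sup U ei ctr ci avg ei≤Q tied closeTo = coordinate-bound Q k (proj₁ positive-K) S Sup U ei λ₀ ctr t ci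
      (subst (λ z → λ₀ * toℚ z ≡ toℚ (+ 4)) (proj₂ positive-K) (scale-value Q λ₀ e∈ isScale)) avg 0≤t t≤1 ei≤Q tied
      (subst (λ z → CloseTo k z U ci) (proj₂ positive-K) closeTo)
      (subst (λ z → k ℕ.* (Q ℕ.* (2 ℕ.* Q ℕ.+ 1) ℕ.+ 4 ℕ.* Q) ℕ.≤ ∣ z ∣) (proj₂ positive-K)
        (negligible-perimeter k Q ∣ K ∣ 42k≤Q 1≤Q large))

    coordinate-x : ∀ px → px ≡ λ₀ * (toℚ (proj₁ (edgeStart Q e)) + t * toℚ (proj₁ e) - proj₁ (centre Q)) →
      ℚ.∣ px - proj₁ c ∣ * toℚ (+ k) ≤ toℚ (+ 5)
    coordinate-x px eq = subst (λ z → ℚ.∣ z - proj₁ c ∣ * toℚ (+ k) ≤ toℚ (+ 5))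
      (sym (trans eq (cong (λ S → λ₀ * (toℚ S + t * toℚ (proj₁ e) - proj₁ (centre Q))) (edgeStart-x Q e))))
      (coordinate (X.startSum Q e) (X.upperSum Q) (X.leftSum Q e) (proj₁ e) (proj₁ (centre Q)) (proj₁ c)
        (centre-x Q e∈) (proj₁ (proj₂ (∈-VQ Q e∈))) (X.twice-start-bound Q e (proj₁ near)) (proj₁ (proj₂ (proj₂ (proj₂ near)))))

    coordinate-y : ∀ py → py ≡ λ₀ * (toℚ (proj₂ (edgeStart Q e)) + t * toℚ (proj₂ e) - proj₂ (centre Q)) →
      ℚ.∣ py - proj₂ c ∣ * toℚ (+ k) ≤ toℚ (+ 5)
    coordinate-y py eq = subst (λ z → ℚ.∣ z - proj₂ c ∣ * toℚ (+ k) ≤ toℚ (+ 5))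
      (sym (trans eq (cong (λ S → λ₀ * (toℚ S + t * toℚ (proj₂ e) - proj₂ (centre Q))) (edgeStart-y Q e))))
      (coordinate (Y.startSum Q e) (Y.upperSum Q) (Y.leftSum Q e) (proj₂ e) (proj₂ (centre Q)) (proj₂ c)
        (centre-y Q e∈) (proj₂ (proj₂ (∈-VQ Q e∈))) (Y.twice-start-bound Q e (proj₁ near)) (proj₂ (proj₂ (proj₂ (proj₂ near)))))

  CoordinatewiseClose : ℕ → Set
  CoordinatewiseClose k = Σ ℕ λ Q₀ → ∀ Q → Q₀ ℕ.< Q → ∀ λ₀ → IsScale Q λ₀ → ∀ px py → OnScaledPolygon Q λ₀ (px , py) →
    Σ Q2 λ c → OnC c × ℚ.∣ px - proj₁ c ∣ * toℚ (+ k) ≤ toℚ (+ 5) × ℚ.∣ py - proj₂ c ∣ * toℚ (+ k) ≤ toℚ (+ 5)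

  approximation : ∀ k N → (∀ Q → N ℕ.≤ Q → cube Q ℕ.≤ 6 ℕ.* ∣ sumPrim Q upperY ∣) → CoordinatewiseClose k
  -- The sum dominates three thresholds: equidistribution, the size of K, and the smallness of ties
  -- and single edges.
  approximation k N N-large = Q₁ ℕ.+ (N ℕ.+ 42 ℕ.* k) , close
    where
    Q₁ : ℕ
    Q₁ = proj₁ (all-near k)
    close : ∀ Q → Q₁ ℕ.+ (N ℕ.+ 42 ℕ.* k) ℕ.< Q → ∀ λ₀ → IsScale Q λ₀ → ∀ px py → OnScaledPolygon Q λ₀ (px , py) →
      Σ Q2 λ c → OnC c × ℚ.∣ px - proj₁ c ∣ * toℚ (+ k) ≤ toℚ (+ 5) × ℚ.∣ py - proj₂ c ∣ * toℚ (+ k) ≤ toℚ (+ 5)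
    close Q Q₀<Q λ₀ isScale px py (e , e∈ , t , 0≤t , t≤1 , eqx , eqy) =
      c , proj₁ (proj₂ (proj₂ e-near)) , coordinate-x px eqx , coordinate-y py eqy
      where
      Q₀≤Q : Q₁ ℕ.+ (N ℕ.+ 42 ℕ.* k) ℕ.≤ Q
      Q₀≤Q = ℕₚ.<⇒≤ Q₀<Q
      rest≤Q : N ℕ.+ 42 ℕ.* k ℕ.≤ Q
      rest≤Q = ℕₚ.m+n≤o⇒n≤o Q₁ Q₀≤Q
      large : cube Q ℕ.≤ 6 ℕ.* ∣ sumPrim Q upperY ∣
      large = N-large Q (ℕₚ.m+n≤o⇒m≤o N rest≤Q)
      e-near : Near Q k e
      e-near = proj₂ (all-near k) Q (ℕₚ.m+n≤o⇒m≤o Q₁ Q₀≤Q) large e (proj₁ (∈-VQ Q e∈))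
      open Approximation k Q λ₀ isScale e e∈ t 0≤t t≤1 (ℕₚ.≤-trans (ℕ.s≤s ℕ.z≤n) Q₀<Q) (ℕₚ.m+n≤o⇒n≤o N rest≤Q) large e-near

  ClosePoints : ℚ → Set
  ClosePoints ε = Σ ℕ λ Q₀ → (Q : ℕ) → Q₀ ℕ.< Q →
      (λ₀ : ℚ) → IsScale Q λ₀ →
      (p : Q2) → OnScaledPolygon Q λ₀ p →
      Σ Q2 λ c → OnC c × (dist² p c ℚ.< ε ℚ.* ε)

  coordinatewise⇒close : ∀ ε → 0ℚ < ε → ∀ n k → k ≡ 10 ℕ.* suc n → 1ℚ ≤ ε * toℚ (+ suc n) → CoordinatewiseClose k → ClosePoints ε
  coordinatewise⇒close ε 0<ε n k k≡ 1≤εn (Q₀ , approximate) = Q₀ , close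
    where
    close : (Q : ℕ) → Q₀ ℕ.< Q → (λ₀ : ℚ) → IsScale Q λ₀ → (p : Q2) → OnScaledPolygon Q λ₀ p →
      Σ Q2 λ c → OnC c × (dist² p c ℚ.< ε ℚ.* ε)
    close Q Q₀<Q λ₀ isScale (px , py) p∈ = c , proj₁ (proj₂ found) ,
      distance-bound (px - proj₁ c) (py - proj₂ c) ε 0<ε
        (half (px - proj₁ c) (proj₁ (proj₂ (proj₂ found)))) (half (py - proj₂ c) (proj₂ (proj₂ (proj₂ found))))
      where
      found : Σ Q2 λ c → OnC c × ℚ.∣ px - proj₁ c ∣ * toℚ (+ k) ≤ toℚ (+ 5) × ℚ.∣ py - proj₂ c ∣ * toℚ (+ k) ≤ toℚ (+ 5)
      found = approximate Q Q₀<Q λ₀ isScale px py p∈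
      c : Q2
      c = proj₁ found
      half : ∀ u → ℚ.∣ u ∣ * toℚ (+ k) ≤ toℚ (+ 5) → toℚ (+ 2) * ℚ.∣ u ∣ ≤ ε
      half u bound = half-ε u ε n 1≤εn (subst (λ m → ℚ.∣ u ∣ * toℚ (+ m) ≤ toℚ (+ 5)) k≡ bound)

theorem1 : (ε : ℚ) → 0ℚ ℚ.< ε →
    Σ ℕ λ Q₀ → (Q : ℕ) → Q₀ ℕ.< Q →
    (λ₀ : ℚ) → IsScale Q λ₀ →
    (p : Q2) → OnScaledPolygon Q λ₀ p →
    Σ Q2 λ c → OnC c × (dist² p c ℚ.< ε ℚ.* ε)
theorem1 ε 0<ε = coordinatewise⇒close ε 0<ε n (10 ℕ.* suc n) refl (proj₂ (archimedean ε 0<ε))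
  (approximation (10 ℕ.* suc n) 1536 sumPrim-upperY≥)
  where
  n : ℕ
  n = proj₁ (archimedean ε 0<ε)
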